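{- There is an algorithm that solves \textsc{Symmetric Directed Vertex Multicut} in time $O\left((2\ell+1)^{2\ell}\, 4^k k^3 n^2\right)$, where, for an input instance $(D,C,k)$, $\ell=|C|$ is the number of cut requests, $k$ is the bound on the solution size and $n=|V(D)|$.
   Context: \textsc{Symmetric Directed Vertex Multicut} is the following problem. Input: a digraph $D$, a set of pairs of vertices of $D$ (the cut requests) $C=\{(s_1,t_1),\dots,(s_\ell,t_\ell)\}$, and an integer $k$. Output: find, if there exists one, a set $X\subseteq V(D)$ of at most $k$ vertices whose removal cuts, for every $i=1,\dots,\ell$, either all $(s_i,t_i)$-paths or all $(t_i,s_i)$-paths (otherwise report that no such set exists). Equivalently, for every $i$ such that $s_i,t_i\notin X$, the vertices $s_i$ and $t_i$ lie in distinct strongly connected components of $D-X$. The set $X$ is allowed to contain vertices $s_i$ or $t_i$; a cut request with an endpoint in $X$ is considered to be cut. -}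

module Defs where

open import Data.Bool using (Bool; true; false; T; not; if_then_else_)
open import Data.Fin using (Fin; toℕ)
open import Data.Fin.Subset using (Subset; _∈_; ∣_∣)
open import Data.List using (List; []; _∷_; length; map; allFin; cartesianProductWith)
open import Data.List.Relation.Unary.All using (All)
open import Data.List.Relation.Unary.Any using (Any)
open import Data.List.Relation.Unary.Unique.Propositional using (Unique)
open import Data.Maybe using (Maybe; just; nothing)
open import Data.Nat using (ℕ; zero; suc; _+_; _*_; _∸_; _^_; _⊔_; _≤_; _≡ᵇ_)
open import Data.Product using (Σ-syntax; _×_; _,_; proj₁; proj₂)
open import Data.Sum using (_⊎_)
open import Data.Vec using (tabulate)
open import Relation.Binary.PropositionalEquality using (_≡_; _≢_)
open import Relation.Nullary using (¬_)

------------------------------------------------------------------------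
-- Symmetric Directed Vertex Multicut

Digraph : ℕ → Set
Digraph n = Fin n → Fin n → Bool

-- Walks from u to v, indexed by the list of visited vertices (both
-- endpoints included).
data Walk {n : ℕ} (D : Digraph n) : Fin n → Fin n → List (Fin n) → Set where
  here : ∀ {u} → Walk D u u (u ∷ [])
  step : ∀ {u v w vs} → T (D u v) → Walk D v w vs → Walk D u w (u ∷ vs)

Path : ∀ {n} → Digraph n → Fin n → Fin n → List (Fin n) → Set
Path D u v vs = Walk D u v vs × Unique vs

-- X may contain u or v, in which case it cuts every (u , v)-path.
CutsAll : ∀ {n} → Digraph n → Subset n → Fin n → Fin n → Set
CutsAll D X u v = ∀ {vs} → Path D u v vs → Any (_∈ X) vs

-- The set of cut requests is a duplicate-free list, so that its
-- cardinality is the length of the list.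
record Instance : Set where
  field
    n      : ℕ
    D      : Digraph n
    C      : List (Fin n × Fin n)
    C-set  : Unique C
    k      : ℕ

  ℓ : ℕ
  ℓ = length C

IsSolution : (I : Instance) → Subset (Instance.n I) → Set
IsSolution I X =
  ∣ X ∣ ≤ k × All (λ (s , t) → CutsAll D X s t ⊎ CutsAll D X t s) C
  where open Instance I

CorrectAnswer : (I : Instance) → Maybe (Subset (Instance.n I)) → Set
CorrectAnswer I (just X) = IsSolution I X
CorrectAnswer I nothing  = ∀ X → ¬ IsSolution I X

------------------------------------------------------------------------
-- Algorithms: structured programs for a uniform-cost random access machine
--
-- Besides the registers, the memory is divided into arrays of unbounded
-- length.  A program mentions only finitely many of them, so interleaving
-- them in a single memory costs a constant factor.  The only arithmetic is
-- addition and truncated subtraction: unit-cost multiplication of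
-- unbounded integers would make the machine unrealistically powerful.

record Store : Set where
  constructor store
  field
    reg : ℕ → ℕ
    arr : ℕ → ℕ → ℕ

open Store public

infix  25 _⟦_⟧
infixl 20 _⊕_ _⊖_
infix  15 _≔_ _⟦_⟧≔_
infixr 10 _⨾_

data Exp : Set where
  lit     : ℕ → Exp
  var     : ℕ → Exp
  _⟦_⟧    : ℕ → Exp → Exp
  _⊕_ _⊖_ : Exp → Exp → Exp

data Program : Set where
  skip       : Program
  _≔_        : ℕ → Exp → Program
  _⟦_⟧≔_     : ℕ → Exp → Exp → Program
  _⨾_        : Program → Program → Program
  cond       : Exp → Program → Program → Program
  while      : Exp → Program → Program

eval : Store → Exp → ℕ
eval σ (lit m)   = m
eval σ (var x)   = reg σ x
eval σ (a ⟦ e ⟧) = arr σ a (eval σ e)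
eval σ (e ⊕ f)   = eval σ e + eval σ f
eval σ (e ⊖ f)   = eval σ e ∸ eval σ f

-- The number of memory accesses and arithmetic operations.
cost : Exp → ℕ
cost (lit m)   = 1
cost (var x)   = 1
cost (a ⟦ e ⟧) = 1 + cost e
cost (e ⊕ f)   = 1 + cost e + cost f
cost (e ⊖ f)   = 1 + cost e + cost f

update : {A : Set} → (ℕ → A) → ℕ → A → ℕ → A
update f i a j = if i ≡ᵇ j then a else f j

setReg : Store → ℕ → ℕ → Store
setReg σ x m = store (update (reg σ) x m) (arr σ)

setArr : Store → ℕ → ℕ → ℕ → Store
setArr σ a i m = store (reg σ) (update (arr σ) a (update (arr σ a) i m))

-- p ⊢ σ ⇓[ t ] τ : started in σ, the program p halts in τ after t steps.
-- A test succeeds when its value is nonzero.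
infix 4 _⊢_⇓[_]_

data _⊢_⇓[_]_ : Program → Store → ℕ → Store → Set where
  ⇓skip : ∀ {σ} → skip ⊢ σ ⇓[ 1 ] σ

  ⇓reg : ∀ {σ x e} →
    (x ≔ e) ⊢ σ ⇓[ 1 + cost e ] setReg σ x (eval σ e)

  ⇓arr : ∀ {σ a e f} →
    (a ⟦ e ⟧≔ f) ⊢ σ ⇓[ 1 + cost e + cost f ] setArr σ a (eval σ e) (eval σ f)

  ⇓seq : ∀ {p q σ τ υ t u} →
    p ⊢ σ ⇓[ t ] τ → q ⊢ τ ⇓[ u ] υ →
    (p ⨾ q) ⊢ σ ⇓[ t + u ] υ

  ⇓then : ∀ {e p q σ τ t} →
    eval σ e ≢ 0 → p ⊢ σ ⇓[ t ] τ →
    cond e p q ⊢ σ ⇓[ 1 + cost e + t ] τ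

  ⇓else : ∀ {e p q σ τ t} →
    eval σ e ≡ 0 → q ⊢ σ ⇓[ t ] τ →
    cond e p q ⊢ σ ⇓[ 1 + cost e + t ] τ

  ⇓loop : ∀ {e p σ τ υ t u} →
    eval σ e ≢ 0 → p ⊢ σ ⇓[ t ] τ → while e p ⊢ τ ⇓[ u ] υ →
    while e p ⊢ σ ⇓[ 1 + cost e + t + u ] υ

  ⇓exit : ∀ {e p σ} →
    eval σ e ≡ 0 →
    while e p ⊢ σ ⇓[ 1 + cost e ] σ

------------------------------------------------------------------------
-- Input and output

-- The i-th entry of a list, padded with zeros.
nth : List ℕ → ℕ → ℕ
nth []       _       = 0
nth (m ∷ ms) zero    = m
nth (m ∷ ms) (suc i) = nth ms i

bit : Bool → ℕ
bit true  = 1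
bit false = 0

-- Registers 0, 1, 2 hold n, ℓ, k.  Array 0 holds the adjacency matrix in
-- row-major order, arrays 1 and 2 the first and second components of the
-- cut requests.  Everything else is zero.
input : Instance → Store
input I = store regs arrs
  where
  open Instance I

  regs : ℕ → ℕ
  regs = nth (n ∷ ℓ ∷ k ∷ [])

  arrs : ℕ → ℕ → ℕ
  arrs 0 = nth (cartesianProductWith (λ u v → bit (D u v)) (allFin n) (allFin n))
  arrs 1 = nth (map (λ r → toℕ (proj₁ r)) C)
  arrs 2 = nth (map (λ r → toℕ (proj₂ r)) C)
  arrs _ = λ _ → 0

-- Register 0 tells whether a solution was found; if so, array 3 holds its
-- characteristic vector.
output : ∀ n → Store → Maybe (Subset n)
output n σ =
  if reg σ 0 ≡ᵇ 0
  then nothing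
  else just (tabulate (λ v → not (arr σ 3 (toℕ v) ≡ᵇ 0)))

-- Read literally, the bound vanishes when k = 0 or n = 0, where no
-- algorithm can meet it; as usual in O-notation these factors are taken to
-- be at least 1.
bound : Instance → ℕ
bound I = (2 * ℓ + 1) ^ (2 * ℓ) * 4 ^ k * (k ⊔ 1) ^ 3 * (n ⊔ 1) ^ 2
  where open Instance I

SolvesInTime : Program → (Instance → ℕ) → Instance → Set
SolvesInTime p f I =
  Σ[ t ∈ ℕ ] Σ[ σ ∈ Store ]
    (p ⊢ input I ⇓[ t ] σ) × CorrectAnswer I (output (Instance.n I) σ) × t ≤ f I

-- Deleting an endpoint of every request is a solution, so at most K = min k ℓ
-- deletions need to be considered, and the bound leaves room for trying all
-- (16 ℓ)^ℓ strings of advice.  Direct the i-th request from source i to sink i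
-- against a topological order of the components of D - X and rank the
-- requests by the positions of their sinks: then no source of rank at least ρ
-- reaches a sink of rank ρ, a skew multicut.  The ranks and directions are
-- part of the advice.  For ρ = 0, 1, … the algorithm finds the minimum vertex
-- cut between the sources of rank at least ρ and the sinks of rank ρ that is
-- closest to the sources.  Some solution is pushed at least that close, so
-- for a vertex v of the cut either v can be deleted or v can be treated as a
-- further sink, as the next bit of the advice decides.  The first option
-- spends a deletion and the second one raises the minimum cut, which bounds
-- the number of bits by 2 K.
--
-- Flows are handled through their residual networks r only: the invariant is
-- that for every cut W the r-capacity of W plus the value of the flow is the
-- capacity of W.  Minimality of the closest cut and the pushing argument
-- follow, because no residual arc leaves the set reached from the sources.

module Submission where

open import Data.Bool using (Bool; true; false; T; not; if_then_else_; _∧_; _∨_)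
open import Data.Bool.Properties using (T-≡; ∨-zeroʳ)
open import Data.Empty using (⊥; ⊥-elim)
open import Data.Fin using (Fin; zero; suc; toℕ; fromℕ<)
open import Data.Fin.Properties using (toℕ<n; toℕ-fromℕ<; fromℕ<-toℕ; toℕ-injective; pigeonhole)
open import Data.Fin.Subset using (Subset; _∈_; _∉_; ∣_∣)
open import Data.List using (List; []; _∷_; _++_; length; map; cartesianProductWith) renaming (tabulate to tabulateₗ)
open import Data.List.Relation.Unary.All using (All; []; _∷_)
open import Data.List.Relation.Unary.Any using (Any)
open import Data.Nat
open import Data.Nat.Properties
open import Data.Nat.Tactic.RingSolver using (solve-∀)
open import Data.Product using (Σ; Σ-syntax; _×_; _,_; proj₁; proj₂)
open import Data.Sum using (_⊎_; inj₁; inj₂; [_,_]′)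
open import Data.List.Membership.Propositional using () renaming (_∈_ to _∈ₗ_)
open import Data.List.Relation.Unary.AllPairs using ([]; _∷_)
import Data.List.Relation.Unary.Any as Any
import Data.List.Relation.Unary.All as All
import Data.List.Relation.Unary.All.Properties as All
import Data.Fin.Properties as Fin
import Data.Fin.Subset.Properties as Subset
open import Data.List.Properties using (length-map; length-tabulate)
import Data.Vec as Vec
import Data.Vec.Properties as Vec
open import Data.Unit using (tt)
open import Data.Vec using (tabulate)
open import Function using (_∘_; id; case_of_; Equivalence)
open import Relation.Binary.Definitions using (tri<; tri≈; tri>)
open import Relation.Binary.PropositionalEquality
open import Relation.Nullary using (¬_; yes; no; contradiction)
open import Defs

-- Program logic

-- A run on one string of advice takes O(ℓ^2 n^2) steps: 3 ℓ stages with at most K + 1 breadth-first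
-- searches each, and every search reads the residual network once. The 3 ℓ accounts for 2 K
-- decisions and ℓ advances of the rank, as K ≤ ℓ. The two directions of correctness are unequal.
-- Soundness holds for arbitrary advice: every completed rank leaves behind a set closed in D - X
-- that contains the sources and misses the sinks in question. Completeness only has to refute a
-- claimed solution, so reachability in D - X, the ranking built on it and the decision bits exist
-- merely under double negation, and nothing is decided outside the machine. Program and
-- completeness argument meet in a step relation on abstract states. It describes cuts by their
-- properties instead of computing them; since the closest cut is unique, the outcome of a stage is
-- determined all the same, and bits chosen in the argument are right for the actual run.

infixr 10 _⨟_

-- Loops only count up to a register, so that termination and a polynomial time bound follow from
-- the syntax. The one unrestricted loop is the outer one over the advice.
data Code : Set where
  nop     : Code
  assign  : ℕ → Exp → Code
  write   : ℕ → Exp → Exp → Code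
  _⨟_     : Code → Code → Code
  branch  : Exp → Code → Code → Code
  forloop : ℕ → ℕ → Code → Code

⟪_⟫ : Code → Program
⟪ nop ⟫           = skip
⟪ assign x e ⟫    = x ≔ e
⟪ write a e f ⟫   = a ⟦ e ⟧≔ f
⟪ p ⨟ q ⟫         = ⟪ p ⟫ ⨾ ⟪ q ⟫
⟪ branch e p q ⟫  = cond e ⟪ p ⟫ ⟪ q ⟫
⟪ forloop x b p ⟫ = x ≔ lit 0 ⨾ while (var b ⊖ var x) (⟪ p ⟫ ⨾ x ≔ var x ⊕ lit 1)

-- Boolean and syntactic, so that side conditions about concrete programs hold by `refl`.
writesReg : Program → ℕ → Bool
writesReg skip           y = false
writesReg (x ≔ e)        y = x ≡ᵇ y
writesReg (a ⟦ e ⟧≔ f)   y = false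
writesReg (p ⨾ q)        y = writesReg p y ∨ writesReg q y
writesReg (cond e p q)   y = writesReg p y ∨ writesReg q y
writesReg (while e p)    y = writesReg p y

writesArr : Program → ℕ → Bool
writesArr skip           b = false
writesArr (x ≔ e)        b = false
writesArr (a ⟦ e ⟧≔ f)   b = a ≡ᵇ b
writesArr (p ⨾ q)        b = writesArr p b ∨ writesArr q b
writesArr (cond e p q)   b = writesArr p b ∨ writesArr q b
writesArr (while e p)    b = writesArr p b

∨-false : ∀ a {b} → a ∨ b ≡ false → a ≡ false × b ≡ false
∨-false false eq = refl , eq

reg-frame : ∀ {p σ t τ} → p ⊢ σ ⇓[ t ] τ → ∀ y → writesReg p y ≡ false → reg τ y ≡ reg σ y
reg-frame ⇓skip y w = refl
reg-frame ⇓reg y w rewrite w = refl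
reg-frame ⇓arr y w = refl
reg-frame (⇓seq {p} d e) y w with ∨-false (writesReg p y) w
... | v , w = trans (reg-frame e y w) (reg-frame d y v)
reg-frame (⇓then {p = p} _ d) y w = reg-frame d y (proj₁ (∨-false (writesReg p y) w))
reg-frame (⇓else {p = p} _ d) y w = reg-frame d y (proj₂ (∨-false (writesReg p y) w))
reg-frame (⇓loop _ d e) y w = trans (reg-frame e y w) (reg-frame d y w)
reg-frame (⇓exit _) y w = refl

arr-frame : ∀ {p σ t τ} → p ⊢ σ ⇓[ t ] τ → ∀ b → writesArr p b ≡ false → arr τ b ≡ arr σ b
arr-frame ⇓skip b w = refl
arr-frame ⇓reg b w = refl
arr-frame ⇓arr b w rewrite w = refl
arr-frame (⇓seq {p} d e) b w with ∨-false (writesArr p b) w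
... | v , w = trans (arr-frame e b w) (arr-frame d b v)
arr-frame (⇓then {p = p} _ d) b w = arr-frame d b (proj₁ (∨-false (writesArr p b) w))
arr-frame (⇓else {p = p} _ d) b w = arr-frame d b (proj₂ (∨-false (writesArr p b) w))
arr-frame (⇓loop _ d e) b w = trans (arr-frame e b w) (arr-frame d b w)
arr-frame (⇓exit _) b w = refl

record Frame (p : Program) (σ τ : Store) : Set where
  constructor frame
  field
    regs : ∀ y → writesReg p y ≡ false → reg τ y ≡ reg σ y
    arrs : ∀ b → writesArr p b ≡ false → arr τ b ≡ arr σ b

open Frame public

frame-of : ∀ {p σ t τ} → p ⊢ σ ⇓[ t ] τ → Frame p σ τ
frame-of d = frame (reg-frame d) (arr-frame d)

≡ᵇ-refl : ∀ m → (m ≡ᵇ m) ≡ true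
≡ᵇ-refl zero    = refl
≡ᵇ-refl (suc m) = ≡ᵇ-refl m

-- Partial correctness only: the induction is on a given derivation, and termination is established
-- separately by the cost analysis. The frame relates each iteration to the store before the loop,
-- so an invariant need only mention what the body changes.
while-invariant : ∀ (Inv : ℕ → Store → Set) {x b p σ τ t} i →
  writesReg p x ≡ false → writesReg p b ≡ false → (x ≡ᵇ b) ≡ false →
  (∀ {j υ ω u} → j < reg σ b → reg υ x ≡ j → Frame (p ⨾ x ≔ var x ⊕ lit 1) σ υ →
    p ⊢ υ ⇓[ u ] ω → Inv j υ → Inv (suc j) (setReg ω x (suc j))) →
  ∀ {υ} → reg υ x ≡ i → i ≤ reg σ b → Frame (p ⨾ x ≔ var x ⊕ lit 1) σ υ → Inv i υ →
  while (var b ⊖ var x) (p ⨾ x ≔ var x ⊕ lit 1) ⊢ υ ⇓[ t ] τ → Inv (reg σ b) τ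
while-invariant Inv {x} {b} {p} {σ} i wx wb x≢b each {υ} x≡i i≤b F inv (⇓loop ne (⇓seq {τ = ω} d ⇓reg) e) =
  while-invariant Inv (suc i) wx wb x≢b each next-x i<b F′ inv′ e
  where
  b≡ : reg υ b ≡ reg σ b
  b≡ = regs F b (cong₂ _∨_ wb x≢b)

  i<b : i < reg σ b
  i<b = ≰⇒> λ b≤i → ne (trans (cong₂ _∸_ b≡ x≡i) (m≤n⇒m∸n≡0 b≤i))

  next : reg ω x + 1 ≡ suc i
  next = trans (+-comm _ 1) (cong suc (trans (reg-frame d x wx) x≡i))

  next-x : reg (setReg ω x (reg ω x + 1)) x ≡ suc i
  next-x rewrite ≡ᵇ-refl x = next

  F′ : Frame (p ⨾ x ≔ var x ⊕ lit 1) σ (setReg ω x (reg ω x + 1))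
  F′ = frame (λ y w → trans (reg-frame (⇓seq d (⇓reg {x = x} {e = var x ⊕ lit 1})) y w) (regs F y w))
             (λ a w → trans (arr-frame (⇓seq d (⇓reg {x = x} {e = var x ⊕ lit 1})) a w) (arrs F a w))

  inv′ : Inv (suc i) (setReg ω x (reg ω x + 1))
  inv′ = subst (λ m → Inv (suc i) (setReg ω x m)) (sym next) (each i<b x≡i F d inv)
while-invariant Inv {x} {b} {p} {σ} i wx wb x≢b each {υ} x≡i i≤b F inv (⇓exit ez) =
  subst (λ m → Inv m υ) (≤-antisym i≤b b≤i) inv
  where
  b≤i : reg σ b ≤ i
  b≤i = m∸n≡0⇒m≤n (trans (sym (cong₂ _∸_ (regs F b (cong₂ _∨_ wb x≢b)) x≡i)) ez)

for-invariant : ∀ (Inv : ℕ → Store → Set) p {x b σ τ t} →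
  ⟪ forloop x b p ⟫ ⊢ σ ⇓[ t ] τ →
  writesReg ⟪ p ⟫ x ≡ false → writesReg ⟪ p ⟫ b ≡ false → (x ≡ᵇ b) ≡ false →
  Inv 0 (setReg σ x 0) →
  (∀ {j υ ω u} → j < reg σ b → reg υ x ≡ j → Frame ⟪ forloop x b p ⟫ σ υ →
    ⟪ p ⟫ ⊢ υ ⇓[ u ] ω → Inv j υ → Inv (suc j) (setReg ω x (suc j))) →
  Inv (reg σ b) τ
for-invariant Inv p {x} {b} {σ} (⇓seq ⇓reg d) wx wb x≢b inv each =
  subst (λ m → Inv m _) σ₀b
    (while-invariant Inv {σ = setReg σ x 0} 0 wx wb x≢b
      (λ {j} {υ} j<b x≡j F → each (subst (j <_) σ₀b j<b) x≡j (frame (fr F) (arrs F)))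
      x₀ z≤n (frame (λ _ _ → refl) (λ _ _ → refl)) inv d)
  where
  σ₀b : reg (setReg σ x 0) b ≡ reg σ b
  σ₀b rewrite x≢b = refl

  x₀ : reg (setReg σ x 0) x ≡ 0
  x₀ rewrite ≡ᵇ-refl x = refl

  fr : ∀ {υ} → Frame (⟪ p ⟫ ⨾ x ≔ var x ⊕ lit 1) (setReg σ x 0) υ →
    ∀ y → (x ≡ᵇ y) ∨ (writesReg ⟪ p ⟫ y ∨ (x ≡ᵇ y)) ≡ false → reg υ y ≡ reg σ y
  fr F y w with ∨-false (x ≡ᵇ y) w
  ... | x≢y , w rewrite x≢y = trans (regs F y (trans (cong (writesReg ⟪ p ⟫ y ∨_) x≢y) w))
                                  (cong (λ c → if c then 0 else reg σ y) x≢y)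

≢⇒≡ᵇ-false : ∀ {m n} → m ≢ n → (m ≡ᵇ n) ≡ false
≢⇒≡ᵇ-false {m} {n} m≢n with m ≡ᵇ n in eq
... | false = refl
... | true  = contradiction (≡ᵇ⇒≡ m n (subst T (sym eq) tt)) m≢n

≢true⇒false : ∀ {b} → b ≢ true → b ≡ false
≢true⇒false {false} _  = refl
≢true⇒false {true}  nt = contradiction refl nt

<ᵇ-sound : ∀ {m n} → (m <ᵇ n) ≡ true → m < n
<ᵇ-sound {m} {n} e = <ᵇ⇒< m n (subst T (sym e) tt)

<ᵇ-complete : ∀ {m n} → m < n → (m <ᵇ n) ≡ true
<ᵇ-complete m<n = Equivalence.to T-≡ (<⇒<ᵇ m<n)

≥⇒<ᵇ-false : ∀ {m n} → n ≤ m → (m <ᵇ n) ≡ false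
≥⇒<ᵇ-false n≤m = ≢true⇒false λ e → <⇒≱ (<ᵇ-sound e) n≤m

≤ᵇ-sound : ∀ {m n} → (m ≤ᵇ n) ≡ true → m ≤ n
≤ᵇ-sound {m} {n} e = ≤ᵇ⇒≤ m n (subst T (sym e) tt)

update-same : ∀ {A : Set} (f : ℕ → A) i {a} → update f i a i ≡ a
update-same f i rewrite ≡ᵇ-refl i = refl

update-other : ∀ {A : Set} (f : ℕ → A) {i j a} → i ≢ j → update f i a j ≡ f j
update-other f i≢j rewrite ≢⇒≡ᵇ-false i≢j = refl

-- Running time

constants : ℕ
constants = 7

-- Loop bounds are read from the registers below `constants`, which bounded
-- code does not write.
bounded : Code → Bool
bounded nop             = true
bounded (assign x e)    = constants ≤ᵇ x
bounded (write a e f)   = true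
bounded (p ⨟ q)         = bounded p ∧ bounded q
bounded (branch e p q)  = bounded p ∧ bounded q
bounded (forloop x b p) = (constants ≤ᵇ x) ∧ (b <ᵇ constants) ∧ not (writesReg ⟪ p ⟫ x) ∧ bounded p

∧-split : ∀ a {b} → a ∧ b ≡ true → a ≡ true × b ≡ true
∧-split true eq = refl , eq

not-true : ∀ {a} → not a ≡ true → a ≡ false
not-true {false} eq = refl

high≢low : ∀ x y → (constants ≤ᵇ x) ≡ true → y < constants → (x ≡ᵇ y) ≡ false
high≢low x y c≤x y<c = ≢⇒≡ᵇ-false λ x≡y →
  <⇒≱ y<c (subst (constants ≤_) x≡y (≤ᵇ-sound {constants} {x} c≤x))

bounded-keeps : ∀ p {y} → bounded p ≡ true → y < constants → writesReg ⟪ p ⟫ y ≡ false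
bounded-keeps nop _ _ = refl
bounded-keeps (assign x e) {y} w y<c = high≢low x y w y<c
bounded-keeps (write a e f) _ _ = refl
bounded-keeps (p ⨟ q) w y<c with ∧-split (bounded p) w
... | v , w = cong₂ _∨_ (bounded-keeps p v y<c) (bounded-keeps q w y<c)
bounded-keeps (branch e p q) w y<c with ∧-split (bounded p) w
... | v , w = cong₂ _∨_ (bounded-keeps p v y<c) (bounded-keeps q w y<c)
bounded-keeps (forloop x b p) {y} w y<c with ∧-split (constants ≤ᵇ x) w
... | w₁ , w with ∧-split (b <ᵇ constants) w
... | w₂ , w with ∧-split (not (writesReg ⟪ p ⟫ x)) w
... | w₃ , w₄ = cong₂ _∨_ x≢y (cong₂ _∨_ (bounded-keeps p w₄ y<c) x≢y)
  where x≢y = high≢low x y w₁ y<c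

-- Registers 0 and 3 will hold n and 2 n. All other loop bounds are O(ℓ), as the solution size is
-- truncated to at most ℓ.
big : ℕ → Bool
big b = (b ≡ᵇ 0) ∨ (b ≡ᵇ 3)

-- The running time is bounded by the monomial `coef p * (M ^ degM p * L ^ degL p)`. Taking the
-- maximum of exponents in a sequence is sound because both bases are at least 1.
degM : Code → ℕ
degM nop             = 0
degM (assign x e)    = 0
degM (write a e f)   = 0
degM (p ⨟ q)         = degM p ⊔ degM q
degM (branch e p q)  = degM p ⊔ degM q
degM (forloop x b p) = if big b then suc (degM p) else degM p

degL : Code → ℕ
degL nop             = 0
degL (assign x e)    = 0
degL (write a e f)   = 0
degL (p ⨟ q)         = degL p ⊔ degL q
degL (branch e p q)  = degL p ⊔ degL q
degL (forloop x b p) = if big b then degL p else suc (degL p)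

coef : Code → ℕ
coef nop             = 1
coef (assign x e)    = 1 + cost e
coef (write a e f)   = 1 + cost e + cost f
coef (p ⨟ q)         = coef p + coef q
coef (branch e p q)  = 1 + cost e + (coef p + coef q)
-- Initialisation costs 2, the final test 4, and each iteration 4 for the test and 4 for the
-- increment. The 5 covers the largest loop bound, the 5 ℓ digits of the advice.
coef (forloop x b p) = 6 + 5 * (8 + coef p)

module Timing (M L : ℕ) (M≥1 : 1 ≤ M) (L≥1 : 1 ≤ L) where

  scale : ℕ → ℕ
  scale b = if big b then M else L

  volume : Code → ℕ
  volume p = M ^ degM p * L ^ degL p

  Bounds : Store → Set
  Bounds σ = ∀ b → b < constants → reg σ b ≤ 5 * scale b

  Halts : Program → ℕ → Store → Set
  Halts p t σ = Σ[ u ∈ ℕ ] Σ[ τ ∈ Store ] (p ⊢ σ ⇓[ u ] τ) × u ≤ t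

  pow-mono : ∀ {M m m′} → 1 ≤ M → m ≤ m′ → M ^ m ≤ M ^ m′
  pow-mono {suc _} _ = ^-monoʳ-≤ _

  pow-pos : ∀ {M} m → 1 ≤ M → 1 ≤ M ^ m
  pow-pos m M≥1 = pow-mono M≥1 (z≤n {m})

  volume-pos : ∀ p → 1 ≤ volume p
  volume-pos p = *-mono-≤ (pow-pos (degM p) M≥1) (pow-pos (degL p) L≥1)

  volume-seqˡ : ∀ p q → volume p ≤ M ^ (degM p ⊔ degM q) * L ^ (degL p ⊔ degL q)
  volume-seqˡ p q = *-mono-≤ (pow-mono M≥1 (m≤m⊔n (degM p) (degM q))) (pow-mono L≥1 (m≤m⊔n (degL p) (degL q)))

  volume-seqʳ : ∀ p q → volume q ≤ M ^ (degM p ⊔ degM q) * L ^ (degL p ⊔ degL q)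
  volume-seqʳ p q = *-mono-≤ (pow-mono M≥1 (m≤n⊔m (degM p) (degM q))) (pow-mono L≥1 (m≤n⊔m (degL p) (degL q)))

  volume-for : ∀ x b p → volume (forloop x b p) ≡ scale b * volume p
  volume-for x b p with big b
  ... | true  = *-assoc M _ _
  ... | false = (λ a b c → trans (sym (*-assoc a b c)) (trans (cong (_* c) (*-comm a b)) (*-assoc b a c)))
                  (M ^ degM p) L (L ^ degL p)

  scale-pos : ∀ b → 1 ≤ scale b
  scale-pos b with big b
  ... | true  = M≥1
  ... | false = L≥1

  keep-bounds : ∀ p {σ t τ} → bounded p ≡ true → ⟪ p ⟫ ⊢ σ ⇓[ t ] τ → Bounds σ → Bounds τ
  keep-bounds p w d B b b<c = subst (_≤ 5 * scale b) (sym (reg-frame d b (bounded-keeps p w b<c))) (B b b<c)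

  set-bounds : ∀ x m σ → (constants ≤ᵇ x) ≡ true → Bounds σ → Bounds (setReg σ x m)
  set-bounds x m σ hx B y y<c =
    subst (λ c → (if c then m else reg σ y) ≤ 5 * scale y) (sym (high≢low x y hx y<c)) (B y y<c)

  private
    both : ∀ {a b} u v {W} → a ≤ u * W → b ≤ v * W → a + b ≤ (u + v) * W
    both {a} {b} u v {W} p q = subst (a + b ≤_) (sym (*-distribʳ-+ W u v)) (+-mono-≤ p q)

    lift : ∀ {a} u {V W} → a ≤ u * V → V ≤ W → a ≤ u * W
    lift u p V≤W = ≤-trans p (*-monoʳ-≤ u V≤W)

    loop-arith : ∀ c s V → 1 ≤ s → 1 ≤ V → 6 + 5 * s * (8 + c * V) ≤ (6 + 5 * (8 + c)) * (s * V)
    loop-arith c s V s≥1 V≥1 = begin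
      6 + 5 * s * (8 + c * V)               ≤⟨ +-mono-≤ (m≤m*n≥1 6 (*-mono-≤ s≥1 V≥1))
                                                 (*-monoʳ-≤ (5 * s) (+-monoˡ-≤ (c * V) (m≤m*n≥1 8 V≥1))) ⟩
      6 * (s * V) + 5 * s * (8 * V + c * V) ≡⟨ rearrange c s V ⟩
      (6 + 5 * (8 + c)) * (s * V)           ∎
      where
      open ≤-Reasoning
      m≤m*n≥1 : ∀ m {n} → 1 ≤ n → m ≤ m * n
      m≤m*n≥1 m {n} n≥1 = subst (_≤ m * n) (*-identityʳ m) (*-monoʳ-≤ m n≥1)
      rearrange : ∀ c s V → 6 * (s * V) + 5 * s * (8 * V + c * V) ≡ (6 + 5 * (8 + c)) * (s * V)
      rearrange = solve-∀

  loop-halts : ∀ x b p t → (x ≡ᵇ b) ≡ false → bounded p ≡ true → writesReg ⟪ p ⟫ x ≡ false →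
    (constants ≤ᵇ x) ≡ true → b < constants →
    (∀ σ → Bounds σ → Halts ⟪ p ⟫ t σ) →
    ∀ j σ → reg σ b ∸ reg σ x ≡ j → Bounds σ →
    Halts (while (var b ⊖ var x) (⟪ p ⟫ ⨾ x ≔ var x ⊕ lit 1)) (4 + j * (8 + t)) σ
  loop-halts x b p t x≢b wp wx hx b<c body zero σ eq B = _ , _ , ⇓exit eq , ≤-refl
  loop-halts x b p t x≢b wp wx hx b<c body (suc j) σ eq B
    with body σ B
  ... | u , υ , d , u≤t
    with loop-halts x b p t x≢b wp wx hx b<c body j (setReg υ x (reg υ x + 1)) next B′
    where
    next : reg (setReg υ x (reg υ x + 1)) b ∸ reg (setReg υ x (reg υ x + 1)) x ≡ j
    next rewrite x≢b | ≡ᵇ-refl x | reg-frame d x wx | reg-frame d b (bounded-keeps p wp b<c) | +-comm (reg σ x) 1 =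
      trans (sym (pred[m∸n]≡m∸[1+n] (reg σ b) (reg σ x))) (cong pred eq)
    B′ : Bounds (setReg υ x (reg υ x + 1))
    B′ = set-bounds x _ υ hx (keep-bounds p wp d B)
  ... | v , τ , e , v≤ =
    _ , _ , ⇓loop (λ z → case trans (sym eq) z of λ ()) (⇓seq d ⇓reg) e , (begin
      4 + (u + 4) + v              ≤⟨ +-mono-≤ (+-monoʳ-≤ 4 (+-monoˡ-≤ 4 u≤t)) v≤ ⟩
      4 + (t + 4) + (4 + j * (8 + t)) ≡⟨ rearrange t (j * (8 + t)) ⟩
      4 + (8 + t + j * (8 + t))    ∎)
    where
    open ≤-Reasoning
    rearrange : ∀ t k → 4 + (t + 4) + (4 + k) ≡ 4 + (8 + t + k)
    rearrange = solve-∀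

  test-cost : ∀ e p q → 1 + cost e ≤ (1 + cost e) * volume (p ⨟ q)
  test-cost e p q = ≤-trans (≤-reflexive (sym (*-identityʳ _))) (*-monoʳ-≤ (1 + cost e) (volume-pos (p ⨟ q)))

  halts : ∀ p → bounded p ≡ true → ∀ σ → Bounds σ → Halts ⟪ p ⟫ (coef p * volume p) σ
  halts nop w σ B = _ , _ , ⇓skip , ≤-refl
  halts (assign x e) w σ B = _ , _ , ⇓reg , ≤-reflexive (sym (*-identityʳ _))
  halts (write a e f) w σ B = _ , _ , ⇓arr , ≤-reflexive (sym (*-identityʳ _))
  halts (p ⨟ q) w σ B with ∧-split (bounded p) w
  ... | wp , wq with halts p wp σ B
  ... | t , τ , d , t≤ with halts q wq τ (keep-bounds p wp d B)
  ... | u , υ , e , u≤ =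
    _ , _ , ⇓seq d e , both (coef p) (coef q) (lift (coef p) t≤ (volume-seqˡ p q)) (lift (coef q) u≤ (volume-seqʳ p q))
  halts (branch e p q) w σ B with ∧-split (bounded p) w
  ... | wp , wq with eval σ e in eq
  ...   | zero with halts q wq σ B
  ...     | t , τ , d , t≤ =
    _ , _ , ⇓else eq d , both (1 + cost e) (coef p + coef q) (test-cost e p q)
      (≤-trans (lift (coef q) t≤ (volume-seqʳ p q)) (*-monoˡ-≤ _ (m≤n+m (coef q) (coef p))))
  halts (branch e p q) w σ B | wp , wq | suc m with halts p wp σ B
  ...     | t , τ , d , t≤ =
    _ , _ , ⇓then (λ z → case trans (sym eq) z of λ ()) d , both (1 + cost e) (coef p + coef q) (test-cost e p q)
      (≤-trans (lift (coef p) t≤ (volume-seqˡ p q)) (*-monoˡ-≤ _ (m≤m+n (coef p) (coef q))))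
  halts (forloop x b p) w σ B with ∧-split (constants ≤ᵇ x) w
  ... | hx , w with ∧-split (b <ᵇ constants) w
  ... | hb , w with ∧-split (not (writesReg ⟪ p ⟫ x)) w
  ... | w₃ , wp
    with loop-halts x b p (coef p * volume p) (high≢low x b hx b<c) wp (not-true w₃) hx b<c (halts p wp)
           (reg σ b) (setReg σ x 0) start B₀
    where
    b<c : b < constants
    b<c = <ᵇ-sound hb
    start : reg (setReg σ x 0) b ∸ reg (setReg σ x 0) x ≡ reg σ b
    start rewrite high≢low x b hx b<c | ≡ᵇ-refl x = refl
    B₀ : Bounds (setReg σ x 0)
    B₀ = set-bounds x 0 σ hx B
  ... | t , τ , d , t≤ = _ , _ , ⇓seq ⇓reg d , (begin
      2 + t                                              ≤⟨ +-monoʳ-≤ 2 t≤ ⟩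
      6 + reg σ b * (8 + coef p * volume p)
        ≤⟨ +-monoʳ-≤ 6 (*-monoˡ-≤ (8 + coef p * volume p) (B b (<ᵇ-sound hb))) ⟩
      6 + 5 * scale b * (8 + coef p * volume p)
        ≤⟨ loop-arith (coef p) (scale b) (volume p) (scale-pos b) (volume-pos p) ⟩
      (6 + 5 * (8 + coef p)) * (scale b * volume p)
        ≡⟨ cong ((6 + 5 * (8 + coef p)) *_) (sym (volume-for x b p)) ⟩
      (6 + 5 * (8 + coef p)) * volume (forloop x b p)    ∎)
    where open ≤-Reasoning

  -- The equations allow a caller to replace the coefficient by an abstract name, so that the
  -- numeral is not unfolded in later arithmetic.
  halts-within : ∀ p {c a b} → coef p ≡ c → degM p ≡ a → degL p ≡ b → bounded p ≡ true →
    ∀ σ → Bounds σ → Halts ⟪ p ⟫ (c * (M ^ a * L ^ b)) σ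
  halts-within p refl refl refl = halts p

-- Finite sums and numerals

∑ : ℕ → (ℕ → ℕ) → ℕ
∑ zero    f = 0
∑ (suc n) f = f 0 + ∑ n (f ∘ suc)

∑-cong : ∀ n {f g} → (∀ i → i < n → f i ≡ g i) → ∑ n f ≡ ∑ n g
∑-cong zero    eq = refl
∑-cong (suc n) eq = cong₂ _+_ (eq 0 z<s) (∑-cong n λ i i<n → eq (suc i) (s<s i<n))

∑-mono : ∀ n {f g} → (∀ i → i < n → f i ≤ g i) → ∑ n f ≤ ∑ n g
∑-mono zero    le = z≤n
∑-mono (suc n) le = +-mono-≤ (le 0 z<s) (∑-mono n λ i i<n → le (suc i) (s<s i<n))

∑-mono-< : ∀ n {f g} → (∀ i → i < n → f i ≤ g i) → ∀ j → j < n → f j < g j → ∑ n f < ∑ n g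
∑-mono-< (suc n) le zero    _         lt = +-mono-<-≤ lt (∑-mono n λ i i<n → le (suc i) (s<s i<n))
∑-mono-< (suc n) le (suc j) (s<s j<n) lt =
  +-mono-≤-< (le 0 z<s) (∑-mono-< n (λ i i<n → le (suc i) (s<s i<n)) j j<n lt)

∑-zero : ∀ n {f} → (∀ i → i < n → f i ≡ 0) → ∑ n f ≡ 0
∑-zero zero    eq = refl
∑-zero (suc n) eq = cong₂ _+_ (eq 0 z<s) (∑-zero n λ i i<n → eq (suc i) (s<s i<n))

∑-term : ∀ n f i → i < n → f i ≤ ∑ n f
∑-term (suc n) f zero    _         = m≤m+n (f 0) _
∑-term (suc n) f (suc i) (s<s i<n) = ≤-trans (∑-term n (f ∘ suc) i i<n) (m≤n+m _ (f 0))

∑-split : ∀ m n f → ∑ (m + n) f ≡ ∑ m f + ∑ n (λ i → f (m + i))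
∑-split zero    n f = refl
∑-split (suc m) n f = trans (cong (f 0 +_) (∑-split m n (f ∘ suc))) (sym (+-assoc (f 0) _ _))

∑-+ : ∀ n f g → ∑ n (λ i → f i + g i) ≡ ∑ n f + ∑ n g
∑-+ zero    f g = refl
∑-+ (suc n) f g = trans (cong (f 0 + g 0 +_) (∑-+ n (f ∘ suc) (g ∘ suc))) (exchange (f 0) (g 0) _ _)
  where
  exchange : ∀ a b c d → a + b + (c + d) ≡ a + c + (b + d)
  exchange = solve-∀

-- The difference of two sums that disagree at one index, arranged without truncated subtraction.
∑-change : ∀ n {f g} i → i < n → (∀ j → j < n → j ≢ i → f j ≡ g j) → ∑ n g + f i ≡ ∑ n f + g i
∑-change (suc n) {f} {g} zero i<n eq
  rewrite ∑-cong n {f ∘ suc} {g ∘ suc} (λ j j<n → eq (suc j) (s<s j<n) λ ()) = rotate (g 0) _ (f 0)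
  where
  rotate : ∀ a b c → a + b + c ≡ c + b + a
  rotate = solve-∀
∑-change (suc n) {f} {g} (suc i) (s<s i<n) eq = begin
  g 0 + ∑ n (g ∘ suc) + f (suc i)   ≡⟨ +-assoc (g 0) _ _ ⟩
  g 0 + (∑ n (g ∘ suc) + f (suc i))
    ≡⟨ cong₂ _+_ (sym (eq 0 z<s λ ())) (∑-change n i i<n λ j j<n j≢i → eq (suc j) (s<s j<n) (j≢i ∘ suc-injective)) ⟩
  f 0 + (∑ n (f ∘ suc) + g (suc i)) ≡⟨ sym (+-assoc (f 0) _ _) ⟩
  f 0 + ∑ n (f ∘ suc) + g (suc i)   ∎
  where open ≡-Reasoning

∑-single : ∀ n {f} i → i < n → (∀ j → j < n → j ≢ i → f j ≡ 0) → ∑ n f ≡ f i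
∑-single n {f} i i<n eq = begin
  ∑ n f                  ≡⟨ sym (+-identityʳ _) ⟩
  ∑ n f + 0              ≡⟨ sym (∑-change n i i<n eq) ⟩
  ∑ n (λ _ → 0) + f i    ≡⟨ cong (_+ f i) (∑-zero n λ _ _ → refl) ⟩
  f i                    ∎
  where open ≡-Reasoning

-- Mixed radix numerals, least significant digit first.

place : (ℕ → ℕ) → ℕ → ℕ
place base zero    = 1
place base (suc m) = base m * place base m

value : (ℕ → ℕ) → ℕ → (ℕ → ℕ) → ℕ
value base zero    g = 0
value base (suc m) g = value base m g + g m * place base m

Digits : (ℕ → ℕ) → ℕ → (ℕ → ℕ) → Set
Digits base m g = ∀ i → i < m → g i < base i

value-cong : ∀ base m {g h} → (∀ i → i < m → g i ≡ h i) → value base m g ≡ value base m h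
value-cong base zero    eq = refl
value-cong base (suc m) eq =
  cong₂ (λ a b → a + b * place base m) (value-cong base m λ i i<m → eq i (m<n⇒m<1+n i<m)) (eq m ≤-refl)

value-zero : ∀ base m {g} → (∀ i → i < m → g i ≡ 0) → value base m g ≡ 0
value-zero base zero    eq = refl
value-zero base (suc m) eq =
  cong₂ (λ a b → a + b * place base m) (value-zero base m λ i i<m → eq i (m<n⇒m<1+n i<m)) (eq m ≤-refl)

value<place : ∀ base m {g} → Digits base m g → value base m g < place base m
value<place base zero    _ = z<s
value<place base (suc m) {g} d = begin-strict
  value base m g + g m * place base m <⟨ +-monoˡ-< _ (value<place base m λ i i<m → d i (m<n⇒m<1+n i<m)) ⟩
  suc (g m) * place base m            ≤⟨ *-monoˡ-≤ (place base m) (d m ≤-refl) ⟩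
  base m * place base m               ∎
  where open ≤-Reasoning

-- Uniqueness of division with remainder; serves the digits of numerals as well as row-major
-- addresses.
quotient-unique : ∀ {P a b} c d → a < P → b < P → a + c * P ≡ b + d * P → a ≡ b × c ≡ d
quotient-unique {P} {a} {b} c d a<P b<P eq with <-cmp c d
... | tri< c<d _ _ = contradiction eq (<⇒≢ (begin-strict
  a + c * P       <⟨ +-monoˡ-< (c * P) a<P ⟩
  suc c * P       ≤⟨ *-monoˡ-≤ P c<d ⟩
  d * P           ≤⟨ m≤n+m _ b ⟩
  b + d * P       ∎))
  where open ≤-Reasoning
... | tri≈ _ refl _ = +-cancelʳ-≡ (c * P) a b eq , refl
... | tri> _ _ d<c = contradiction (sym eq) (<⇒≢ (begin-strict
  b + d * P       <⟨ +-monoˡ-< (d * P) b<P ⟩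
  suc d * P       ≤⟨ *-monoˡ-≤ P d<c ⟩
  c * P           ≤⟨ m≤n+m _ a ⟩
  a + c * P       ∎))
  where open ≤-Reasoning

<-suc-cases : ∀ {i m} → i < suc m → i < m ⊎ i ≡ m
<-suc-cases (s≤s i≤m) = m≤n⇒m<n∨m≡n i≤m

value-injective : ∀ base m {g h} → Digits base m g → Digits base m h →
  value base m g ≡ value base m h → ∀ i → i < m → g i ≡ h i
value-injective base (suc m) {g} {h} dg dh eq i i<m
  with quotient-unique (g m) (h m)
         (value<place base m λ j j<m → dg j (m<n⇒m<1+n j<m))
         (value<place base m λ j j<m → dh j (m<n⇒m<1+n j<m)) eq
... | eq′ , gm≡hm with <-suc-cases i<m
... | inj₁ i<m = value-injective base m (λ j j<m → dg j (m<n⇒m<1+n j<m)) (λ j j<m → dh j (m<n⇒m<1+n j<m)) eq′ i i<m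
... | inj₂ refl = gm≡hm

value-mono : ∀ base m {g h} → (∀ i → i < m → g i ≤ h i) → value base m g ≤ value base m h
value-mono base zero    le = z≤n
value-mono base (suc m) le =
  +-mono-≤ (value-mono base m λ i i<m → le i (m<n⇒m<1+n i<m)) (*-monoˡ-≤ (place base m) (le m ≤-refl))

place-+ : ∀ base m n → place base (n + m) ≡ place (λ i → base (i + m)) n * place base m
place-+ base m zero    = sym (*-identityˡ _)
place-+ base m (suc n) = trans (cong (base (n + m) *_) (place-+ base m n)) (sym (*-assoc (base (n + m)) _ _))

place-const : ∀ base b m → (∀ i → i < m → base i ≡ b) → place base m ≡ b ^ m
place-const base b zero    eq = refl
place-const base b (suc m) eq =
  cong₂ _*_ (eq m ≤-refl) (place-const base b m λ i i<m → eq i (m<n⇒m<1+n i<m))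

-- Cuts and residual networks

true≢false : ∀ {b} → b ≡ true → b ≢ false
true≢false refl ()

true-or-false : ∀ b → b ≡ true ⊎ b ≡ false
true-or-false true  = inj₁ refl
true-or-false false = inj₂ refl

∧-join : ∀ {a b} → a ≡ true → b ≡ true → a ∧ b ≡ true
∧-join refl refl = refl

∧-falseʳ : ∀ a {b} → b ≡ false → a ∧ b ≡ false
∧-falseʳ true  refl = refl
∧-falseʳ false _    = refl

not-false : ∀ {a} → a ≡ false → not a ≡ true
not-false refl = refl

bit≤1 : ∀ b → bit b ≤ 1
bit≤1 true  = ≤-refl
bit≤1 false = z≤n

bit-mono : ∀ {a b} → (a ≡ true → b ≡ true) → bit a ≤ bit b
bit-mono {false} _ = z≤n
bit-mono {true}  i rewrite i refl = ≤-refl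

bit≡0 : ∀ {b} → bit b ≡ 0 → b ≡ false
bit≡0 {false} _ = refl

insert : ℕ → (ℕ → Bool) → ℕ → Bool
insert v f i = (v ≡ᵇ i) ∨ f i

insert-same : ∀ v f → insert v f v ≡ true
insert-same v f rewrite ≡ᵇ-refl v = refl

insert-other : ∀ {v i} f → v ≢ i → insert v f i ≡ f i
insert-other f v≢i rewrite ≢⇒≡ᵇ-false v≢i = refl

insert-old : ∀ v {i} f → f i ≡ true → insert v f i ≡ true
insert-old v {i} f eq with v ≡ᵇ i
... | true  = refl
... | false = eq

size-insert : ∀ n v f → v < n → ∑ n (bit ∘ insert v f) ≤ suc (∑ n (bit ∘ f))
size-insert n v f v<n = begin
  ∑ n (bit ∘ insert v f)                ≤⟨ m≤m+n _ (bit (f v)) ⟩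
  ∑ n (bit ∘ insert v f) + bit (f v)
    ≡⟨ ∑-change n v v<n (λ w _ w≢v → cong bit (sym (insert-other f (w≢v ∘ sym)))) ⟩
  ∑ n (bit ∘ f) + bit (insert v f v)    ≤⟨ +-monoʳ-≤ (∑ n (bit ∘ f)) (bit≤1 _) ⟩
  ∑ n (bit ∘ f) + 1                     ≡⟨ +-comm _ 1 ⟩
  suc (∑ n (bit ∘ f))                   ∎
  where open ≤-Reasoning

-- A vertex v of the digraph is split into the node v, where arcs enter,
-- and the node n + v, where arcs leave.
module Network (n K : ℕ) (adj : ℕ → ℕ → Bool) where

  N : ℕ
  N = n + n

  in< : ∀ {v} → v < n → v < N
  in< v<n = <-≤-trans v<n (m≤m+n n n)

  out< : ∀ {v} → v < n → n + v < N
  out< v<n = +-monoʳ-< n v<n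

  crosses : (ℕ → Bool) → ℕ → ℕ → Bool
  crosses W x y = W x ∧ not (W y)

  crossing : (ℕ → Bool) → (ℕ → ℕ → ℕ) → ℕ
  crossing W r = ∑ N λ x → ∑ N λ y → if crosses W x y then r x y else 0

  -- These are the vertices whose unit arc from in-node to out-node crosses the cut. A deleted
  -- vertex has capacity 0 and does not count.
  boundary : (ℕ → Bool) → (ℕ → Bool) → ℕ → Bool
  boundary X W v = W v ∧ (not (W (n + v)) ∧ not (X v))

  leak : (ℕ → Bool) → ℕ → ℕ → Bool
  leak W u v = (W (n + u) ∧ not (W v)) ∧ adj u v

  -- Arcs of the digraph must not be cut. The capacity K + 1 acts as infinity, because only cuts of
  -- capacity at most K are of interest.
  leaks : (ℕ → Bool) → ℕ
  leaks W = ∑ n λ u → ∑ n λ v → if leak W u v then suc K else 0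

  capacity : (ℕ → Bool) → (ℕ → Bool) → ℕ
  capacity X W = ∑ n (bit ∘ boundary X W) + leaks W

  record Capacities (X : ℕ → Bool) (r : ℕ → ℕ → ℕ) : Set where
    field
      in-in    : ∀ u v → u < n → v < n → r u v ≡ 0
      in-out   : ∀ v → v < n → r v (n + v) ≡ bit (not (X v))
      in-out′  : ∀ u v → u < n → v < n → u ≢ v → r u (n + v) ≡ 0
      out-in   : ∀ u v → u < n → v < n → r (n + u) v ≡ (if adj u v then suc K else 0)
      out-out  : ∀ u v → u < n → v < n → r (n + u) (n + v) ≡ 0

  private
    if-zero : ∀ b {m} → m ≡ 0 → (if b then m else 0) ≡ 0
    if-zero true  eq = eq
    if-zero false eq = refl

    in-out-term : ∀ a b c → (if a ∧ not b then bit (not c) else 0) ≡ bit (a ∧ (not b ∧ not c))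
    in-out-term true  true  c = refl
    in-out-term true  false c = refl
    in-out-term false b     c = refl

    out-in-term : ∀ (a b c : Bool) {m : ℕ} →
      (if a ∧ not b then (if c then m else 0) else 0) ≡ (if (a ∧ not b) ∧ c then m else 0)
    out-in-term true  true  c = refl
    out-in-term true  false c = refl
    out-in-term false b     c = refl

  crossing-capacities : ∀ {X r} W → Capacities X r → crossing W r ≡ capacity X W
  crossing-capacities {X} {r} W cap = trans (∑-split n n _) (cong₂ _+_ (∑-cong n ins) (∑-cong n outs))
    where
    open Capacities cap
    ins : ∀ u → u < n → (∑ N λ y → if crosses W u y then r u y else 0) ≡ bit (boundary X W u)
    ins u u<n = begin
      (∑ N λ y → if crosses W u y then r u y else 0)
        ≡⟨ ∑-split n n _ ⟩
      (∑ n λ y → if crosses W u y then r u y else 0) + (∑ n λ v → if crosses W u (n + v) then r u (n + v) else 0)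
        ≡⟨ cong₂ _+_ (∑-zero n λ v v<n → if-zero (crosses W u v) (in-in u v u<n v<n))
             (∑-single n u u<n λ v v<n v≢u → if-zero (crosses W u (n + v)) (in-out′ u v u<n v<n (v≢u ∘ sym))) ⟩
      (if crosses W u (n + u) then r u (n + u) else 0)
        ≡⟨ cong (λ m → if crosses W u (n + u) then m else 0) (in-out u u<n) ⟩
      (if crosses W u (n + u) then bit (not (X u)) else 0)
        ≡⟨ in-out-term (W u) (W (n + u)) (X u) ⟩
      bit (boundary X W u) ∎
      where open ≡-Reasoning

    outs : ∀ u → u < n → (∑ N λ y → if crosses W (n + u) y then r (n + u) y else 0) ≡
                         (∑ n λ v → if leak W u v then suc K else 0)
    outs u u<n = begin
      (∑ N λ y → if crosses W (n + u) y then r (n + u) y else 0)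
        ≡⟨ ∑-split n n _ ⟩
      (∑ n λ v → if crosses W (n + u) v then r (n + u) v else 0) + (∑ n λ v → if crosses W (n + u) (n + v) then r (n + u) (n + v) else 0)
        ≡⟨ cong₂ _+_ (∑-cong n λ v v<n → trans (cong (λ m → if crosses W (n + u) v then m else 0)
            (out-in u v u<n v<n)) (out-in-term (W (n + u)) (W v) (adj u v)))
             (∑-zero n λ v v<n → if-zero (crosses W (n + u) (n + v)) (out-out u v u<n v<n)) ⟩
      (∑ n λ v → if leak W u v then suc K else 0) + 0
        ≡⟨ +-identityʳ _ ⟩
      (∑ n λ v → if leak W u v then suc K else 0) ∎
      where open ≡-Reasoning

  crossing-change : ∀ W {r r′ : ℕ → ℕ → ℕ} u v → u < N → v < N →
    (∀ x y → x < N → y < N → (x ≢ u ⊎ y ≢ v) → r x y ≡ r′ x y) →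
    crossing W r′ + (if crosses W u v then r u v else 0) ≡ crossing W r + (if crosses W u v then r′ u v else 0)
  crossing-change W {r} {r′} u v u<N v<N eq =
    -- `∑-change` is applied to the sum over rows and then inside row u; the old sum of row u occurs
    -- on both sides and is cancelled.
    +-cancelʳ-≡ (row r u) _ _ (begin
      crossing W r′ + cell r u v + row r u     ≡⟨ swap (crossing W r′) _ _ ⟩
      crossing W r′ + row r u + cell r u v
        ≡⟨ cong (_+ cell r u v) (∑-change N u u<N λ x x<N x≢u → ∑-cong N λ y y<N → cong
            (λ m → if crosses W x y then m else 0) (eq x y x<N y<N (inj₁ x≢u))) ⟩
      crossing W r + row r′ u + cell r u v     ≡⟨ +-assoc (crossing W r) _ _ ⟩
      crossing W r + (row r′ u + cell r u v)
        ≡⟨ cong (crossing W r +_) (∑-change N v v<N λ y y<N y≢v → cong (λ m → if crosses W u y then m else 0) (eq u y u<N y<N (inj₂ y≢v))) ⟩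
      crossing W r + (row r u + cell r′ u v)   ≡⟨ swap′ (crossing W r) _ _ ⟩
      crossing W r + cell r′ u v + row r u     ∎)
    where
    open ≡-Reasoning
    cell : (ℕ → ℕ → ℕ) → ℕ → ℕ → ℕ
    cell r x y = if crosses W x y then r x y else 0
    row : (ℕ → ℕ → ℕ) → ℕ → ℕ
    row r x = ∑ N (cell r x)
    swap : ∀ a b c → a + b + c ≡ a + c + b
    swap = solve-∀
    swap′ : ∀ a b c → a + (b + c) ≡ a + c + b
    swap′ = solve-∀

  record Valid (Z T : ℕ → Set) (W : ℕ → Bool) : Set where
    constructor valid
    field
      contains : ∀ x → x < N → Z x → W x ≡ true
      avoids   : ∀ x → x < N → T x → W x ≡ false

  open Valid public

  -- r is the residual network of a flow of value f.  Only this consequence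
  -- of flow conservation is needed.
  Residual : (X : ℕ → Bool) (Z T : ℕ → Set) (r : ℕ → ℕ → ℕ) (f : ℕ) → Set
  Residual X Z T r f = ∀ W → Valid Z T W → crossing W r + f ≡ capacity X W

  infixr 6 _∩_
  _∩_ : (ℕ → Bool) → (ℕ → Bool) → ℕ → Bool
  (U ∩ W) x = U x ∧ W x

  -- By `closest`, Q lies inside every minimum cut. `uncross` is what submodularity yields once the
  -- union with Q is known to cost at least as much as Q.
  record ClosestCut (X : ℕ → Bool) (Z T : ℕ → Set) (Q : ℕ → Bool) : Set where
    field
      isCut   : Valid Z T Q
      small   : capacity X Q ≤ K
      least   : ∀ W → Valid Z T W → capacity X Q ≤ capacity X W
      closest : ∀ W → Valid Z T W → ∀ x → x < N → Q x ≡ true → W x ≡ false → capacity X Q < capacity X W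
      uncross : ∀ W → Valid Z T W → capacity X (W ∩ Q) ≤ capacity X W

  -- `order` decreases towards the roots, so `parent` bounds Q from above by the reachable nodes
  -- without any mention of paths.
  record Reached (Z : ℕ → Set) (r : ℕ → ℕ → ℕ) (Q : ℕ → Bool) : Set where
    field
      roots  : ∀ x → x < N → Z x → Q x ≡ true
      closed : ∀ x y → x < N → y < N → Q x ≡ true → r x y ≢ 0 → Q y ≡ true
      order  : ℕ → ℕ
      parent : ∀ x → x < N → Q x ≡ true →
        Z x ⊎ Σ[ p ∈ ℕ ] (p < N × Q p ≡ true × order p < order x × r p x ≢ 0)

  crossing-term : ∀ W r x y → x < N → y < N → W x ≡ true → W y ≡ false → r x y ≤ crossing W r
  crossing-term W r x y x<N y<N Wx Wy = begin
    r x y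
      ≡⟨ sym (cong₂ (λ a b → if a ∧ not b then r x y else 0) Wx Wy) ⟩
    (if crosses W x y then r x y else 0)             ≤⟨ ∑-term N _ y y<N ⟩
    (∑ N λ y → if crosses W x y then r x y else 0)
      ≤⟨ ∑-term N (λ x → ∑ N λ y → if crosses W x y then r x y else 0) x x<N ⟩
    crossing W r                                     ∎
    where open ≤-Reasoning

  -- The residual crossing of Q is 0, so the invariant at Q says that f is the capacity of Q; at any
  -- other W the excess over f is the residual crossing of W. This is max-flow min-cut.
  reached-closest : ∀ {X Z T r f Q} → Residual X Z T r f → f ≤ K → Reached Z r Q →
    (∀ x → x < N → T x → Q x ≡ false) → ClosestCut X Z T Q
  reached-closest {X} {Z} {T} {r} {f} {Q} res f≤K reached Q-avoids = record
    { isCut   = Q-valid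
    ; small   = subst (_≤ K) f≡ f≤K
    ; least   = λ W v → subst (_≤ capacity X W) f≡ (subst (f ≤_) (res W v) (m≤n+m f _))
    ; closest = λ W v x x<N Qx Wx → subst (_< capacity X W) f≡
        (subst (f <_) (res W v) (m<n+m f (n≢0⇒n>0 (escape W v x x<N Qx Wx))))
    ; uncross = λ W v → subst₂ _≤_ (res (W ∩ Q) (meet W v)) (res W v) (+-monoˡ-≤ f (smaller W))
    }
    where
    open Reached reached
    Q-valid : Valid Z T Q
    Q-valid = valid roots Q-avoids

    none : ∀ x y → x < N → y < N → (if crosses Q x y then r x y else 0) ≡ 0
    none x y x<N y<N with Q x in Qx | Q y in Qy
    ... | false | _     = refl
    ... | true  | true  = refl
    ... | true  | false with r x y in rxy
    ...   | zero  = refl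
    ...   | suc _ = contradiction Qy (true≢false (closed x y x<N y<N Qx λ z → case trans (sym rxy) z of λ ()))

    f≡ : f ≡ capacity X Q
    f≡ = trans (cong (_+ f) (sym (∑-zero N λ x x<N → ∑-zero N λ y y<N → none x y x<N y<N))) (res Q Q-valid)

    -- The parents of x lead from outside W to a root inside W. The tree arc on which this changes
    -- crosses W and has positive residual capacity.
    escape-below : ∀ W → Valid Z T W → ∀ b x → order x < b → x < N → Q x ≡ true → W x ≡ false → crossing W r ≢ 0
    escape-below W v (suc b) x ox<b x<N Qx Wx with parent x x<N Qx
    ... | inj₁ Zx = contradiction Wx (true≢false (contains v x x<N Zx))
    ... | inj₂ (p , p<N , Qp , op<ox , rpx) with W p in Wp
    ...   | false = escape-below W v b p (<-≤-trans op<ox (s≤s⁻¹ ox<b)) p<N Qp Wp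
    ...   | true  = λ z → rpx (n≤0⇒n≡0 (subst (r p x ≤_) z (crossing-term W r p x p<N x<N Wp Wx)))

    escape : ∀ W → Valid Z T W → ∀ x → x < N → Q x ≡ true → W x ≡ false → crossing W r ≢ 0
    escape W v x = escape-below W v (suc (order x)) x ≤-refl

    meet : ∀ W → Valid Z T W → Valid Z T (W ∩ Q)
    meet W v = valid
      (λ x x<N Zx → ∧-join (contains v x x<N Zx) (roots x x<N Zx))
      (λ x x<N Tx → cong (_∧ Q x) (avoids v x x<N Tx))

    -- An arc that crosses W ∩ Q but not W leaves Q, where the residual capacity is 0.
    smaller-term : ∀ W x y → x < N → y < N →
      (if crosses (W ∩ Q) x y then r x y else 0) ≤ (if crosses W x y then r x y else 0)
    smaller-term W x y x<N y<N with W x | Q x in Qx | W y | Q y in Qy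
    ... | false | _     | _     | _     = z≤n
    ... | true  | false | _     | _     = z≤n
    ... | true  | true  | false | _     = ≤-refl
    ... | true  | true  | true  | true  = z≤n
    ... | true  | true  | true  | false with r x y in rxy
    ...   | zero  = z≤n
    ...   | suc _ = contradiction Qy (true≢false (closed x y x<N y<N Qx λ z → case trans (sym rxy) z of λ ()))

    smaller : ∀ W → crossing (W ∩ Q) r ≤ crossing W r
    smaller W = ∑-mono N λ x x<N → ∑-mono N λ y y<N → smaller-term W x y x<N y<N

  -- Both cuts are minimum, so a node in only one of them would make the other strictly more
  -- expensive. The outcome of a stage is therefore determined by the state.
  closest-unique : ∀ {X Z T Q Q′} → ClosestCut X Z T Q → ClosestCut X Z T Q′ → ∀ x → x < N → Q x ≡ Q′ x
  closest-unique {Q = Q} {Q′} c c′ x x<N with Q x in Qx | Q′ x in Q′x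
  ... | true  | true  = refl
  ... | false | false = refl
  ... | true  | false = contradiction (ClosestCut.least c′ Q (ClosestCut.isCut c))
                          (<⇒≱ (ClosestCut.closest c Q′ (ClosestCut.isCut c′) x x<N Qx Q′x))
  ... | false | true  = contradiction (ClosestCut.least c Q′ (ClosestCut.isCut c′))
                          (<⇒≱ (ClosestCut.closest c′ Q (ClosestCut.isCut c) x x<N Q′x Qx))

  -- No walk of D - X leads out of W: a certificate of unreachability that needs no paths and
  -- survives further deletions.
  record Closed (X W : ℕ → Bool) : Set where
    constructor isClosed
    field
      no-boundary : ∀ v → v < n → boundary X W v ≡ false
      no-leak     : ∀ u v → u < n → v < n → leak W u v ≡ false

  open Closed public

  size : (ℕ → Bool) → ℕ
  size Y = ∑ n (bit ∘ Y)

  infixr 5 _∪_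
  _∪_ : (ℕ → Bool) → (ℕ → Bool) → ℕ → Bool
  (X ∪ Y) v = X v ∨ Y v

  capacity-cong : ∀ {X X′} W → (∀ v → v < n → X v ≡ X′ v) → capacity X W ≡ capacity X′ W
  capacity-cong W eq = cong (_+ leaks W)
    (∑-cong n λ v v<n → cong (λ b → bit (W v ∧ (not (W (n + v)) ∧ not b))) (eq v v<n))

  leak-free : ∀ {W} → leaks W ≤ K → ∀ u v → u < n → v < n → leak W u v ≡ false
  leak-free {W} le u v u<n v<n with leak W u v in eq
  ... | false = refl
  ... | true  = contradiction (begin-strict
    K                                                     <⟨ ≤-refl ⟩
    suc K                                                 ≡⟨ cong (λ b → if b then suc K else 0) (sym eq) ⟩
    (if leak W u v then suc K else 0)                     ≤⟨ ∑-term n _ v v<n ⟩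
    (∑ n λ v → if leak W u v then suc K else 0)
      ≤⟨ ∑-term n (λ u → ∑ n λ v → if leak W u v then suc K else 0) u u<n ⟩
    leaks W                                               ≤⟨ le ⟩
    K                                                     ∎) (<-irrefl refl)
    where open ≤-Reasoning

  no-leaks : ∀ {W} → (∀ u v → u < n → v < n → leak W u v ≡ false) → leaks W ≡ 0
  no-leaks lf = ∑-zero n λ u u<n → ∑-zero n λ v v<n → cong (λ b → if b then suc K else 0) (lf u v u<n v<n)

  boundary-mono : ∀ {X X′ W} v → (X v ≡ true → X′ v ≡ true) → boundary X W v ≡ false → boundary X′ W v ≡ false
  boundary-mono {X} {X′} {W} v imp eq with W v | W (n + v) | X v | X′ v
  ... | false | _     | _     | _     = refl
  ... | true  | true  | _     | _     = refl
  ... | true  | false | false | _     = case eq of λ ()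
  ... | true  | false | true  | true  = refl
  ... | true  | false | true  | false = case imp refl of λ ()

  closed-mono : ∀ {X X′ W} → (∀ v → v < n → X v ≡ true → X′ v ≡ true) → Closed X W → Closed X′ W
  closed-mono {X} {X′} {W} imp c = isClosed
    (λ v v<n → boundary-mono {X} {X′} {W} v (imp v v<n) (no-boundary c v v<n)) (no-leak c)

  boundary⊆ : ∀ {X Y U} → Closed (X ∪ Y) U → ∀ v → v < n → boundary X U v ≡ true → Y v ≡ true
  boundary⊆ {X} {Y} {U} c v v<n bd with U v | U (n + v) | X v | Y v | no-boundary c v v<n
  ... | true | false | false | true  | _  = refl
  ... | true | false | false | false | ()

  -- Once Y is deleted too, nothing leaves U, so every vertex in its boundary is paid for by Y.
  capacity-closed : ∀ {X Y U} → Closed (X ∪ Y) U → capacity X U ≤ size Y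
  capacity-closed {X} {Y} {U} c = begin
    ∑ n (bit ∘ boundary X U) + leaks U ≡⟨ cong (∑ n (bit ∘ boundary X U) +_) (no-leaks {U} (no-leak c)) ⟩
    ∑ n (bit ∘ boundary X U) + 0       ≡⟨ +-identityʳ _ ⟩
    ∑ n (bit ∘ boundary X U)           ≤⟨ ∑-mono n (λ v v<n → bit-mono (boundary⊆ {X} {Y} {U} c v v<n)) ⟩
    size Y                             ∎
    where open ≤-Reasoning

  capacity-delete : ∀ X W v → v < n → capacity X W ≤ suc (capacity (insert v X) W)
  capacity-delete X W v v<n = +-monoˡ-≤ (leaks W) (begin
    ∑ n (bit ∘ boundary X W)
      ≤⟨ m≤m+n _ (bit (boundary (insert v X) W v)) ⟩
    ∑ n (bit ∘ boundary X W) + bit (boundary (insert v X) W v)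
      ≡⟨ sym (∑-change n v v<n λ w w<n w≢v →
           cong (λ b → bit (W w ∧ (not (W (n + w)) ∧ not b))) (sym (insert-other X (w≢v ∘ sym)))) ⟩
    ∑ n (bit ∘ boundary (insert v X) W) + bit (boundary X W v)         ≤⟨ +-monoʳ-≤ _ (bit≤1 _) ⟩
    ∑ n (bit ∘ boundary (insert v X) W) + 1                           ≡⟨ +-comm _ 1 ⟩
    suc (∑ n (bit ∘ boundary (insert v X) W))                         ∎)
    where open ≤-Reasoning

  -- Pushing a solution towards the roots: inside the closest cut Q, the part
  -- of Y in the boundary of U is replaced by the boundary of U ∩ Q.
  module Push {X Z T Q} (cc : ClosestCut X Z T Q) {Y U} (c : Closed (X ∪ Y) U) (U-valid : Valid Z T U)
              (small-Y : size Y ≤ K) where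

    open ClosestCut cc

    kept : ℕ → Bool
    kept v = Y v ∧ not (boundary X U v)

    pushed : ℕ → Bool
    pushed v = kept v ∨ boundary X (U ∩ Q) v

    capacity-U∩Q : capacity X (U ∩ Q) ≤ capacity X U
    capacity-U∩Q = uncross U U-valid

    U∩Q-leak : ∀ u v → u < n → v < n → leak (U ∩ Q) u v ≡ false
    -- Uncrossing bounds the capacity of U ∩ Q by that of U, hence by `size Y` ≤ K, less than a
    -- single leak would cost.
    U∩Q-leak = leak-free {U ∩ Q} (≤-trans (m≤n+m _ (∑ n (bit ∘ boundary X (U ∩ Q))))
      (≤-trans capacity-U∩Q (≤-trans (capacity-closed {X} {Y} {U} c) small-Y)))

    -- The boundary of U is part of Y, and by uncrossing the boundary of U ∩ Q that replaces it is
    -- no larger.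
    pushed-size : size pushed ≤ size Y
    pushed-size = begin
      size pushed
        ≤⟨ ∑-mono n (λ v _ → union (kept v) (boundary X (U ∩ Q) v)) ⟩
      ∑ n (λ v → bit (kept v) + bit (boundary X (U ∩ Q) v))         ≡⟨ ∑-+ n _ _ ⟩
      size kept + ∑ n (bit ∘ boundary X (U ∩ Q))                    ≤⟨ +-monoʳ-≤ (size kept) fewer ⟩
      size kept + ∑ n (bit ∘ boundary X U)                          ≡⟨ sym (∑-+ n _ _) ⟩
      ∑ n (λ v → bit (kept v) + bit (boundary X U v))
        ≤⟨ ∑-mono n (λ v v<n → split (Y v) (boundary X U v) (boundary⊆ {X} {Y} {U} c v v<n)) ⟩
      size Y                                                       ∎
      where
      open ≤-Reasoning
      union : ∀ a b → bit (a ∨ b) ≤ bit a + bit b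
      union true  b = s≤s z≤n
      union false b = ≤-refl
      split : ∀ a b → (b ≡ true → a ≡ true) → bit (a ∧ not b) + bit b ≤ bit a
      split true  true  _ = ≤-refl
      split true  false _ = ≤-refl
      split false true  i = case i refl of λ ()
      split false false _ = ≤-refl
      fewer : ∑ n (bit ∘ boundary X (U ∩ Q)) ≤ ∑ n (bit ∘ boundary X U)
      fewer = begin
        ∑ n (bit ∘ boundary X (U ∩ Q))  ≤⟨ m≤m+n _ _ ⟩
        capacity X (U ∩ Q)              ≤⟨ capacity-U∩Q ⟩
        ∑ n (bit ∘ boundary X U) + leaks U ≡⟨ cong (∑ n (bit ∘ boundary X U) +_) (no-leaks {U} (no-leak c)) ⟩
        ∑ n (bit ∘ boundary X U) + 0    ≡⟨ +-identityʳ _ ⟩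
        ∑ n (bit ∘ boundary X U)        ∎

    -- Not only U but the closed sets of all later ranks survive the exchange. If the in-node of an
    -- undeleted v is in U′ ∩ U ∩ Q and its out-node is not in U ∩ Q, then v is in the new boundary.
    -- If the out-node is missing from U′ alone, then v is in Y but not in the boundary of U, so it
    -- was kept.
    pushed-closed : ∀ {U′} → Closed (X ∪ Y) U′ → Closed (X ∪ pushed) (U′ ∩ U ∩ Q)
    pushed-closed {U′} c′ = isClosed bd lk
      where
      bd : ∀ v → v < n → boundary (X ∪ pushed) (U′ ∩ U ∩ Q) v ≡ false
      bd v v<n with U′ v | U v | Q v | U′ (n + v) | U (n + v) | Q (n + v) | X v | Y v
                  | no-boundary c′ v v<n
      ... | false | _     | _     | _     | _     | _     | _     | _     | _ = refl
      ... | true  | false | _     | _     | _     | _     | _     | _     | _ = refl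
      ... | true  | true  | false | _     | _     | _     | _     | _     | _ = refl
      ... | true  | true  | true  | b     | c     | d     | true  | _     | _ = ∧-falseʳ (not (b ∧ c ∧ d)) refl
      ... | true  | true  | true  | _     | false | _     | false | true  | _ = ∧-falseʳ _ refl
      ... | true  | true  | true  | _     | false | _     | false | false | _ = ∧-falseʳ _ refl
      ... | true  | true  | true  | b     | true  | false | false | true  | _ = ∧-falseʳ _ refl
      ... | true  | true  | true  | b     | true  | false | false | false | _ = ∧-falseʳ _ refl
      ... | true  | true  | true  | true  | true  | true  | false | _     | _ = refl
      ... | true  | true  | true  | false | true  | true  | false | true  | _ = refl
      ... | true  | true  | true  | false | true  | true  | false | false | ()

      lk : ∀ u v → u < n → v < n → leak (U′ ∩ U ∩ Q) u v ≡ false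
      lk u v u<n v<n with U′ (n + u) | U (n + u) | Q (n + u) | U′ v | U v | Q v | adj u v
                        | no-leak c′ u v u<n v<n | U∩Q-leak u v u<n v<n
      ... | false | _     | _     | _     | _     | _     | _     | _  | _  = refl
      ... | true  | false | _     | _     | _     | _     | _     | _  | _  = refl
      ... | true  | true  | false | _     | _     | _     | _     | _  | _  = refl
      ... | true  | true  | true  | b     | c     | d     | false | _  | _  = ∧-falseʳ (not (b ∧ c ∧ d)) refl
      ... | true  | true  | true  | true  | true  | true  | true  | _  | _  = refl
      ... | true  | true  | true  | false | _     | _     | true  | () | _
      ... | true  | true  | true  | true  | false | _     | true  | _  | ()
      ... | true  | true  | true  | true  | true  | false | true  | _  | ()

  remove : ℕ → (ℕ → Bool) → ℕ → Bool
  remove v Y w = not (v ≡ᵇ w) ∧ Y w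

  remove-size : ∀ v Y → v < n → Y v ≡ true → suc (size (remove v Y)) ≤ size Y
  remove-size v Y v<n Yv = begin
    suc (size (remove v Y))                      ≡⟨ +-comm 1 _ ⟩
    size (remove v Y) + 1                        ≡⟨ cong (λ b → size (remove v Y) + bit b) (sym Yv) ⟩
    size (remove v Y) + bit (Y v)
      ≡⟨ ∑-change n v v<n (λ w w<n w≢v → cong (λ b → bit (not b ∧ Y w)) (sym (≢⇒≡ᵇ-false (w≢v ∘ sym)))) ⟩
    size Y + bit (remove v Y v)                  ≡⟨ cong (λ b → size Y + bit (not b ∧ Y v)) (≡ᵇ-refl v) ⟩
    size Y + 0                                   ≡⟨ +-identityʳ _ ⟩
    size Y                                       ∎
    where open ≤-Reasoning

-- The search for a solution

member : List Bool → ℕ → Bool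
member []       i       = false
member (b ∷ bs) zero    = b
member (b ∷ bs) (suc i) = member bs i

characteristic : ℕ → (ℕ → Bool) → List Bool
characteristic zero    f = []
characteristic (suc m) f = f 0 ∷ characteristic m (f ∘ suc)

member-characteristic : ∀ m f i → i < m → member (characteristic m f) i ≡ f i
member-characteristic (suc m) f zero    _         = refl
member-characteristic (suc m) f (suc i) (s<s i<m) = member-characteristic m (f ∘ suc) i i<m

characteristic-cong : ∀ m {f g} → (∀ i → i < m → f i ≡ g i) → characteristic m f ≡ characteristic m g
characteristic-cong zero    eq = refl
characteristic-cong (suc m) eq = cong₂ _∷_ (eq 0 z<s) (characteristic-cong m λ i i<m → eq (suc i) (s<s i<m))

nothing-member : ∀ m i → member (characteristic m (λ _ → false)) i ≡ false
nothing-member zero    i       = refl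
nothing-member (suc m) zero    = refl
nothing-member (suc m) (suc i) = nothing-member m i

-- Sets are stored as lists so that equal states are propositionally equal.
record State : Set where
  constructor state
  field
    deleted adopted : List Bool
    rank count      : ℕ

open State public

data Verdict : Set where
  halted failed advance : Verdict
  select : ℕ → Verdict

-- The i-th request demands that no path lead from source i to sink i.
module Search (n K ℓ : ℕ) (adj : ℕ → ℕ → Bool) (rk source sink : ℕ → ℕ) where

  open Network n K adj public

  X? A? : State → ℕ → Bool
  X? s = member (deleted s)
  A? s = member (adopted s)

  Root : ℕ → ℕ → Set
  Root ρ x = Σ[ i ∈ ℕ ] (i < ℓ × ρ ≤ rk i × x ≡ source i)

  -- A sink is a target at its out-node, just as a source is a root at its in-node, so endpoints of
  -- requests may be cut. An adopted vertex is a target already at its in-node: then no valid cut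
  -- has it in its boundary.
  Target : State → ℕ → Set
  Target s x = A? s x ≡ true ⊎ Σ[ i ∈ ℕ ] (i < ℓ × rk i ≡ rank s × x ≡ n + sink i)

  Closest : State → (ℕ → Bool) → Set
  Closest s = ClosestCut (X? s) (Root (rank s)) (Target s)

  -- Taking the largest vertex of the boundary makes the verdict unique and matches a scan that
  -- keeps the last vertex found.
  Judged : State → Verdict → Set
  Judged s halted     = ℓ ≤ rank s
  Judged s failed     = rank s < ℓ × (∀ W → Valid (Root (rank s)) (Target s) W → K < capacity (X? s) W)
  Judged s advance    = rank s < ℓ × Σ[ Q ∈ (ℕ → Bool) ] (Closest s Q × (∀ v → v < n → boundary (X? s) Q v ≡ false))
  Judged s (select v) = rank s < ℓ × Σ[ Q ∈ (ℕ → Bool) ] (Closest s Q × v < n × boundary (X? s) Q v ≡ true ×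
                          (∀ w → w < n → v < w → boundary (X? s) Q w ≡ false))

  delete : ℕ → State → State
  delete v s = state (characteristic n (insert v (X? s))) (adopted s) (rank s) (suc (count s))

  next : Bool → Verdict → State → State
  next b     halted     s = s
  next b     failed     s = s
  next b     advance    s = state (deleted s) (characteristic N (λ _ → false)) (suc (rank s)) (count s)
  -- The test bounds the count for arbitrary advice; advice that follows a solution never fails it.
  next true  (select v) s = if count s <ᵇ K then delete v s else s
  next false (select v) s = state (deleted s) (characteristic N (insert v (A? s))) (rank s) (count s)

  judged-unique : ∀ {s} d d′ → Judged s d → Judged s d′ → d ≡ d′
  judged-unique {s} d d′ = go d d′
    where
    same-boundary : ∀ {Q Q′} → Closest s Q → Closest s Q′ → ∀ v → v < n → boundary (X? s) Q v ≡ boundary (X? s) Q′ v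
    same-boundary cc cc′ v v<n = cong₂ (λ a b → a ∧ (not b ∧ not (X? s v)))
      (closest-unique cc cc′ v (in< v<n)) (closest-unique cc cc′ (n + v) (out< v<n))

    fail⊥ : ∀ {Q} → (∀ W → Valid (Root (rank s)) (Target s) W → K < capacity (X? s) W) → ¬ Closest s Q
    fail⊥ f cc = <⇒≱ (f _ (ClosestCut.isCut cc)) (ClosestCut.small cc)

    none⊥ : ∀ {Q Q′ v} → Closest s Q → Closest s Q′ → (∀ v → v < n → boundary (X? s) Q v ≡ false) →
      v < n → boundary (X? s) Q′ v ≢ true
    none⊥ {v = v} cc cc′ none v<n eq = true≢false (trans (same-boundary cc cc′ v v<n) eq) (none v v<n)

    go : ∀ d d′ → Judged s d → Judged s d′ → d ≡ d′
    go halted     halted      _ _ = refl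
    go halted     failed      h (r , _) = contradiction r (≤⇒≯ h)
    go halted     advance     h (r , _) = contradiction r (≤⇒≯ h)
    go halted     (select _)  h (r , _) = contradiction r (≤⇒≯ h)
    go failed     halted      (r , _) h = contradiction r (≤⇒≯ h)
    go advance    halted      (r , _) h = contradiction r (≤⇒≯ h)
    go (select _) halted      (r , _) h = contradiction r (≤⇒≯ h)
    go failed     failed      _ _ = refl
    go failed     advance     (_ , f) (_ , _ , cc , _) = ⊥-elim (fail⊥ f cc)
    go failed     (select _)  (_ , f) (_ , _ , cc , _) = ⊥-elim (fail⊥ f cc)
    go advance    failed      (_ , _ , cc , _) (_ , f) = ⊥-elim (fail⊥ f cc)
    go (select _) failed      (_ , _ , cc , _) (_ , f) = ⊥-elim (fail⊥ f cc)
    go advance    advance     _ _ = refl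
    go advance    (select _)  (_ , _ , cc , none) (_ , _ , cc′ , v<n , bd , _) = ⊥-elim (none⊥ cc cc′ none v<n bd)
    go (select _) advance     (_ , _ , cc′ , v<n , bd , _) (_ , _ , cc , none) = ⊥-elim (none⊥ cc cc′ none v<n bd)
    go (select v) (select w)  (_ , _ , cc , v<n , bv , lv) (_ , _ , cc′ , w<n , bw , lw) with <-cmp v w
    ... | tri≈ _ refl _ = refl
    ... | tri< v<w _ _ = contradiction (trans (same-boundary cc cc′ w w<n) bw) (λ e → true≢false e (lv w w<n v<w))
    ... | tri> _ _ w<v = contradiction (trans (sym (same-boundary cc cc′ v v<n)) bv) (λ e → true≢false e (lw v v<n w<v))

  initial : State
  initial = state (characteristic n (λ _ → false)) (characteristic N (λ _ → false)) 0 0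

  Step : Bool → State → State → Set
  Step b s s′ = Σ[ d ∈ Verdict ] (Judged s d × s′ ≡ next b d s)

  data Steps (β : ℕ → Bool) (i : ℕ) : ℕ → State → State → Set where
    done : ∀ {s} → Steps β i 0 s s
    _◅_  : ∀ {f s s′ s″} → Step (β i) s s′ → Steps β (suc i) f s′ s″ → Steps β i (suc f) s s″

  Separated : ℕ → (X W : ℕ → Bool) → Set
  Separated ρ X W = Closed X W × (∀ x → x < N → Root ρ x → W x ≡ true) ×
    (∀ i → i < ℓ → rk i ≡ ρ → W (n + sink i) ≡ false)

  record Sound (s : State) : Set where
    field
      count≤K : count s ≤ K
      size≤   : size (X? s) ≤ count s
      cuts    : ∀ ρ → ρ < rank s → Σ[ W ∈ (ℕ → Bool) ] Separated ρ (X? s) W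
      rank≤ℓ  : rank s ≤ ℓ

  deleted-insert : ∀ s v u → u < n → member (characteristic n (insert v (X? s))) u ≡ insert v (X? s) u
  deleted-insert s v = member-characteristic n (insert v (X? s))

  -- On `advance` the closest cut itself certifies the rank: its boundary is empty and its capacity
  -- leaves no room for a leak. Later deletions preserve certificates.
  sound-step : ∀ {s} b d → (∀ i → i < ℓ → sink i < n) → Judged s d → Sound s → Sound (next b d s)
  sound-step b halted _ _ snd = snd
  sound-step b failed _ _ snd = snd
  sound-step {s} b advance sink<n (r , Q , cc , none) snd = record
    { count≤K = count≤K
    ; size≤ = size≤
    ; cuts = λ ρ ρ<1+r → [ cuts ρ , (λ { refl → Q , isClosed none (leak-free {Q} (≤-trans (m≤n+m _ (∑ n (bit ∘ boundary (X? s) Q))) small)) ,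
        contains isCut , λ i i<ℓ eq → avoids isCut _ (out< (sink<n i i<ℓ)) (inj₂ (i , i<ℓ , eq , refl)) }) ]′ (<-suc-cases ρ<1+r)
    ; rank≤ℓ = r
    }
    where
    open Sound snd
    open ClosestCut cc
  sound-step {s} true (select v) _ (r , Q , cc , v<n , _) snd with count s <ᵇ K in eq
  ... | false = snd
  ... | true = record
    { count≤K = <ᵇ-sound eq
    ; size≤ = subst (_≤ suc (count s)) (∑-cong n λ u u<n → cong bit (sym (deleted-insert s v u u<n)))
               (≤-trans (size-insert n v (X? s) v<n) (s≤s size≤))
    ; cuts = λ ρ ρ<r → case cuts ρ ρ<r of λ (W , c , ct) → W , closed-mono
        (λ u u<n Xu → trans (deleted-insert s v u u<n) (insert-old v (X? s) Xu)) c , ct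
    ; rank≤ℓ = rank≤ℓ
    }
    where open Sound snd
  sound-step false (select v) _ _ snd = record { Sound snd }

  sound-steps : ∀ {β i f s s′} → (∀ i → i < ℓ → sink i < n) → Steps β i f s s′ → Sound s → Sound s′
  sound-steps sink<n done snd = snd
  sound-steps sink<n ((d , j , refl) ◅ ss) snd = sound-steps sink<n ss (sound-step _ d sink<n j snd)

  -- Y completes the deleted vertices to a solution, and g is a lower bound for
  -- the current minimum cut: every step decreases 2 (K - count) - g or
  -- increases the rank, so that f further steps suffice.
  record Good (f : ℕ) (s : State) : Set where
    field
      Y      : ℕ → Bool
      U      : ℕ → ℕ → Bool
      g      : ℕ
      budget : count s + size Y ≤ K
      cuts   : ∀ ρ → rank s ≤ ρ → ρ < ℓ → Separated ρ (X? s ∪ Y) (U ρ)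
      avoid  : rank s < ℓ → ∀ x → x < N → A? s x ≡ true → U (rank s) x ≡ false
      lower  : rank s < ℓ → ∀ W → Valid (Root (rank s)) (Target s) W → g ≤ capacity (X? s) W
      fuel   : 2 * K + ℓ ≤ f + g + 2 * count s + rank s

    current-valid : rank s < ℓ → Valid (Root (rank s)) (Target s) (U (rank s))
    current-valid r = valid (proj₁ (proj₂ (cuts _ ≤-refl r)))
      (λ { x x<N (inj₁ a) → avoid r x x<N a
         ; x x<N (inj₂ (i , i<ℓ , eq , refl)) → proj₂ (proj₂ (cuts _ ≤-refl r)) i i<ℓ eq })

    size≤K : size Y ≤ K
    size≤K = ≤-trans (m≤n+m _ (count s)) budget

    current-small : rank s < ℓ → capacity (X? s) (U (rank s)) ≤ size Y
    current-small r = capacity-closed {X? s} {Y} (proj₁ (cuts _ ≤-refl r))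

  -- If the rank were below ℓ, the set `U (rank s)` would be a cut paid for by Y, so g ≤ `size Y` ≤
  -- K - count. Then g + 2 count + rank stays below 2 K + ℓ, against `fuel`.
  good-finished : ∀ {s} → Good 0 s → ℓ ≤ rank s
  good-finished {s} good = ≮⇒≥ λ r → <⇒≱ (begin-strict
      g + 2 * count s + rank s
        ≤⟨ +-monoˡ-≤ (rank s) (+-monoˡ-≤ (2 * count s) (≤-trans (lower r _ (current-valid r)) (current-small r))) ⟩
      size Y + 2 * count s + rank s       ≤⟨ +-monoˡ-≤ (rank s) (m≤m+n _ (size Y)) ⟩
      size Y + 2 * count s + size Y + rank s ≡⟨ rearrange (count s) (size Y) (rank s) ⟩
      2 * (count s + size Y) + rank s     ≤⟨ +-monoˡ-≤ (rank s) (*-monoʳ-≤ 2 budget) ⟩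
      2 * K + rank s                      <⟨ +-monoʳ-< (2 * K) r ⟩
      2 * K + ℓ                           ∎) fuel
    where
    open Good good
    open ≤-Reasoning
    rearrange : ∀ c y r → y + 2 * c + y + r ≡ 2 * (c + y) + r
    rearrange = solve-∀

  -- For a selected v the bit tells whether its in-node lies in `U (rank s) ∩ Q`. If it does, v is
  -- in the boundary of this set, because its out-node is not in Q; so v belongs to the pushed
  -- solution and may be deleted. If not, the pushed sets avoid v and it may be adopted.
  good-step : ∀ {f s} d → Judged s d → Good (suc f) s → Σ[ b ∈ Bool ] Good f (next b d s)
  good-step {f} {s} halted h good = true , record
    -- Beyond the last rank `lower` is vacuous, so g can be chosen large enough to provide the fuel.
    { Y = Y ; U = U ; g = 2 * K ; budget = budget ; cuts = cuts ; avoid = avoid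
    ; lower = λ r → contradiction r (≤⇒≯ h)
    ; fuel = begin
        2 * K + ℓ                          ≤⟨ +-monoʳ-≤ (2 * K) h ⟩
        2 * K + rank s                     ≤⟨ m≤n+m _ (f + 2 * count s) ⟩
        f + 2 * count s + (2 * K + rank s) ≡⟨ rearrange f (count s) K (rank s) ⟩
        f + 2 * K + 2 * count s + rank s   ∎
    }
    where
    open Good good
    open ≤-Reasoning
    rearrange : ∀ f c K r → f + 2 * c + (2 * K + r) ≡ f + 2 * K + 2 * c + r
    rearrange = solve-∀
  good-step {f} {s} failed (r , bad) good =
    contradiction (≤-trans (current-small r) size≤K) (<⇒≱ (bad _ (current-valid r)))
    where open Good good
  good-step {f} {s} advance (r , Q , cc , none) good = true , record
    -- The closest cut has capacity 0, so g was 0 before as well; the step is paid for by the rank.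
    { Y = Y ; U = U ; g = 0 ; budget = budget
    ; cuts = λ ρ r≤ρ → cuts ρ (<⇒≤ r≤ρ)
    ; avoid = λ _ x _ a → contradiction (nothing-member N x) (true≢false a)
    ; lower = λ _ _ _ → z≤n
    ; fuel = begin
        2 * K + ℓ                                      ≤⟨ fuel ⟩
        suc f + g + 2 * count s + rank s
          ≤⟨ +-monoˡ-≤ (rank s) (+-monoˡ-≤ (2 * count s) (+-monoʳ-≤ (suc f) g≤0)) ⟩
        suc f + 0 + 2 * count s + rank s               ≡⟨ sym (+-suc _ (rank s)) ⟩
        f + 0 + 2 * count s + suc (rank s)             ∎
    }
    where
    open Good good
    open ≤-Reasoning
    g≤0 : g ≤ 0
    g≤0 = subst (g ≤_) (cong₂ _+_ (∑-zero n λ v v<n → cong bit (none v v<n))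
            (no-leaks {Q} (leak-free {Q} (≤-trans (m≤n+m _ (∑ n (bit ∘ boundary (X? s) Q))) (ClosestCut.small cc)))))
            (lower r Q (ClosestCut.isCut cc))
  good-step {f} {s} (select v) (r , Q , cc , v<n , bdv , _) good with U (rank s) v ∧ Q v in in-U
    where open Good good
  ... | false = false , record
    -- Valid cuts must now avoid v, which is in Q, so by `closest` they are strictly more expensive
    -- than Q.
    { Y = pushed ; U = λ ρ → U ρ ∩ U (rank s) ∩ Q ; g = suc (capacity (X? s) Q)
    ; budget = ≤-trans (+-monoʳ-≤ (count s) pushed-size) budget
    ; cuts = λ ρ r≤ρ ρ<ℓ → let c , inc , exc = cuts ρ r≤ρ ρ<ℓ in
        pushed-closed {U ρ} c ,
        -- A root of a later rank is also a root of the current rank, hence a member of all three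
        -- sets.
        (λ x x<N R@(i , i<ℓ , ρ≤ , eq) → let R′ = i , i<ℓ , ≤-trans r≤ρ ρ≤ , eq in
          ∧-join (inc x x<N R) (∧-join (contains (current-valid r) x x<N R′) (contains (ClosestCut.isCut cc) x x<N R′))) ,
        λ i i<ℓ eq → cong (_∧ (U (rank s) ∩ Q) (n + sink i)) (exc i i<ℓ eq)
    ; avoid = λ _ x x<N a → ∧-falseʳ (U (rank s) x) (avoid′ x x<N (trans (sym (member-characteristic N _ x x<N)) a))
    ; lower = λ _ W v′ → ClosestCut.closest cc W
        (valid (contains v′) λ { x x<N (inj₁ a) → avoids v′ x x<N (inj₁ (trans (member-characteristic N _ x x<N) (insert-old v (A? s) a)))
                               ; x x<N (inj₂ b) → avoids v′ x x<N (inj₂ b) })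
        v (in< v<n) Qv (avoids v′ v (in< v<n) (inj₁ (trans (member-characteristic N _ v (in< v<n)) (insert-same v (A? s)))))
    ; fuel = begin
        2 * K + ℓ                                      ≤⟨ fuel ⟩
        suc f + g + 2 * count s + rank s
          ≤⟨ +-monoˡ-≤ (rank s) (+-monoˡ-≤ (2 * count s) (+-monoʳ-≤ (suc f) (lower r Q (ClosestCut.isCut cc)))) ⟩
        suc f + capacity (X? s) Q + 2 * count s + rank s
          ≡⟨ cong (λ m → m + 2 * count s + rank s) (sym (+-suc f _)) ⟩
        f + suc (capacity (X? s) Q) + 2 * count s + rank s ∎
    }
    where
    open Good good
    open ≤-Reasoning
    open Push cc {Y} {U (rank s)} (proj₁ (cuts _ ≤-refl r)) (current-valid r) size≤K
    Qv : Q v ≡ true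
    Qv = proj₁ (∧-split (Q v) bdv)
    avoid′ : ∀ x → x < N → insert v (A? s) x ≡ true → U (rank s) x ∧ Q x ≡ false
    avoid′ x x<N a with v ≡ᵇ x in eq
    ... | true  = subst (λ y → U (rank s) y ∧ Q y ≡ false) (≡ᵇ⇒≡ v x (subst T (sym eq) tt)) in-U
    ... | false = cong (_∧ Q x) (avoid r x x<N a)
  ... | true = true , subst (Good f) (sym (cong (λ b → if b then delete v s else s) count<K)) record
    -- Deleting v lowers the minimum cut by at most 1, while twice the count grows by 2.
    { Y = remove v pushed ; U = λ ρ → U ρ ∩ U (rank s) ∩ Q ; g = pred (capacity (X? s) Q)
    ; budget = begin
        suc (count s) + size (remove v pushed)  ≡⟨ sym (+-suc (count s) _) ⟩
        count s + suc (size (remove v pushed))  ≤⟨ +-monoʳ-≤ (count s) (remove-size v pushed v<n in-pushed) ⟩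
        count s + size pushed                   ≤⟨ budget′ ⟩
        K                                       ∎
    ; cuts = λ ρ r≤ρ ρ<ℓ → let c , inc , exc = cuts ρ r≤ρ ρ<ℓ in
        closed-mono {X? s ∪ pushed} more (pushed-closed {U ρ} c) ,
        (λ x x<N R@(i , i<ℓ , ρ≤ , eq) → let R′ = i , i<ℓ , ≤-trans r≤ρ ρ≤ , eq in
          ∧-join (inc x x<N R) (∧-join (contains (current-valid r) x x<N R′) (contains (ClosestCut.isCut cc) x x<N R′))) ,
        λ i i<ℓ eq → cong (_∧ (U (rank s) ∩ Q) (n + sink i)) (exc i i<ℓ eq)
    ; avoid = λ _ x x<N a → ∧-falseʳ (U (rank s) x) (cong (_∧ Q x) (avoid r x x<N a))
    ; lower = λ _ W v′ → pred-mono-≤ (begin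
        capacity (X? s) Q                     ≤⟨ ClosestCut.least cc W v′ ⟩
        capacity (X? s) W                     ≤⟨ capacity-delete (X? s) W v v<n ⟩
        suc (capacity (insert v (X? s)) W)
          ≡⟨ cong suc (capacity-cong W λ u u<n → sym (deleted-insert s v u u<n)) ⟩
        suc (capacity (member (characteristic n (insert v (X? s)))) W) ∎)
    ; fuel = begin
        2 * K + ℓ                                      ≤⟨ fuel ⟩
        suc f + g + 2 * count s + rank s
          ≤⟨ +-monoˡ-≤ (rank s) (+-monoˡ-≤ (2 * count s)
              (+-monoʳ-≤ (suc f) (≤-trans (lower r Q (ClosestCut.isCut cc)) (suc-pred≤ (capacity (X? s) Q))))) ⟩
        suc f + suc (pred (capacity (X? s) Q)) + 2 * count s + rank s
          ≡⟨ rearrange f (pred (capacity (X? s) Q)) (count s) (rank s) ⟩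
        f + pred (capacity (X? s) Q) + 2 * suc (count s) + rank s ∎
    }
    where
    open Good good
    open ≤-Reasoning
    open Push cc {Y} {U (rank s)} (proj₁ (cuts _ ≤-refl r)) (current-valid r) size≤K
    rearrange : ∀ f q c r → suc f + suc q + 2 * c + r ≡ f + q + 2 * suc c + r
    rearrange = solve-∀
    suc-pred≤ : ∀ m → m ≤ suc (pred m)
    suc-pred≤ zero    = z≤n
    suc-pred≤ (suc m) = ≤-refl
    not-out : Q (n + v) ≡ false
    not-out = not-true (proj₁ (∧-split (not (Q (n + v))) (proj₂ (∧-split (Q v) bdv))))
    not-deleted : not (X? s v) ≡ true
    not-deleted = proj₂ (∧-split (not (Q (n + v))) (proj₂ (∧-split (Q v) bdv)))
    in-pushed : pushed v ≡ true
    in-pushed = trans (cong (kept v ∨_) (∧-join in-U (∧-join (not-false (∧-falseʳ (U (rank s) (n + v)) not-out)) not-deleted))) (∨-zeroʳ (kept v))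
    budget′ : count s + size pushed ≤ K
    budget′ = ≤-trans (+-monoʳ-≤ (count s) pushed-size) budget
    count<K : (count s <ᵇ K) ≡ true
    count<K = <ᵇ-complete (≤-trans (subst (_≤ count s + size pushed) (+-comm _ 1)
      (+-monoʳ-≤ (count s) (≤-trans (s≤s z≤n) (remove-size v pushed v<n in-pushed)))) budget′)
    more : ∀ u → u < n → (X? s ∪ pushed) u ≡ true → (member (characteristic n (insert v (X? s))) ∪ remove v pushed) u ≡ true
    more u u<n e rewrite deleted-insert s v u u<n with v ≡ᵇ u | X? s u
    ... | true  | _     = refl
    ... | false | true  = refl
    ... | false | false = e

-- Advice that leads to a solution

anyBelow : ℕ → (ℕ → Bool) → Bool
anyBelow zero    p = false
anyBelow (suc m) p = p 0 ∨ anyBelow m (p ∘ suc)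

anyBelow-true : ∀ m p i → i < m → p i ≡ true → anyBelow m p ≡ true
anyBelow-true (suc m) p zero    _         eq rewrite eq = refl
anyBelow-true (suc m) p (suc i) (s<s i<m) eq with p 0
... | true  = refl
... | false = anyBelow-true m (p ∘ suc) i i<m eq

anyBelow-witness : ∀ m p → anyBelow m p ≡ true → Σ[ i ∈ ℕ ] (i < m × p i ≡ true)
anyBelow-witness (suc m) p eq with p 0 in p0
... | true  = 0 , z<s , p0
... | false with anyBelow-witness m (p ∘ suc) eq
...   | i , i<m , pi = suc i , s<s i<m , pi

-- Double negation commutes with conjunctions over a finite range, so choices that cannot be
-- computed can still be collected in a function.
finite-choice : ∀ {A : Set} (R : ℕ → A → Set) → A → ∀ m →
  (∀ i → i < m → ¬ ¬ (Σ A (R i))) → ¬ ¬ (Σ[ f ∈ (ℕ → A) ] (∀ i → i < m → R i (f i)))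
finite-choice R a zero    h k = k ((λ _ → a) , λ _ ())
finite-choice R a (suc m) h k = h 0 z<s λ (b , Rb) →
  finite-choice (R ∘ suc) a m (λ i i<m → h (suc i) (s<s i<m)) λ (f , Rf) →
    k ((λ { zero → b ; (suc i) → f i }) , λ { zero _ → Rb ; (suc i) (s<s i<m) → Rf i i<m })

Reflects : Set → Bool → Set
Reflects P b = (b ≡ true → P) × (P → b ≡ true)

-- Excluded middle under double negation, in Boolean form.
reflected : (P : Set) → ¬ ¬ (Σ Bool (Reflects P))
reflected P k = k (false , (λ ()) , λ p → ⊥-elim (k (true , (λ _ → p) , λ _ → refl)))

module Bits (n K ℓ : ℕ) (adj : ℕ → ℕ → Bool) (rk source sink : ℕ → ℕ) where

  open Search n K ℓ adj rk source sink public

  steps-cong : ∀ {β β′ i f s s′} → (∀ j → i ≤ j → β j ≡ β′ j) → Steps β i f s s′ → Steps β′ i f s s′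
  steps-cong eq done = done
  steps-cong {i = i} eq ((d , j , s≡) ◅ ss) =
    (d , j , trans s≡ (cong (λ b → next b d _) (eq i ≤-refl))) ◅ steps-cong (λ j i<j → eq j (<⇒≤ i<j)) ss

  good-bits : ∀ f i s → Good f s → ¬ ¬ (Σ[ β ∈ (ℕ → Bool) ] (∀ s′ → Steps β i f s s′ → ℓ ≤ rank s′))
  good-bits zero    i s good k = k ((λ _ → false) , λ { _ done → good-finished good })
  good-bits (suc f) i s good k =
    -- Whether a verdict applies is not decided. If none does, any bits win; to refute a given one,
    -- `k` is called again with the bits that `good-step` and the induction supply. By
    -- `judged-unique` these bits serve every run.
    k ((λ _ → false) , λ { _ ((d , j , _) ◅ _) → ⊥-elim (unjudged d j) })
    where
    unjudged : ∀ d → ¬ Judged s d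
    unjudged d j with good-step d j good
    ... | b , good′ = good-bits f (suc i) (next b d s) good′ λ (β , wins) →
      k (override β , λ { s′ ((d′ , j′ , refl) ◅ ss) → wins s′ (steps-cong tail (start β d′ j′ ss)) })
      where
      override : (ℕ → Bool) → ℕ → Bool
      override β j = if j ≡ᵇ i then b else β j
      tail : ∀ {β} j → suc i ≤ j → override β j ≡ β j
      tail {β} j i<j rewrite ≢⇒≡ᵇ-false (λ (eq : j ≡ i) → <-irrefl (sym eq) i<j) = refl
      start : ∀ β d′ → Judged s d′ → ∀ {s′} → Steps (override β) (suc i) f (next (override β i) d′ s) s′ →
        Steps (override β) (suc i) f (next b d s) s′
      start β d′ j′ {s′} = subst₂ (λ c e → Steps (override β) (suc i) f (next c e s) s′)
        (cong (λ c → if c then b else β i) (≡ᵇ-refl i)) (judged-unique d′ d j′ j)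

-- Reachability after the deletions and the ranking of the requests

module Reachability (n : ℕ) (adj : ℕ → ℕ → Bool) (X : ℕ → Bool) where

  -- A deleted vertex does not even reach itself, so that requests with a deleted endpoint count as
  -- cut without a separate case.
  data _⇝_ : ℕ → ℕ → Set where
    stop : ∀ {v} → v < n → X v ≡ false → v ⇝ v
    move : ∀ {u w v} → u < n → X u ≡ false → adj u w ≡ true → w ⇝ v → u ⇝ v

  ⇝-trans : ∀ {u v w} → u ⇝ v → v ⇝ w → u ⇝ w
  ⇝-trans (stop _ _)     q = q
  ⇝-trans (move b a e p) q = move b a e (⇝-trans p q)

  ⇝-source : ∀ {u v} → u ⇝ v → u ⇝ u
  ⇝-source (stop b a)     = stop b a
  ⇝-source (move b a _ _) = stop b a

  ⇝-bounded : ∀ {u v} → u ⇝ v → v < n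
  ⇝-bounded (stop b _)     = b
  ⇝-bounded (move _ _ _ p) = ⇝-bounded p

  Reaches : (ℕ → ℕ → Bool) → Set
  Reaches R = ∀ u v → u < n → v < n → Reflects (u ⇝ v) (R u v)

  reaches : ¬ ¬ (Σ (ℕ → ℕ → Bool) Reaches)
  reaches k = finite-choice (λ u f → ∀ v → v < n → Reflects (u ⇝ v) (f v)) (λ _ → false) n
    (λ u _ → finite-choice (λ v → Reflects (u ⇝ v)) false n λ v _ → reflected (u ⇝ v))
    λ (R , h) → k (R , λ u v u<n → h u u<n v)

  -- The requests are directed and ranked by the binary code of the set of
  -- vertices reachable from their endpoints: it is monotone along paths and
  -- determines this set.
  module Ranking (R : ℕ → ℕ → Bool) (reach : Reaches R) (ℓ : ℕ) (s t : ℕ → ℕ)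
                 (s< : ∀ i → i < ℓ → s i < n) (t< : ∀ i → i < ℓ → t i < n)
                 (solution : ∀ i → i < ℓ → ¬ (s i ⇝ t i) ⊎ ¬ (t i ⇝ s i)) where

    key : ℕ → ℕ
    key u = value (λ _ → 2) n (bit ∘ R u)

    digits : ∀ u → Digits (λ _ → 2) n (bit ∘ R u)
    digits u i _ = s≤s (bit≤1 (R u i))

    key-mono : ∀ {u v} → u ⇝ v → key v ≤ key u
    key-mono {u} {v} p = value-mono (λ _ → 2) n λ w w<n → bit-mono λ Rvw →
      proj₂ (reach u w u<n w<n) (⇝-trans p (proj₁ (reach v w (⇝-bounded p) w<n) Rvw))
      where
      u<n = ⇝-bounded (⇝-source p)

    same-key : ∀ {u v w} → u < n → v < n → key u ≡ key v → u ⇝ w → v ⇝ w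
    same-key {u} {v} {w} u<n v<n eq p = proj₁ (reach v w v<n w<n)
      (bit-injective (trans (sym (value-injective (λ _ → 2) n (digits u) (digits v) eq w w<n)) (cong bit (proj₂ (reach u w u<n w<n) p))))
      where
      w<n = ⇝-bounded p
      bit-injective : ∀ {b} → bit b ≡ 1 → b ≡ true
      bit-injective {true} _ = refl

    forward : ℕ → Bool
    forward i = key (s i) ≤ᵇ key (t i)

    source sink : ℕ → ℕ
    source i = if forward i then s i else t i
    sink   i = if forward i then t i else s i

    source< : ∀ i → i < ℓ → source i < n
    source< i i<ℓ with forward i
    ... | true  = s< i i<ℓ
    ... | false = t< i i<ℓ

    sink< : ∀ i → i < ℓ → sink i < n
    sink< i i<ℓ with forward i
    ... | true  = t< i i<ℓ
    ... | false = s< i i<ℓ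

    directed : ∀ i → i < ℓ → key (source i) ≤ key (sink i) ×
      (source i ⇝ sink i → sink i ⇝ source i → ⊥)
    directed i i<ℓ with forward i in eq | solution i i<ℓ
    ... | true  | inj₁ np = ≤ᵇ-sound eq , λ p q → np p
    ... | true  | inj₂ np = ≤ᵇ-sound eq , λ p q → np q
    ... | false | inj₁ np = ≰⇒≥ (λ le → subst T eq (≤⇒≤ᵇ le)) , λ p q → np q
    ... | false | inj₂ np = ≰⇒≥ (λ le → subst T eq (≤⇒≤ᵇ le)) , λ p q → np p

    above : ℕ → ℕ → Bool
    above i j = key (sink i) <ᵇ key (sink j)

    -- Counts the requests whose sink has a strictly larger key: the larger the key the lower the
    -- rank, and equal keys share a rank.
    rk : ℕ → ℕ
    rk i = ∑ ℓ (bit ∘ above i)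

    <ᵇ-irrefl : ∀ m → (m <ᵇ m) ≡ false
    <ᵇ-irrefl zero    = refl
    <ᵇ-irrefl (suc m) = <ᵇ-irrefl m

    rk<ℓ : ∀ i → i < ℓ → rk i < ℓ
    rk<ℓ i i<ℓ = subst (rk i <_) (ones ℓ) (∑-mono-< ℓ (λ j _ → bit≤1 (above i j)) i i<ℓ
      (subst (λ b → bit b < 1) (sym (<ᵇ-irrefl (key (sink i)))) z<s))
      where
      ones : ∀ m → ∑ m (λ _ → 1) ≡ m
      ones zero    = refl
      ones (suc m) = cong suc (ones m)

    -- If the sink of i had the larger key, every request counted for i would be counted for j, and
    -- so would i itself, making the rank of j larger.
    rk-antitone : ∀ i j → i < ℓ → rk j ≤ rk i → key (sink i) ≤ key (sink j)
    rk-antitone i j i<ℓ rj≤ri = ≮⇒≥ λ lt → <⇒≱ (∑-mono-< ℓ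
      (λ w _ → bit-mono λ a → <ᵇ-complete (<-trans {key (sink j)} {key (sink i)} {key (sink w)} lt (<ᵇ-sound a)))
      i i<ℓ (subst₂ (λ a b → bit a < bit b) (sym (<ᵇ-irrefl (key (sink i)))) (sym (<ᵇ-complete lt)) z<s)) rj≤ri

    -- Reaching sink j from source i would give the cycle key (source i) ≤ key (sink i) ≤ key (sink
    -- j) ≤ key (source i). Equal keys mean equal reachable sets, so source i and sink i would reach
    -- each other.
    skew : ∀ i j → i < ℓ → j < ℓ → rk j ≤ rk i → ¬ (source i ⇝ sink j)
    skew i j i<ℓ j<ℓ rj≤ri p =
      proj₂ (directed i i<ℓ)
        (same-key (sink< i i<ℓ) (source< i i<ℓ) (sym key≡) sink-self)
        (same-key (source< i i<ℓ) (sink< i i<ℓ) key≡ (⇝-source p))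
      where
      key≡ : key (source i) ≡ key (sink i)
      key≡ = ≤-antisym (proj₁ (directed i i<ℓ)) (≤-trans (rk-antitone i j i<ℓ rj≤ri) (key-mono p))
      sink-self : sink i ⇝ sink i
      sink-self = ⇝-source (same-key (source< i i<ℓ) (sink< i i<ℓ) key≡ (⇝-source p))

  module Start (R : ℕ → ℕ → Bool) (reach : Reaches R) (K ℓ : ℕ) (rk source sink : ℕ → ℕ)
               (source< : ∀ i → i < ℓ → source i < n) (sink< : ∀ i → i < ℓ → sink i < n)
               (skew : ∀ i j → i < ℓ → j < ℓ → rk j ≤ rk i → ¬ (source i ⇝ sink j)) where

    open Bits n K ℓ adj rk source sink

    out : ℕ → ℕ → Bool
    out ρ v = anyBelow ℓ λ i → (ρ ≤ᵇ rk i) ∧ R (source i) v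

    -- The in-nodes of all deleted vertices are included, reached or not: arcs into deleted vertices
    -- then do not leak, and deleted sources are still contained.
    side : ℕ → ℕ → Bool
    side ρ x = if x <ᵇ n then X x ∨ out ρ x else out ρ (x ∸ n)

    side-in : ∀ ρ v → v < n → side ρ v ≡ X v ∨ out ρ v
    side-in ρ v v<n rewrite <ᵇ-complete v<n = refl

    side-out : ∀ ρ v → side ρ (n + v) ≡ out ρ v
    side-out ρ v rewrite ≥⇒<ᵇ-false (m≤m+n n v) | m+n∸m≡n n v = refl

    out-intro : ∀ ρ v i → i < ℓ → ρ ≤ rk i → v < n → source i ⇝ v → out ρ v ≡ true
    out-intro ρ v i i<ℓ ρ≤ v<n p = anyBelow-true ℓ _ i i<ℓ
      (∧-join (Equivalence.to T-≡ (≤⇒≤ᵇ ρ≤)) (proj₂ (reach (source i) v (source< i i<ℓ) v<n) p))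

    out-elim : ∀ ρ v → v < n → out ρ v ≡ true → Σ[ i ∈ ℕ ] (i < ℓ × ρ ≤ rk i × source i ⇝ v)
    out-elim ρ v v<n o with anyBelow-witness ℓ _ o
    ... | i , i<ℓ , eq with ∧-split (ρ ≤ᵇ rk i) eq
    ...   | le , Rv = i , i<ℓ , ≤ᵇ-sound le , proj₁ (reach (source i) v (source< i i<ℓ) v<n) Rv

    separated : ∀ ρ → ρ < ℓ → Separated ρ X (side ρ)
    separated ρ ρ<ℓ = isClosed bd lk , inc , exc
      where
      bd : ∀ v → v < n → boundary X (side ρ) v ≡ false
      bd v v<n rewrite side-in ρ v v<n | side-out ρ v with X v | out ρ v
      ... | true  | o     = ∧-falseʳ (not o) refl
      ... | false | true  = refl
      ... | false | false = refl
      lk : ∀ u v → u < n → v < n → leak (side ρ) u v ≡ false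
      lk u v u<n v<n = ≢true⇒false λ e → let e₁ , a = ∧-split (side ρ (n + u) ∧ not (side ρ v)) e in
        let o , ni = ∧-split (side ρ (n + u)) e₁ in
        leak⊥ a (trans (sym (side-out ρ u)) o) (trans (sym (side-in ρ v v<n)) (not-true ni))
        where
        leak⊥ : adj u v ≡ true → out ρ u ≡ true → X v ∨ out ρ v ≡ false → ⊥
        leak⊥ a o ni with out-elim ρ u u<n o | ∨-false (X v) ni
        ... | i , i<ℓ , ρ≤ , p | Xv , nv = true≢false (out-intro ρ v i i<ℓ ρ≤ v<n (⇝-trans p (extend p))) nv
          where
          extend : ∀ {a} → a ⇝ u → u ⇝ v
          extend (stop b x)     = move b x a (stop v<n Xv)
          extend (move _ _ _ q) = extend q
      inc : ∀ x → x < N → Root ρ x → side ρ x ≡ true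
      inc x x<N (i , i<ℓ , ρ≤ , refl) with true-or-false (X (source i))
      ... | inj₁ Xv = trans (side-in ρ (source i) (source< i i<ℓ)) (cong (_∨ out ρ (source i)) Xv)
      ... | inj₂ Xv = trans (side-in ρ (source i) (source< i i<ℓ))
        (trans (cong (X (source i) ∨_) (out-intro ρ (source i) i i<ℓ ρ≤ (source< i i<ℓ) (stop (source< i i<ℓ) Xv))) (∨-zeroʳ _))
      exc : ∀ j → j < ℓ → rk j ≡ ρ → side ρ (n + sink j) ≡ false
      exc j j<ℓ refl = trans (side-out ρ (sink j)) (≢true⇒false λ o →
        case out-elim ρ (sink j) (sink< j j<ℓ) o of λ (i , i<ℓ , ρ≤ , p) → skew i j i<ℓ j<ℓ ρ≤ p)

    good-initial : size X ≤ K → K ≤ ℓ → Good (3 * ℓ) initial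
    good-initial X≤K K≤ℓ = record
      { Y = X ; U = side ; g = 0
      ; budget = X≤K
      ; cuts = λ ρ _ ρ<ℓ → let c , ct = separated ρ ρ<ℓ in closed-mono {X} (λ v v<n Xv → trans (cong (_∨ X v) (nothing-member n v)) Xv) c , ct
      ; avoid = λ _ x _ a → contradiction (nothing-member N x) (true≢false a)
      ; lower = λ _ _ _ → z≤n
      ; fuel = begin
          2 * K + ℓ              ≤⟨ +-monoˡ-≤ ℓ (*-monoʳ-≤ 2 K≤ℓ) ⟩
          2 * ℓ + ℓ              ≡⟨ rearrange ℓ ⟩
          3 * ℓ + 0 + 2 * 0 + 0  ∎
      }
      where
      open ≤-Reasoning
      rearrange : ∀ ℓ → 2 * ℓ + ℓ ≡ 3 * ℓ + 0 + 2 * 0 + 0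
      rearrange = solve-∀

-- The program

infix 26 _′
_′ : ℕ → Exp
x ′ = var x

nR ℓR KR NR roundsR stagesR digitsR goR foundR countR rankR stageR roundR xR yR tailR uR targetR currentR pickR carryR baseR capR aR bR : ℕ
nR       = 0
ℓR       = 1
KR       = 2
NR       = 3
roundsR  = 4
stagesR  = 5
digitsR  = 6
goR      = 7
foundR   = 8
countR   = 9
rankR    = 10
stageR   = 11
roundR   = 12
xR       = 13
yR       = 14
tailR    = 15
uR       = 16
targetR  = 17
currentR = 18
pickR    = 19
carryR   = 20
baseR    = 21
capR     = 22
aR       = 23
bR       = 24

adjA sA tA deletedA residualA offsetA guessA markA parentA queueA rootA targetA adoptedA : ℕ
adjA      = 0
sA        = 1
tA        = 2
deletedA  = 3
residualA = 4
offsetA   = 5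
guessA    = 6
markA     = 7
parentA   = 8
queueA    = 9
rootA     = 10
targetA   = 11
adoptedA  = 12

-- targetR and pickR hold the successor of a node, or 0 if there is none, and
-- markA holds the successor of the position in the queue.

clear : ℕ → ℕ → Code
clear a b = forloop xR b (write a (xR ′) (lit 0))

endpoints : Code
endpoints =
  branch (guessA ⟦ ℓR ′ ⊕ xR ′ ⟧)
    (assign aR (sA ⟦ xR ′ ⟧) ⨟ assign bR (tA ⟦ xR ′ ⟧))
    (assign aR (tA ⟦ xR ′ ⟧) ⨟ assign bR (sA ⟦ xR ′ ⟧))

resetTerminal : Code
resetTerminal = write rootA (xR ′) (lit 0) ⨟ write targetA (xR ′) (adoptedA ⟦ xR ′ ⟧)

markTerminal : Code
markTerminal =
  branch (rankR ′ ⊖ guessA ⟦ xR ′ ⟧) nop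
    (write rootA (aR ′) (lit 1) ⨟
     branch (guessA ⟦ xR ′ ⟧ ⊖ rankR ′) nop
       (write targetA (nR ′ ⊕ bR ′) (lit 1)))

prepare : Code
prepare = forloop xR NR resetTerminal ⨟ forloop xR ℓR (endpoints ⨟ markTerminal)

-- The residual network is stored with rows of length 2 n, whereas
-- offsetA ⟦ u ⟧ is u n.
cell : ℕ → ℕ → Exp
cell u v = offsetA ⟦ u ′ ⟧ ⊕ offsetA ⟦ u ′ ⟧ ⊕ v ′

-- The sum of the two truncated differences vanishes exactly when y = n + x, the arc inside a split
-- vertex. `roundsR` holds K + 1, the capacity of an arc of the digraph.
entry : Code
entry =
  branch (nR ′ ⊖ xR ′)
    (branch ((nR ′ ⊕ xR ′ ⊖ yR ′) ⊕ (yR ′ ⊖ (nR ′ ⊕ xR ′))) nop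
      (assign capR (lit 1 ⊖ deletedA ⟦ xR ′ ⟧)))
    (branch (nR ′ ⊖ yR ′)
      (branch (adjA ⟦ offsetA ⟦ xR ′ ⊖ nR ′ ⟧ ⊕ yR ′ ⟧) (assign capR (roundsR ′)) nop)
      nop)

buildEntry : Code
buildEntry = assign capR (lit 0) ⨟ entry ⨟ write residualA (cell xR yR) (capR ′)

build : Code
build = forloop xR NR (forloop yR NR buildEntry)

push : ℕ → Code
push v =
  write queueA (tailR ′) (v ′) ⨟
  assign tailR (tailR ′ ⊕ lit 1) ⨟
  write markA (v ′) (tailR ′) ⨟
  write parentA (v ′) (uR ′)

pushRoot : Code
pushRoot = branch (rootA ⟦ xR ′ ⟧) (push xR) nop

scanEntry : Code
scanEntry = branch (residualA ⟦ cell uR yR ⟧) (branch (markA ⟦ yR ′ ⟧) nop (push yR)) nop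

-- At most 2 n nodes ever enter the queue, so a counter up to 2 n replaces the test for an empty
-- queue; positions not filled when their turn comes are skipped.
scan : Code
scan = branch (tailR ′ ⊖ xR ′) (assign uR (queueA ⟦ xR ′ ⟧) ⨟ forloop yR NR scanEntry) nop

search : Code
search = assign tailR (lit 0) ⨟ clear markA NR ⨟ forloop xR NR pushRoot ⨟ forloop xR NR scan

seekStep : Code
seekStep =
  branch (targetA ⟦ xR ′ ⟧) (branch (markA ⟦ xR ′ ⟧) (assign targetR (xR ′ ⊕ lit 1)) nop) nop

seek : Code
seek = assign targetR (lit 0) ⨟ forloop xR NR seekStep

augmentStep : Code
augmentStep =
  branch (rootA ⟦ currentR ′ ⟧) nop
    (assign uR (parentA ⟦ currentR ′ ⟧) ⨟
     write residualA (cell uR currentR) (residualA ⟦ cell uR currentR ⟧ ⊖ lit 1) ⨟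
     write residualA (cell currentR uR) (residualA ⟦ cell currentR uR ⟧ ⊕ lit 1) ⨟
     assign currentR (uR ′))

-- Marks are at most 2 n and decrease along parents, so 2 n iterations lead to a root; the remaining
-- ones idle.
augment : Code
augment = assign currentR (targetR ′ ⊖ lit 1) ⨟ forloop xR NR augmentStep

flowRound : Code
flowRound = branch (targetR ′) (search ⨟ seek ⨟ branch (targetR ′) augment nop) nop

-- K + 1 augmentations show that the minimum cut exceeds K. `targetR` stays nonzero as long as
-- searches succeed, so at the end it distinguishes this case from a closest cut; its initial value
-- only admits the first round.
maxflow : Code
maxflow = assign targetR (lit 1) ⨟ forloop roundR roundsR flowRound

pickStep : Code
pickStep =
  branch (markA ⟦ xR ′ ⟧)
    (branch (markA ⟦ nR ′ ⊕ xR ′ ⟧ ⊕ deletedA ⟦ xR ′ ⟧) nop (assign pickR (xR ′ ⊕ lit 1)))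
    nop

pick : Code
pick = assign pickR (lit 0) ⨟ forloop xR nR pickStep

decide : Code
decide =
  branch (targetR ′) nop
    (pick ⨟
     branch (pickR ′)
       (branch (guessA ⟦ ℓR ′ ⊕ ℓR ′ ⊕ stageR ′ ⟧)
         (branch (KR ′ ⊖ countR ′)
           (write deletedA (pickR ′ ⊖ lit 1) (lit 1) ⨟ assign countR (countR ′ ⊕ lit 1))
           nop)
         (write adoptedA (pickR ′ ⊖ lit 1) (lit 1)))
       (clear adoptedA NR ⨟ assign rankR (rankR ′ ⊕ lit 1)))

stage : Code
stage = branch (ℓR ′ ⊖ rankR ′) (prepare ⨟ build ⨟ maxflow ⨟ decide) nop

run : Code
run =
  clear deletedA nR ⨟
  clear adoptedA NR ⨟
  assign countR (lit 0) ⨟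
  assign rankR (lit 0) ⨟
  forloop stageR stagesR stage

carryStep : Code
carryStep =
  branch (carryR ′)
    (assign baseR (lit 2) ⨟
     branch (ℓR ′ ⊖ xR ′) (assign baseR (ℓR ′)) nop ⨟
     branch (baseR ′ ⊖ (guessA ⟦ xR ′ ⟧ ⊕ lit 1))
       (write guessA (xR ′) (guessA ⟦ xR ′ ⟧ ⊕ lit 1) ⨟ assign carryR (lit 0))
       (write guessA (xR ′) (lit 0)))
    nop

increment : Code
increment =
  assign carryR (lit 1) ⨟
  forloop xR digitsR carryStep ⨟
  branch (carryR ′) (assign goR (lit 0)) nop

attempt : Code
attempt = run ⨟ branch (ℓR ′ ⊖ rankR ′) increment (assign foundR (lit 1) ⨟ assign goR (lit 0))

-- A table of multiples of n built by repeated addition, because the machine cannot multiply to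
-- address rows.
offsets : Code
offsets = forloop xR NR (write offsetA (xR ′ ⊕ lit 1) (offsetA ⟦ xR ′ ⟧ ⊕ nR ′))

-- Abstract, since unfolding products with these large numerals is infeasible.
abstract

  attemptCost offsetsCost slack : ℕ
  attemptCost = coef attempt
  offsetsCost = coef offsets
  slack       = 1024 ^ 16

  attempt-cost : coef attempt ≡ attemptCost
  attempt-cost = refl

  offsets-cost : coef offsets ≡ offsetsCost
  offsets-cost = refl

  slack-large : 1024 ^ 16 ≤ slack
  slack-large = ≤-refl

  slack-pos : 1 ≤ slack
  slack-pos = <ᵇ⇒< 0 (1024 ^ 16) tt

registers : Program
registers =
  -- Two truncated subtractions compute the minimum of k and ℓ.
  KR ≔ KR ′ ⊖ (KR ′ ⊖ ℓR ′) ⨾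
  NR ≔ nR ′ ⊕ nR ′ ⨾
  roundsR ≔ KR ′ ⊕ lit 1 ⨾
  stagesR ≔ ℓR ′ ⊕ ℓR ′ ⊕ ℓR ′ ⨾
  digitsR ≔ stagesR ′ ⊕ ℓR ′ ⊕ ℓR ′ ⨾
  goR ≔ lit 1

multicut : Program
multicut = registers ⨾ ⟪ offsets ⟫ ⨾ while (goR ′) ⟪ attempt ⟫ ⨾ nR ≔ foundR ′

fixedArr : ℕ → ℕ
fixedArr = nth (adjA ∷ sA ∷ tA ∷ offsetA ∷ [])

-- Checked by evaluation, so that the input, the constants and the address table are carried through
-- concrete code with `refl`.
quiet : Program → Bool
quiet p = not (anyBelow constants (writesReg p)) ∧ not (anyBelow 4 (writesArr p ∘ fixedArr))

noneBelow : ∀ m p → anyBelow m p ≡ false → ∀ i → i < m → p i ≡ false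
noneBelow m p eq i i<m = ≢true⇒false λ pi → true≢false (anyBelow-true m p i i<m pi) eq

on : ℕ → Bool
on m = not (m ≡ᵇ 0)

on-true : ∀ {m} → m ≢ 0 → on m ≡ true
on-true {zero}  ne = contradiction refl ne
on-true {suc m} _  = refl

on-false : ∀ {m} → m ≡ 0 → on m ≡ false
on-false refl = refl

on-≢0 : ∀ {m} → on m ≡ true → m ≢ 0
on-≢0 {suc m} _ ()

on-≡0 : ∀ {m} → on m ≡ false → m ≡ 0
on-≡0 {zero} _ = refl

set-hit : ∀ {i j m k : ℕ} → i ≡ j → (if i ≡ᵇ j then m else k) ≡ m
set-hit {i} refl rewrite ≡ᵇ-refl i = refl

set-miss : ∀ {i j m k : ℕ} → i ≢ j → (if i ≡ᵇ j then m else k) ≡ k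
set-miss ne rewrite ≢⇒≡ᵇ-false ne = refl

set-≢0 : ∀ (i j : ℕ) {k : ℕ} → (if i ≡ᵇ j then 1 else k) ≢ 0 → i ≡ j ⊎ k ≢ 0
set-≢0 i j ne with i ≟ j
... | yes eq = inj₁ eq
... | no neq = inj₂ λ z → ne (trans (set-miss neq) z)

set-keeps : ∀ (i j : ℕ) {k : ℕ} → k ≢ 0 → (if i ≡ᵇ j then 1 else k) ≢ 0
set-keeps i j ne with i ≡ᵇ j
... | true  = λ ()
... | false = ne

record Static (n K ℓ : ℕ) (adj : ℕ → ℕ → Bool) (s t offset : ℕ → ℕ) (σ : Store) : Set where
  field
    n≡       : reg σ nR ≡ n
    ℓ≡       : reg σ ℓR ≡ ℓ
    K≡       : reg σ KR ≡ K
    N≡       : reg σ NR ≡ n + n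
    rounds≡  : reg σ roundsR ≡ suc K
    stages≡  : reg σ stagesR ≡ 3 * ℓ
    digits≡  : reg σ digitsR ≡ 5 * ℓ
    arcs≡    : ∀ u v → u < n → v < n → arr σ adjA (offset u + v) ≡ bit (adj u v)
    s≡       : ∀ i → i < ℓ → arr σ sA i ≡ s i
    t≡       : ∀ i → i < ℓ → arr σ tA i ≡ t i
    offset≡  : ∀ u → u < n + n → arr σ offsetA u ≡ offset u

static-keep : ∀ p {σ τ n K ℓ adj s t offset} → quiet p ≡ true → Frame p σ τ →
  Static n K ℓ adj s t offset σ → Static n K ℓ adj s t offset τ
static-keep p {σ} {τ} {n} {K} {ℓ} {adj} {s} {t} {offset} q F S = record
  { n≡      = trans (same 0 refl) n≡
  ; ℓ≡      = trans (same 1 refl) ℓ≡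
  ; K≡      = trans (same 2 refl) K≡
  ; N≡      = trans (same 3 refl) N≡
  ; rounds≡ = trans (same 4 refl) rounds≡
  ; stages≡ = trans (same 5 refl) stages≡
  ; digits≡ = trans (same 6 refl) digits≡
  ; arcs≡   = λ u v u<n v<n → trans (sameA 0 refl (offset u + v)) (arcs≡ u v u<n v<n)
  ; s≡      = λ i i<ℓ → trans (sameA 1 refl i) (s≡ i i<ℓ)
  ; t≡      = λ i i<ℓ → trans (sameA 2 refl i) (t≡ i i<ℓ)
  ; offset≡ = λ u u<N → trans (sameA 3 refl u) (offset≡ u u<N)
  }
  where
  open Static S
  checks = ∧-split (not (anyBelow constants (writesReg p))) q
  same : ∀ y → (y <ᵇ constants) ≡ true → reg τ y ≡ reg σ y
  same y y<7 = regs F y (noneBelow constants (writesReg p) (not-true (proj₁ checks)) y (<ᵇ-sound y<7))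
  sameA : ∀ i → (i <ᵇ 4) ≡ true → ∀ j → arr τ (fixedArr i) j ≡ arr σ (fixedArr i) j
  sameA i i<4 j = cong (λ f → f j) (arrs F (fixedArr i) (noneBelow 4 (writesArr p ∘ fixedArr) (not-true (proj₂ checks)) i (<ᵇ-sound i<4)))

-- The advice consists of ℓ ranks, ℓ directions and 3 ℓ decisions.
record Guided (ℓ : ℕ) (s t g rk source sink : ℕ → ℕ) (β : ℕ → Bool) : Set where
  field
    rk≡      : ∀ i → i < ℓ → g i ≡ rk i
    forward  : ∀ i → i < ℓ → g (ℓ + i) ≢ 0 → source i ≡ s i × sink i ≡ t i
    backward : ∀ i → i < ℓ → g (ℓ + i) ≡ 0 → source i ≡ t i × sink i ≡ s i
    bit-yes  : ∀ i → i < 3 * ℓ → g (ℓ + ℓ + i) ≢ 0 → β i ≡ true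
    bit-no   : ∀ i → i < 3 * ℓ → g (ℓ + ℓ + i) ≡ 0 → β i ≡ false

-- Correctness of the program

module Machine
  (n K ℓ : ℕ) (adj : ℕ → ℕ → Bool) (s t offset : ℕ → ℕ)
  (cell-injective : ∀ {x y x′ y′} → x < n + n → y < n + n → x′ < n + n → y′ < n + n →
    offset x + offset x + y ≡ offset x′ + offset x′ + y′ → x ≡ x′ × y ≡ y′)
  (rk source sink : ℕ → ℕ)
  (source< : ∀ i → i < ℓ → source i < n) (sink< : ∀ i → i < ℓ → sink i < n)
  (β : ℕ → Bool)
  where

  open Bits n K ℓ adj rk source sink public

  record Env (σ : Store) : Set where
    field
      static : Static n K ℓ adj s t offset σ
      guided : Guided ℓ s t (arr σ guessA) rk source sink β

    open Static static public
    open Guided guided public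

  open Env

  env-keep : ∀ p {σ τ} → quiet ⟪ p ⟫ ∧ not (writesArr ⟪ p ⟫ guessA) ≡ true → Frame ⟪ p ⟫ σ τ → Env σ → Env τ
  env-keep p {σ} {τ} q F E = record
    { static = static-keep ⟪ p ⟫ (proj₁ checks) F (static E)
    ; guided = subst (λ g → Guided ℓ s t g rk source sink β) (sym (arrs F guessA (not-true (proj₂ checks)))) (guided E)
    }
    where checks = ∧-split (quiet ⟪ p ⟫) q

  abstraction : Store → State
  abstraction σ = state (characteristic n (on ∘ arr σ deletedA)) (characteristic N (on ∘ arr σ adoptedA)) (reg σ rankR) (reg σ countR)

  deleted-abs : ∀ σ v → v < n → X? (abstraction σ) v ≡ on (arr σ deletedA v)
  deleted-abs σ = member-characteristic n (on ∘ arr σ deletedA)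

  adopted-abs : ∀ σ x → x < N → A? (abstraction σ) x ≡ on (arr σ adoptedA x)
  adopted-abs σ = member-characteristic N (on ∘ arr σ adoptedA)

  clear-correct : ∀ {a b σ τ u} → ⟪ clear a b ⟫ ⊢ σ ⇓[ u ] τ → (xR ≡ᵇ b) ≡ false → ∀ x → x < reg σ b → arr τ a x ≡ 0
  clear-correct {a} {b} {σ} d xb = for-invariant (λ i υ → ∀ x → x < i → arr υ a x ≡ 0) (write a (xR ′) (lit 0)) d refl refl xb (λ _ ()) step′
    where
    step′ : ∀ {j υ ω u} → j < reg σ b → reg υ xR ≡ j → Frame ⟪ clear a b ⟫ σ υ →
      ⟪ write a (xR ′) (lit 0) ⟫ ⊢ υ ⇓[ u ] ω → (∀ x → x < j → arr υ a x ≡ 0) → ∀ x → x < suc j → arr ω a x ≡ 0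
    step′ {j} {υ} j<b x≡j F ⇓arr inv x x<1+j rewrite ≡ᵇ-refl a with <-suc-cases x<1+j
    ... | inj₂ x≡ = set-hit (trans x≡j (sym x≡))
    ... | inj₁ x<j with reg υ xR ≟ x
    ...   | yes eq = set-hit eq
    ...   | no neq = trans (set-miss neq) (inv x x<j)

  record Terminals (σ τ : Store) : Set where
    field
      root-sound   : ∀ x → x < N → arr τ rootA x ≢ 0 → Root (reg σ rankR) x
      root-all     : ∀ x → x < N → Root (reg σ rankR) x → arr τ rootA x ≢ 0
      target-sound : ∀ x → x < N → arr τ targetA x ≢ 0 → Target (abstraction σ) x
      target-all   : ∀ x → x < N → Target (abstraction σ) x → arr τ targetA x ≢ 0

  endpoints-correct : ∀ {σ τ u i} → Env σ → reg σ xR ≡ i → i < ℓ → ⟪ endpoints ⟫ ⊢ σ ⇓[ u ] τ →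
    reg τ aR ≡ source i × reg τ bR ≡ sink i
  endpoints-correct {σ} {i = i} E refl i<ℓ (⇓then ne (⇓seq ⇓reg ⇓reg)) =
    case forward E i i<ℓ (λ z → ne (trans (cong (λ m → arr σ guessA (m + i)) (ℓ≡ E)) z)) of λ (p , q) →
      trans (s≡ E i i<ℓ) (sym p) , trans (t≡ E i i<ℓ) (sym q)
  endpoints-correct {σ} {i = i} E refl i<ℓ (⇓else ez (⇓seq ⇓reg ⇓reg)) =
    case backward E i i<ℓ (trans (cong (λ m → arr σ guessA (m + i)) (sym (ℓ≡ E))) ez) of λ (p , q) →
      trans (t≡ E i i<ℓ) (sym p) , trans (s≡ E i i<ℓ) (sym q)

  prepare-correct : ∀ {σ τ u} → Env σ → ⟪ prepare ⟫ ⊢ σ ⇓[ u ] τ → Terminals σ τ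
  prepare-correct {σ} {τ} E (⇓seq {τ = υ₀} d₁ d₂) = record
    { root-sound = λ x x<N ne → case proj₁ (proj₁ final x x<N) ne of λ { (i , i<ℓ , r) → i , i<ℓ , r }
    ; root-all = λ x x<N r → proj₂ (proj₁ final x x<N) r
    ; target-sound = λ x x<N ne → case proj₁ (proj₂ final x x<N) ne of λ
        { (inj₁ a) → inj₁ (trans (adopted-abs σ x x<N) (on-true a)) ; (inj₂ b) → inj₂ b }
    ; target-all = λ x x<N → λ
        { (inj₁ a) → proj₂ (proj₂ final x x<N) (inj₁ (on-≢0 (trans (sym (adopted-abs σ x x<N)) a)))
        ; (inj₂ b) → proj₂ (proj₂ final x x<N) (inj₂ b) }
    }
    where
    ρ : ℕ
    ρ = reg σ rankR

    Cleared : ℕ → Store → Set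
    Cleared i υ = ∀ x → x < i → arr υ rootA x ≡ 0 × arr υ targetA x ≡ arr σ adoptedA x

    clears : ∀ {j υ ω u} → j < reg σ NR → reg υ xR ≡ j → Frame ⟪ forloop xR NR resetTerminal ⟫ σ υ →
      ⟪ resetTerminal ⟫ ⊢ υ ⇓[ u ] ω →
      Cleared j υ → Cleared (suc j) (setReg ω xR (suc j))
    clears {j} {υ} j<N refl F (⇓seq ⇓arr ⇓arr) inv x x<1+j with <-suc-cases x<1+j
    ... | inj₂ refl = set-hit {reg υ xR} refl , trans (set-hit {reg υ xR} refl) (cong (λ f → f x) (arrs F adoptedA refl))
    ... | inj₁ x<j = trans (set-miss (<⇒≢ x<j ∘ sym)) (proj₁ (inv x x<j)) , trans (set-miss (<⇒≢ x<j ∘ sym)) (proj₂ (inv x x<j))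

    cleared : ∀ x → x < N → arr υ₀ rootA x ≡ 0 × arr υ₀ targetA x ≡ arr σ adoptedA x
    cleared = subst (λ m → ∀ x → x < m → arr υ₀ rootA x ≡ 0 × arr υ₀ targetA x ≡ arr σ adoptedA x) (N≡ E)
      (for-invariant Cleared resetTerminal d₁ refl refl refl (λ _ ()) clears)

    E₀ : Env υ₀
    E₀ = env-keep (forloop xR NR resetTerminal) refl (frame-of d₁) E

    RootBelow TargetBelow : ℕ → ℕ → Set
    RootBelow m x = Σ[ i ∈ ℕ ] (i < m × ρ ≤ rk i × x ≡ source i)
    TargetBelow m x = arr σ adoptedA x ≢ 0 ⊎ Σ[ i ∈ ℕ ] (i < m × rk i ≡ ρ × x ≡ n + sink i)

    Marked : ℕ → Store → Set
    Marked m υ =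
      (∀ x → x < N → (arr υ rootA x ≢ 0 → RootBelow m x) × (RootBelow m x → arr υ rootA x ≢ 0)) ×
      (∀ x → x < N → (arr υ targetA x ≢ 0 → TargetBelow m x) × (TargetBelow m x → arr υ targetA x ≢ 0))

    grow-root : ∀ {m x} → RootBelow m x → RootBelow (suc m) x
    grow-root (i , i<m , r) = i , m<n⇒m<1+n i<m , r

    grow-target : ∀ {m x} → TargetBelow m x → TargetBelow (suc m) x
    grow-target (inj₁ a) = inj₁ a
    grow-target (inj₂ (i , i<m , r)) = inj₂ (i , m<n⇒m<1+n i<m , r)

    mark-step : ∀ {j υ ω u} → j < ℓ → reg υ xR ≡ j → Env υ → reg υ rankR ≡ ρ →
      ⟪ endpoints ⨟ markTerminal ⟫ ⊢ υ ⇓[ u ] ω →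
      Marked j υ → Marked (suc j) (setReg ω xR (suc j))
    mark-step {j} {υ} j<ℓ x≡j Eυ ρ≡ (⇓seq {τ = υ′} d e) inv = rest e
      where
      Eυ′ : Env υ′
      Eυ′ = env-keep endpoints refl (frame-of d) Eυ
      ab : reg υ′ aR ≡ source j × reg υ′ bR ≡ sink j
      ab = endpoints-correct Eυ x≡j j<ℓ d
      rank≡ : reg υ′ rankR ≡ ρ
      rank≡ = trans (reg-frame d rankR refl) ρ≡
      rkj : arr υ′ guessA (reg υ′ xR) ≡ rk j
      rkj = trans (cong (arr υ′ guessA) (trans (reg-frame d xR refl) x≡j)) (rk≡ Eυ′ j j<ℓ)
      inv′ : Marked j υ′
      inv′ = (λ x x<N → subst (λ f → (f x ≢ 0 → RootBelow j x) × (RootBelow j x → f x ≢ 0)) (sym (arr-frame d rootA refl)) (proj₁ inv x x<N)) ,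
             (λ x x<N → subst (λ f → (f x ≢ 0 → TargetBelow j x) × (TargetBelow j x → f x ≢ 0)) (sym (arr-frame d targetA refl)) (proj₂ inv x x<N))

      old-root : ¬ ρ ≤ rk j → ∀ {x} → RootBelow (suc j) x → RootBelow j x
      old-root nle (i , i<1+j , le , eq) with <-suc-cases i<1+j
      ... | inj₁ i<j = i , i<j , le , eq
      ... | inj₂ refl = contradiction le nle
      old-target : rk j ≢ ρ → ∀ {x} → TargetBelow (suc j) x → TargetBelow j x
      old-target ne (inj₁ a) = inj₁ a
      old-target ne (inj₂ (i , i<1+j , e , eq)) with <-suc-cases i<1+j
      ... | inj₁ i<j = inj₂ (i , i<j , e , eq)
      ... | inj₂ refl = contradiction e ne

      same-targets : rk j ≢ ρ → ∀ x → x < N → (arr υ′ targetA x ≢ 0 → TargetBelow (suc j) x) × (TargetBelow (suc j) x → arr υ′ targetA x ≢ 0)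
      same-targets ne x x<N = grow-target ∘ proj₁ (proj₂ inv′ x x<N) , proj₂ (proj₂ inv′ x x<N) ∘ old-target ne

      new-roots : ρ ≤ rk j → ∀ x → x < N →
        ((if reg υ′ aR ≡ᵇ x then 1 else arr υ′ rootA x) ≢ 0 → RootBelow (suc j) x) ×
        (RootBelow (suc j) x → (if reg υ′ aR ≡ᵇ x then 1 else arr υ′ rootA x) ≢ 0)
      new-roots le x x<N =
        (λ ne → case set-≢0 (reg υ′ aR) x ne of λ
          { (inj₁ eq) → j , ≤-refl , le , trans (sym eq) (proj₁ ab)
          ; (inj₂ old) → grow-root (proj₁ (proj₁ inv′ x x<N) old) }) ,
        λ (i , i<1+j , le′ , eq) → case <-suc-cases i<1+j of λ
          { (inj₁ i<j) → set-keeps (reg υ′ aR) x (proj₂ (proj₁ inv′ x x<N) (i , i<j , le′ , eq))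
          ; (inj₂ refl) → λ z → case trans (sym (set-hit (trans (proj₁ ab) (sym eq)))) z of λ () }

      rest : ∀ {ω u} → ⟪ markTerminal ⟫ ⊢ υ′ ⇓[ u ] ω → Marked (suc j) (setReg ω xR (suc j))
      rest (⇓then ne ⇓skip) =
        (λ x x<N → grow-root ∘ proj₁ (proj₁ inv′ x x<N) , proj₂ (proj₁ inv′ x x<N) ∘ old-root low) ,
        same-targets (λ e → low (≤-reflexive (sym e)))
        where
        low : ¬ ρ ≤ rk j
        low le = ne (trans (cong₂ _∸_ rank≡ rkj) (m≤n⇒m∸n≡0 le))
      rest (⇓else ez (⇓seq ⇓arr (⇓then ne ⇓skip))) =
        new-roots (m∸n≡0⇒m≤n (trans (sym (cong₂ _∸_ rank≡ rkj)) ez)) ,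
        same-targets (λ e → ne (trans (cong₂ _∸_ rkj rank≡) (m≤n⇒m∸n≡0 (≤-reflexive e))))
      rest (⇓else ez (⇓seq ⇓arr (⇓else ez′ ⇓arr))) =
        new-roots le ,
        λ x x<N →
        (λ ne → case set-≢0 (reg υ′ nR + reg υ′ bR) x ne of λ
          { (inj₁ eq) → inj₂ (j , ≤-refl , rk≡ρ , trans (sym eq) new)
          ; (inj₂ old) → grow-target (proj₁ (proj₂ inv′ x x<N) old) }) ,
        λ { (inj₁ a) → set-keeps (reg υ′ nR + reg υ′ bR) x (proj₂ (proj₂ inv′ x x<N) (inj₁ a))
          ; (inj₂ (i , i<1+j , e , eq)) → case <-suc-cases i<1+j of λ
              { (inj₁ i<j) → set-keeps (reg υ′ nR + reg υ′ bR) x (proj₂ (proj₂ inv′ x x<N) (inj₂ (i , i<j , e , eq)))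
              ; (inj₂ refl) → λ z → case trans (sym (set-hit (trans new (sym eq)))) z of λ () } }
        where
        le : ρ ≤ rk j
        le = m∸n≡0⇒m≤n (trans (sym (cong₂ _∸_ rank≡ rkj)) ez)
        rk≡ρ : rk j ≡ ρ
        rk≡ρ = ≤-antisym (m∸n≡0⇒m≤n (trans (sym (cong₂ _∸_ rkj rank≡)) ez′)) le
        new : reg υ′ nR + reg υ′ bR ≡ n + sink j
        new = cong₂ _+_ (n≡ Eυ′) (proj₂ ab)

    final : Marked ℓ τ
    final = subst (λ m → Marked m τ) (ℓ≡ E₀) (for-invariant Marked (endpoints ⨟ markTerminal) d₂ refl refl refl
      ((λ x x<N → (λ ne → contradiction (proj₁ (cleared x x<N)) ne) , λ { (_ , () , _) }) ,
       (λ x x<N → (λ ne → inj₁ (subst (_≢ 0) (proj₂ (cleared x x<N)) ne)) ,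
         λ { (inj₁ a) → subst (_≢ 0) (sym (proj₂ (cleared x x<N))) a ; (inj₂ (_ , () , _)) }))
      (λ j<b x≡j F → mark-step (subst (_ <_) (ℓ≡ E₀) j<b) x≡j (env-keep (forloop xR ℓR (endpoints ⨟ markTerminal)) refl F E₀)
        (trans (regs F rankR refl) (reg-frame d₁ rankR refl))))

  residual : Store → ℕ → ℕ → ℕ
  residual σ x y = arr σ residualA (offset x + offset x + y)

  entryValue : (ℕ → ℕ) → ℕ → ℕ → ℕ
  entryValue del x y =
    if x <ᵇ n
    then (if n + x ≡ᵇ y then bit (not (on (del x))) else 0)
    else (if y <ᵇ n then (if adj (x ∸ n) y then suc K else 0) else 0)

  private
    ∸≢0⇒< : ∀ {a b} → a ∸ b ≢ 0 → b < a
    ∸≢0⇒< ne = ≰⇒> λ le → ne (m≤n⇒m∸n≡0 le)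

  entry-correct : ∀ {σ τ u x y} → Env σ → reg σ xR ≡ x → reg σ yR ≡ y → x < N → reg σ capR ≡ 0 →
    ⟪ entry ⟫ ⊢ σ ⇓[ u ] τ → reg τ capR ≡ entryValue (arr σ deletedA) x y
  entry-correct {σ} {x = x} {y} E refl refl x<N c0 (⇓then ne (⇓then ne′ ⇓skip))
    rewrite n≡ E | <ᵇ-complete {x} {n} (∸≢0⇒< {n} {x} ne) | ≢⇒≡ᵇ-false {n + x} {y}
        (λ e → ne′ (cong₂ _+_ (m≤n⇒m∸n≡0 (≤-reflexive e)) (m≤n⇒m∸n≡0 (≤-reflexive (sym e))))) = c0
  entry-correct {σ} {x = x} {y} E refl refl x<N c0 (⇓then ne (⇓else ez ⇓reg))
    rewrite n≡ E | <ᵇ-complete {x} {n} (∸≢0⇒< {n} {x} ne)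
          | ≤-antisym (m∸n≡0⇒m≤n {n + x} {y} (m+n≡0⇒m≡0 (n + x ∸ y) ez)) (m∸n≡0⇒m≤n {y} {n + x} (m+n≡0⇒n≡0 (n + x ∸ y) ez)) | ≡ᵇ-refl y =
    complement (arr σ deletedA x)
    where
    complement : ∀ m → 1 ∸ m ≡ bit (not (on m))
    complement zero          = refl
    complement (suc zero)    = refl
    complement (suc (suc m)) = refl
  entry-correct {σ} {x = x} {y} E refl refl x<N c0 (⇓else ez (⇓then ne (⇓then a ⇓reg)))
    rewrite n≡ E | ≥⇒<ᵇ-false {x} {n} (m∸n≡0⇒m≤n ez) | <ᵇ-complete {y} {n} (∸≢0⇒< {n} {y} ne) =
    arc (trans (cong (λ o → arr σ adjA (o + y)) (offset≡ E (x ∸ n) (≤-<-trans (m∸n≤m x n) x<N))) (arcs≡ E (x ∸ n) y x-n<n (∸≢0⇒< {n} {y} ne)))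
    where
    x-n<n : x ∸ n < n
    x-n<n = m<n+o⇒m∸n<o x n ⦃ >-nonZero (≤-<-trans z≤n (∸≢0⇒< {n} {y} ne)) ⦄ x<N
    arc : arr σ adjA (arr σ offsetA (x ∸ n) + y) ≡ bit (adj (x ∸ n) y) → reg σ roundsR ≡ (if adj (x ∸ n) y then suc K else 0)
    arc e with adj (x ∸ n) y
    ... | true  = rounds≡ E
    ... | false = contradiction e a
  entry-correct {σ} {x = x} {y} E refl refl x<N c0 (⇓else ez (⇓then ne (⇓else a ⇓skip)))
    rewrite n≡ E | ≥⇒<ᵇ-false {x} {n} (m∸n≡0⇒m≤n ez) | <ᵇ-complete {y} {n} (∸≢0⇒< {n} {y} ne) =
    arc (trans (cong (λ o → arr σ adjA (o + y)) (offset≡ E (x ∸ n) (≤-<-trans (m∸n≤m x n) x<N))) (arcs≡ E (x ∸ n) y x-n<n (∸≢0⇒< {n} {y} ne)))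
    where
    x-n<n : x ∸ n < n
    x-n<n = m<n+o⇒m∸n<o x n ⦃ >-nonZero (≤-<-trans z≤n (∸≢0⇒< {n} {y} ne)) ⦄ x<N
    arc : arr σ adjA (arr σ offsetA (x ∸ n) + y) ≡ bit (adj (x ∸ n) y) → reg σ capR ≡ (if adj (x ∸ n) y then suc K else 0)
    arc e with adj (x ∸ n) y
    ... | true  = contradiction (trans (sym e) a) λ ()
    ... | false = c0
  entry-correct {σ} {x = x} {y} E refl refl x<N c0 (⇓else ez (⇓else ez′ ⇓skip))
    rewrite n≡ E | ≥⇒<ᵇ-false {x} {n} (m∸n≡0⇒m≤n ez) | ≥⇒<ᵇ-false {y} {n} (m∸n≡0⇒m≤n ez′) = c0

  cell≡ : ∀ {σ x y u v} → Env σ → reg σ u ≡ x → reg σ v ≡ y → x < N → eval σ (cell u v) ≡ offset x + offset x + y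
  cell≡ E refl refl x<N rewrite offset≡ E _ x<N = refl

  buildEntry-correct : ∀ {σ τ u x y} → Env σ → reg σ xR ≡ x → reg σ yR ≡ y → x < N → y < N →
    ⟪ buildEntry ⟫ ⊢ σ ⇓[ u ] τ →
    residual τ x y ≡ entryValue (arr σ deletedA) x y ×
    (∀ x′ y′ → x′ < N → y′ < N → (x ≢ x′ ⊎ y ≢ y′) → residual τ x′ y′ ≡ residual σ x′ y′)
  buildEntry-correct {σ} {x = x} {y} E x≡ y≡ x<N y<N (⇓seq ⇓reg (⇓seq {τ = υ} d ⇓arr)) =
    trans (set-hit addr) (entry-correct E₀ x≡ y≡ x<N refl d) ,
    λ x′ y′ x′<N y′<N ne → trans (set-miss λ e → case cell-injective x<N y<N x′<N y′<N
        (trans (sym addr) e) of λ { (p , q) → [ (λ a → a p) , (λ b → b q) ]′ ne })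
      (cong (λ f → f (offset x′ + offset x′ + y′)) (arr-frame d residualA refl))
    where
    E₀ : Env (setReg σ capR 0)
    E₀ = env-keep (assign capR (lit 0)) refl (frame-of ⇓reg) E
    addr : eval υ (cell xR yR) ≡ offset x + offset x + y
    addr = cell≡ (env-keep entry refl (frame-of d) E₀) (trans (reg-frame d xR refl) x≡) (trans (reg-frame d yR refl) y≡) x<N

  build-entries : ∀ {σ τ u} → Env σ → ⟪ build ⟫ ⊢ σ ⇓[ u ] τ →
    ∀ x y → x < N → y < N → residual τ x y ≡ entryValue (arr σ deletedA) x y
  build-entries {σ} {τ} E d = λ x y x<N y<N → final x x<N y y<N
    where
    del : ℕ → ℕ
    del = arr σ deletedA

    Rows : ℕ → Store → Set
    Rows i υ = ∀ x → x < i → ∀ y → y < N → residual υ x y ≡ entryValue del x y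

    Row : ℕ → ℕ → Store → Set
    Row i j υ = Rows i υ × (∀ y → y < j → residual υ i y ≡ entryValue del i y)

    row-done : ∀ {i υ ω u} → i < N → reg υ xR ≡ i → Env υ → arr υ deletedA ≡ del →
      ⟪ forloop yR NR buildEntry ⟫ ⊢ υ ⇓[ u ] ω → Rows i υ → Row i N ω
    row-done {i} {υ} {ω} i<N x≡i Eυ del≡ d rows =
      subst (λ m → Row i m ω) (N≡ Eυ) (for-invariant (Row i) buildEntry d refl refl refl (rows , λ _ ())
        λ {j} j<b y≡j F e inv →
          let j<N = subst (j <_) (N≡ Eυ) j<b
              new , old = buildEntry-correct (env-keep (forloop yR NR buildEntry) refl F Eυ) (trans (regs F xR refl) x≡i) y≡j i<N j<N e
          in (λ x x<i y y<N → trans (old x y (<-trans x<i i<N) y<N (inj₁ (<⇒≢ x<i ∘ sym))) (proj₁ inv x x<i y y<N)) ,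
             (λ y y<1+j → [ (λ y<j → trans (old i y i<N (<-trans y<j j<N) (inj₂ (<⇒≢ y<j ∘ sym))) (proj₂ inv y y<j))
                          , (λ { refl → trans new (cong (λ f → entryValue f i j) (trans (arrs F deletedA refl) del≡)) }) ]′ (<-suc-cases y<1+j)))

    row-step : ∀ {i υ ω u} → i < N → reg υ xR ≡ i → Env υ → arr υ deletedA ≡ del →
      ⟪ forloop yR NR buildEntry ⟫ ⊢ υ ⇓[ u ] ω → Rows i υ → Rows (suc i) (setReg ω xR (suc i))
    row-step i<N x≡i Eυ del≡ d rows x x<1+i y y<N
      with row-done i<N x≡i Eυ del≡ d rows | <-suc-cases x<1+i
    ... | old , new | inj₁ x<i  = old x x<i y y<N
    ... | old , new | inj₂ refl = new y y<N

    final : Rows N τ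
    final = subst (λ m → Rows m τ) (N≡ E) (for-invariant Rows (forloop yR NR buildEntry) d refl refl refl (λ _ ())
      λ {j} j<b x≡j F → row-step (subst (j <_) (N≡ E) j<b) x≡j (env-keep build refl F E) (arrs F deletedA refl))

  build-correct : ∀ {σ τ u} → Env σ → ⟪ build ⟫ ⊢ σ ⇓[ u ] τ → Capacities (X? (abstraction σ)) (residual τ)
  build-correct {σ} {τ} E d = record
    { in-in   = λ u v u<n v<n → trans (all u v (in< u<n) (in< v<n)) (in-value u v u<n λ e → <⇒≱ v<n (subst (n ≤_) e (m≤m+n n u)))
    ; in-out  = λ v v<n → trans (all v (n + v) (in< v<n) (out< v<n)) (trans (diagonal v v<n) (cong (bit ∘ not) (sym (deleted-abs σ v v<n))))
    ; in-out′ = λ u v u<n v<n u≢v → trans (all u (n + v) (in< u<n) (out< v<n)) (in-value u (n + v) u<n (u≢v ∘ +-cancelˡ-≡ n u v))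
    ; out-in  = λ u v u<n v<n → trans (all (n + u) v (out< u<n) (in< v<n)) (arc-value u v v<n)
    ; out-out = λ u v u<n v<n → trans (all (n + u) (n + v) (out< u<n) (out< v<n)) (out-value u v)
    }
    where
    del : ℕ → ℕ
    del = arr σ deletedA
    all = build-entries E d
    in-value : ∀ x y → x < n → n + x ≢ y → entryValue del x y ≡ 0
    in-value x y x<n ne rewrite <ᵇ-complete x<n | ≢⇒≡ᵇ-false ne = refl
    diagonal : ∀ v → v < n → entryValue del v (n + v) ≡ bit (not (on (del v)))
    diagonal v v<n rewrite <ᵇ-complete v<n | ≡ᵇ-refl (n + v) = refl
    arc-value : ∀ u v → v < n → entryValue del (n + u) v ≡ (if adj u v then suc K else 0)
    arc-value u v v<n rewrite ≥⇒<ᵇ-false (m≤m+n n u) | <ᵇ-complete v<n | m+n∸m≡n n u = refl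
    out-value : ∀ u v → entryValue del (n + u) (n + v) ≡ 0
    out-value u v rewrite ≥⇒<ᵇ-false (m≤m+n n u) | ≥⇒<ᵇ-false (m≤m+n n v) = refl

  -- Breadth-first search, augmentation and maximum flow

  record Queue (mark parent queue : ℕ → ℕ) (tail : ℕ) (r : ℕ → ℕ → ℕ) (Z : ℕ → Set) : Set where
    field
      slot   : ∀ i → i < tail → queue i < N × mark (queue i) ≡ suc i
      placed : ∀ v → v < N → mark v ≢ 0 → Σ[ i ∈ ℕ ] (i < tail × mark v ≡ suc i × queue i ≡ v)
      why    : ∀ v → v < N → mark v ≢ 0 →
        Z v ⊎ (parent v < N × mark (parent v) ≢ 0 × mark (parent v) < mark v × r (parent v) v ≢ 0)

  QueueIn : Store → (ℕ → ℕ → ℕ) → (ℕ → Set) → Set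
  QueueIn σ = Queue (arr σ markA) (arr σ parentA) (arr σ queueA) (reg σ tailR)

  enqueue : ∀ {mark parent queue tail r Z v u} → Queue mark parent queue tail r Z → v < N → mark v ≡ 0 →
    Z v ⊎ (u < N × mark u ≢ 0 × r u v ≢ 0) →
    Queue (update mark v (suc tail)) (update parent v u) (update queue tail v) (suc tail) r Z
  enqueue {mark} {parent} {queue} {tail} {r} {Z} {v} {u} q v<N unmarked reason = record
    { slot = λ i i<1+t → case <-suc-cases i<1+t of λ
        { (inj₁ i<t) → let b , m = slot i i<t in
            subst (_< N) (sym (update-other queue (<⇒≢ i<t ∘ sym))) b ,
            trans (cong (update mark v (suc tail)) (update-other queue (<⇒≢ i<t ∘ sym)))
              (trans (update-other mark λ eq → case trans (sym m) (trans (cong mark (sym eq)) unmarked) of λ ()) m)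
        ; (inj₂ refl) → subst (_< N) (sym (update-same queue tail)) v<N ,
            trans (cong (update mark v (suc tail)) (update-same queue tail)) (update-same mark v) }
    ; placed = placed′
    ; why = why′
    }
    where
    open Queue q
    mark′ : ℕ → ℕ
    mark′ = update mark v (suc tail)

    placed′ : ∀ w → w < N → mark′ w ≢ 0 → Σ[ i ∈ ℕ ] (i < suc tail × mark′ w ≡ suc i × update queue tail v i ≡ w)
    placed′ w w<N ne with v ≟ w
    ... | yes refl = tail , ≤-refl , update-same mark v , update-same queue tail
    ... | no v≢w with placed w w<N (subst (_≢ 0) (update-other mark v≢w) ne)
    ...   | i , i<t , m , qi = i , m<n⇒m<1+n i<t , trans (update-other mark v≢w) m ,
                               trans (update-other queue (<⇒≢ i<t ∘ sym)) qi

    old-mark : ∀ {w} → mark w ≢ 0 → mark′ w ≡ mark w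
    old-mark {w} ne = update-other mark {v} {w} λ { refl → ne unmarked }

    why′ : ∀ w → w < N → mark′ w ≢ 0 →
      Z w ⊎ (update parent v u w < N × mark′ (update parent v u w) ≢ 0 × mark′ (update parent v u w) < mark′ w × r (update parent v u w) w ≢ 0)
    why′ w w<N ne with v ≟ w
    ... | no v≢w rewrite ≢⇒≡ᵇ-false v≢w with why w w<N ne
    ...   | inj₁ z = inj₁ z
    ...   | inj₂ (p<N , mp , lt , e) = inj₂ (p<N , subst (_≢ 0) (sym (old-mark mp)) mp , subst (_< mark w) (sym (old-mark mp)) lt , e)
    why′ w w<N ne | yes refl rewrite ≡ᵇ-refl v = case reason of λ
      { (inj₁ z) → inj₁ z
      ; (inj₂ (u<N , mu , e)) → inj₂ (u<N , subst (_≢ 0) (sym (old-mark mu)) mu ,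
          subst (_< suc tail) (sym (old-mark mu)) (case placed u u<N mu of λ (i , i<t , m , _) → s≤s (subst (_≤ tail) (sym m) i<t)) , e) }

  -- The mark of a node recovers its position, so the entries of the queue are distinct nodes.
  queue-bounded : ∀ {mark parent queue tail r Z} → Queue mark parent queue tail r Z → tail ≤ N
  queue-bounded {mark} {tail = tail} {r} q = ≮⇒≥ λ N<tail →
    case pigeonhole N<tail (λ i → fromℕ< (proj₁ (slot (toℕ i) (toℕ<n i)))) of λ (i , j , i<j , eq) →
      <-irrefl (suc-injective (begin
        suc (toℕ i)      ≡⟨ sym (proj₂ (slot (toℕ i) (toℕ<n i))) ⟩
        mark _           ≡⟨ cong mark (trans (sym (toℕ-fromℕ< _)) (trans (cong toℕ eq) (toℕ-fromℕ< _))) ⟩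
        mark _           ≡⟨ proj₂ (slot (toℕ j) (toℕ<n j)) ⟩
        suc (toℕ j)      ∎)) i<j
    where
    open Queue q
    open ≡-Reasoning

  push-correct : ∀ {σ τ t r Z x} v → (tailR ≡ᵇ v) ≡ false → reg σ v ≡ x → x < N → arr σ markA x ≡ 0 →
    Z x ⊎ (reg σ uR < N × arr σ markA (reg σ uR) ≢ 0 × r (reg σ uR) x ≢ 0) →
    ⟪ push v ⟫ ⊢ σ ⇓[ t ] τ → QueueIn σ r Z → QueueIn τ r Z
  push-correct {σ} {r = r} {Z} v tv refl x<N m0 reason (⇓seq ⇓arr (⇓seq ⇓reg (⇓seq ⇓arr ⇓arr))) q
    rewrite tv | +-comm (reg σ tailR) 1 = enqueue q x<N m0 reason

  push-marks : ∀ {σ τ t x} v → (tailR ≡ᵇ v) ≡ false → reg σ v ≡ x →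
    ⟪ push v ⟫ ⊢ σ ⇓[ t ] τ → arr τ markA x ≢ 0 × (∀ w → x ≢ w → arr τ markA w ≡ arr σ markA w) ×
    (∀ w → arr σ markA w ≢ 0 → arr τ markA w ≢ 0) ×
    reg τ tailR ≡ suc (reg σ tailR) × (∀ i → i < reg σ tailR → arr τ queueA i ≡ arr σ queueA i)
  push-marks {σ} {x = x} v tv refl (⇓seq ⇓arr (⇓seq ⇓reg (⇓seq ⇓arr ⇓arr)))
    rewrite tv | +-comm (reg σ tailR) 1 =
    subst (_≢ 0) (sym (set-hit {reg σ v} refl)) (λ ()) , (λ w → set-miss) , keeps , refl ,
    λ i i<t → set-miss (<⇒≢ i<t ∘ sym)
    where
    keeps : ∀ w → arr σ markA w ≢ 0 → (if reg σ v ≡ᵇ w then suc (reg σ tailR) else arr σ markA w) ≢ 0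
    keeps w ne with reg σ v ≡ᵇ w
    ... | true  = λ ()
    ... | false = ne

  IsRoot : Store → ℕ → Set
  IsRoot σ x = arr σ rootA x ≢ 0

  record Searched (r : ℕ → ℕ → ℕ) (Z : ℕ → Set) (τ : Store) : Set where
    field
      queueIn   : QueueIn τ r Z
      all-roots : ∀ x → x < N → Z x → arr τ markA x ≢ 0
      all-nodes : ∀ x y → x < N → y < N → arr τ markA x ≢ 0 → r x y ≢ 0 → arr τ markA y ≢ 0

    open Queue queueIn public

    mark≤N : ∀ x → x < N → arr τ markA x ≢ 0 → arr τ markA x ≤ N
    mark≤N x x<N m with placed x x<N m
    ... | i , i<t , e , _ = subst (_≤ N) (sym e) (≤-trans i<t (queue-bounded queueIn))

    reached : Reached Z r (on ∘ arr τ markA)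
    reached = record
      { roots  = λ x x<N z → on-true (all-roots x x<N z)
      ; closed = λ x y x<N y<N Qx e → on-true (all-nodes x y x<N y<N (on-≢0 Qx) e)
      -- Parents enter the queue before their children.
      ; order  = arr τ markA
      ; parent = λ x x<N Qx → case why x x<N (on-≢0 Qx) of λ
          { (inj₁ z) → inj₁ z
          ; (inj₂ (p<N , mp , lt , e)) → inj₂ (arr τ parentA x , p<N , on-true mp , lt , e) }
      }

  search-correct : ∀ {σ τ u} → Env σ → ⟪ search ⟫ ⊢ σ ⇓[ u ] τ → Searched (residual σ) (IsRoot σ) τ
  search-correct {σ} {τ} E (⇓seq ⇓reg (⇓seq {τ = σ₁} d₁ (⇓seq {τ = σ₂} d₂ d₃))) = record
    { queueIn = proj₁ scanned
    ; all-roots = proj₁ (proj₂ scanned)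
    -- A marked node occupies a position below the tail, hence below 2 n, and all those positions
    -- have been scanned.
    ; all-nodes = λ x y x<N y<N mx e → case Queue.placed (proj₁ scanned) x x<N mx of λ
        { (i , i<t , _ , refl) → proj₂ (proj₂ scanned) i (≤-trans i<t (queue-bounded (proj₁ scanned))) i<t y y<N e }
    }
    where
    r : ℕ → ℕ → ℕ
    r = residual σ
    Z : ℕ → Set
    Z = IsRoot σ

    E₁ : Env σ₁
    E₁ = env-keep (assign tailR (lit 0) ⨟ clear markA NR) refl (frame-of (⇓seq ⇓reg d₁)) E
    E₂ : Env σ₂
    E₂ = env-keep (forloop xR NR pushRoot) refl (frame-of d₂) E₁

    unmarked : ∀ x → x < N → arr σ₁ markA x ≡ 0
    unmarked = subst (λ m → ∀ x → x < m → arr σ₁ markA x ≡ 0) (N≡ E) (clear-correct d₁ refl)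

    -- The last component, that later nodes are still unmarked, is why roots can be enqueued without
    -- testing their marks.
    Rooted : ℕ → Store → Set
    Rooted i υ = QueueIn υ r Z × (∀ x → x < i → x < N → Z x → arr υ markA x ≢ 0) × (∀ x → i ≤ x → x < N → arr υ markA x ≡ 0)

    root-step : ∀ {i υ ω u} → i < N → reg υ xR ≡ i → arr υ rootA ≡ arr σ rootA →
      ⟪ pushRoot ⟫ ⊢ υ ⇓[ u ] ω → Rooted i υ → Rooted (suc i) (setReg ω xR (suc i))
    root-step {i} {υ} {ω} i<N x≡i root≡ (⇓then ne d) (q , before , after) =
      push-correct xR refl x≡i i<N (after i ≤-refl i<N) (inj₁ Zi) d q ,
      (λ x x<1+i x<N z → [ (λ x<i → keeps x (before x x<i x<N z)) , (λ { refl → hit }) ]′ (<-suc-cases x<1+i)) ,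
      λ x i<x x<N → trans (miss x (<⇒≢ i<x)) (after x (<⇒≤ i<x) x<N)
      where
      Zi : Z i
      Zi = subst₂ (λ f m → f m ≢ 0) root≡ x≡i ne
      facts = push-marks xR refl x≡i d
      hit = proj₁ facts
      miss = proj₁ (proj₂ facts)
      keeps = proj₁ (proj₂ (proj₂ facts))
    root-step {i} {υ} {ω} i<N x≡i root≡ (⇓else ez ⇓skip) (q , before , after) =
      q ,
      (λ x x<1+i x<N z → [ (λ x<i → before x x<i x<N z) ,
          (λ { refl → contradiction (subst₂ (λ f m → f m ≡ 0) root≡ x≡i ez) z }) ]′ (<-suc-cases x<1+i)) ,
      λ x i<x x<N → after x (<⇒≤ i<x) x<N

    rooted : Rooted N σ₂
    rooted = subst (λ m → Rooted m σ₂) (N≡ E₁) (for-invariant Rooted pushRoot d₂ refl refl refl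
      (record { slot = λ i i<t → ⊥-elim (n≮0 (subst (i <_) (reg-frame d₁ tailR refl) i<t))
              ; placed = λ v v<N m → contradiction (unmarked v v<N) m
              ; why = λ v v<N m → contradiction (unmarked v v<N) m } ,
       (λ _ ()) , λ x _ x<N → unmarked x x<N)
      λ {i} i<b x≡i F → root-step (subst (i <_) (N≡ E₁) i<b) x≡i
        (trans (arrs F rootA refl) (arr-frame d₁ rootA refl)))

    Scanned : ℕ → Store → Set
    Scanned h υ = QueueIn υ r Z × (∀ x → x < N → Z x → arr υ markA x ≢ 0) ×
      (∀ i → i < h → i < reg υ tailR → ∀ y → y < N → r (arr υ queueA i) y ≢ 0 → arr υ markA y ≢ 0)

    Row : ℕ → ℕ → ℕ → Store → Set
    Row h u j υ = Scanned h υ × h < reg υ tailR × arr υ queueA h ≡ u × (∀ y → y < j → r u y ≢ 0 → arr υ markA y ≢ 0)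

    entry-step : ∀ {h u j υ ω c} → j < N → reg υ yR ≡ j → reg υ uR ≡ u → Env υ → arr υ residualA ≡ arr σ residualA →
      ⟪ scanEntry ⟫ ⊢ υ ⇓[ c ] ω → Row h u j υ → Row h u (suc j) (setReg ω yR (suc j))
    entry-step {h} {u} {j} {υ} {ω} j<N y≡j u≡ Eυ res≡ d ((q , roots , processed) , h<t , qh , row) = go d
      where
      u-slot : arr υ queueA h < N × arr υ markA (arr υ queueA h) ≡ suc h
      u-slot = Queue.slot q h h<t
      u<N : u < N
      u<N = subst (_< N) qh (proj₁ u-slot)
      u-marked : arr υ markA u ≢ 0
      u-marked z = case trans (sym (trans (cong (arr υ markA) (sym qh)) (proj₂ u-slot))) z of λ ()
      value≡ : arr υ residualA (eval υ (cell uR yR)) ≡ r u j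
      value≡ = cong₂ (λ f m → f m) res≡ (cell≡ Eυ u≡ y≡j u<N)

      go : ∀ {ω c} → ⟪ scanEntry ⟫ ⊢ υ ⇓[ c ] ω → Row h u (suc j) (setReg ω yR (suc j))
      go (⇓else ez ⇓skip) = (q , roots , processed) , h<t , qh ,
        λ y y<1+j e → [ (λ y<j → row y y<j e) , (λ { refl → contradiction (trans (sym value≡) ez) e }) ]′ (<-suc-cases y<1+j)
      go (⇓then ne (⇓then m ⇓skip)) = (q , roots , processed) , h<t , qh ,
        λ y y<1+j e → [ (λ y<j → row y y<j e) , (λ { refl → subst (λ m → arr υ markA m ≢ 0) y≡j m }) ]′ (<-suc-cases y<1+j)
      go {ω} (⇓then ne (⇓else m d)) =
        ( push-correct yR refl y≡j j<N (trans (cong (arr υ markA) (sym y≡j)) m)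
            (inj₂ (subst (_< N) (sym u≡) u<N , subst (λ w → arr υ markA w ≢ 0) (sym u≡) u-marked ,
                   subst (λ w → r w j ≢ 0) (sym u≡) (λ z → ne (trans value≡ z)))) d q
        , (λ x x<N z → keeps x (roots x x<N z))
        , λ i i<h i<t y y<N e → let i<t₀ = <-trans i<h h<t in
            keeps y (processed i i<h i<t₀ y y<N (subst (λ w → r w y ≢ 0) (queue≡ i i<t₀) e)) ) ,
        subst (h <_) (sym tail≡) (m<n⇒m<1+n h<t) ,
        trans (queue≡ h h<t) qh ,
        λ y y<1+j e → [ (λ y<j → keeps y (row y y<j e)) , (λ { refl → hit }) ]′ (<-suc-cases y<1+j)
        where
        facts = push-marks yR refl y≡j d
        hit = proj₁ facts
        keeps = proj₁ (proj₂ (proj₂ facts))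
        tail≡ = proj₁ (proj₂ (proj₂ (proj₂ facts)))
        queue≡ = proj₂ (proj₂ (proj₂ (proj₂ facts)))

    scan-step : ∀ {h υ ω c} → reg υ xR ≡ h → Env υ → arr υ residualA ≡ arr σ residualA →
      ⟪ scan ⟫ ⊢ υ ⇓[ c ] ω → Scanned h υ → Scanned (suc h) (setReg ω xR (suc h))
    scan-step {h} {υ} x≡h Eυ res≡ (⇓else ez ⇓skip) (q , roots , processed) = q , roots ,
      λ i _ i<t → processed i (<-≤-trans i<t (m∸n≡0⇒m≤n (trans (cong (reg υ tailR ∸_) (sym x≡h)) ez))) i<t
    scan-step {h} {υ} {ω} x≡h Eυ res≡ (⇓then ne (⇓seq ⇓reg d)) scanned = finish row-done
      where
      h<t : h < reg υ tailR
      h<t = ≰⇒> λ le → ne (m≤n⇒m∸n≡0 (subst (reg υ tailR ≤_) (sym x≡h) le))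
      u : ℕ
      u = arr υ queueA (reg υ xR)
      E′ : Env (setReg υ uR u)
      E′ = env-keep (assign uR (queueA ⟦ xR ′ ⟧)) refl (frame-of ⇓reg) Eυ
      row-done : Row h u N ω
      row-done = subst (λ m → Row h u m ω) (N≡ Eυ) (for-invariant (Row h u) scanEntry d refl refl refl
        (scanned , h<t , cong (arr υ queueA) (sym x≡h) , λ _ ())
        λ {j} j<b y≡j F → entry-step (subst (j <_) (N≡ Eυ) j<b) y≡j (regs F uR refl)
          (env-keep (forloop yR NR scanEntry) refl F E′) (trans (arrs F residualA refl) res≡))
      finish : Row h u N ω → Scanned (suc h) (setReg ω xR (suc h))
      finish ((q , roots , processed) , _ , qh , row) = q , roots ,
        λ i i<1+h i<t y y<N e → [ (λ i<h → processed i i<h i<t y y<N e)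
                                , (λ { refl → row y y<N (subst (λ w → r w y ≢ 0) qh e) }) ]′ (<-suc-cases i<1+h)

    scanned : Scanned N τ
    scanned = subst (λ m → Scanned m τ) (N≡ E₂) (for-invariant Scanned scan d₃ refl refl refl
      (proj₁ rooted , (λ x x<N → proj₁ (proj₂ rooted) x x<N x<N) , λ _ ())
      λ _ x≡h F → scan-step x≡h (env-keep (forloop xR NR scan) refl F E₂)
        (trans (arrs F residualA refl) (trans (arr-frame d₂ residualA refl) (arr-frame d₁ residualA refl))))

  Sought : Store → Set
  Sought τ =
    (reg τ targetR ≡ 0 × (∀ x → x < N → arr τ targetA x ≢ 0 → arr τ markA x ≡ 0)) ⊎
    Σ[ x ∈ ℕ ] (reg τ targetR ≡ suc x × x < N × arr τ targetA x ≢ 0 × arr τ markA x ≢ 0)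

  seek-correct : ∀ {σ τ u} → Env σ → ⟪ seek ⟫ ⊢ σ ⇓[ u ] τ → Sought τ
  seek-correct {σ} {τ} E (⇓seq ⇓reg d) =
    case subst (λ m → Inv m τ) (N≡ E) (for-invariant Inv seekStep d refl refl refl (inj₁ (refl , λ _ ()))
      λ {i} i<b x≡i _ → each (subst (i <_) (N≡ E) i<b) x≡i) of λ
      { (inj₁ (z , none)) → inj₁ (z , none) ; (inj₂ found) → inj₂ found }
    where
    Inv : ℕ → Store → Set
    Inv i υ =
      (reg υ targetR ≡ 0 × (∀ x → x < i → arr υ targetA x ≢ 0 → arr υ markA x ≡ 0)) ⊎
      Σ[ x ∈ ℕ ] (reg υ targetR ≡ suc x × x < N × arr υ targetA x ≢ 0 × arr υ markA x ≢ 0)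

    each : ∀ {i υ ω u} → i < N → reg υ xR ≡ i → ⟪ seekStep ⟫ ⊢ υ ⇓[ u ] ω → Inv i υ → Inv (suc i) (setReg ω xR (suc i))
    each {i} {υ} i<N x≡i (⇓then ne (⇓then m ⇓reg)) _ =
      inj₂ (i , trans (+-comm _ 1) (cong suc x≡i) , i<N , subst (λ w → arr υ targetA w ≢ 0) x≡i ne , subst (λ w → arr υ markA w ≢ 0) x≡i m)
    each i<N x≡i (⇓then ne (⇓else m ⇓skip)) (inj₂ found) = inj₂ found
    each i<N x≡i (⇓else ez ⇓skip) (inj₂ found) = inj₂ found
    each {υ = υ} i<N x≡i (⇓then ne (⇓else m ⇓skip)) (inj₁ (z , none)) = inj₁ (z , λ x x<1+i e →
      [ (λ x<i → none x x<i e) , (λ { refl → trans (cong (arr υ markA) (sym x≡i)) m }) ]′ (<-suc-cases x<1+i))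
    each {υ = υ} i<N x≡i (⇓else ez ⇓skip) (inj₁ (z , none)) = inj₁ (z , λ x x<1+i e →
      [ (λ x<i → none x x<i e) , (λ { refl → contradiction (trans (cong (arr υ targetA) (sym x≡i)) ez) e }) ]′ (<-suc-cases x<1+i))

  record SearchResult (r : ℕ → ℕ → ℕ) (Z : ℕ → Set) (mark parent : ℕ → ℕ) : Set where
    field
      reached : Reached Z r (on ∘ mark)
      why     : ∀ v → v < N → mark v ≢ 0 →
        Z v ⊎ (parent v < N × mark (parent v) ≢ 0 × mark (parent v) < mark v × r (parent v) v ≢ 0)
      mark≤N  : ∀ x → x < N → mark x ≢ 0 → mark x ≤ N

  search-result : ∀ {r Z τ} → Searched r Z τ → SearchResult r Z (arr τ markA) (arr τ parentA)
  search-result S = record { Searched S }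

  IsTarget : Store → ℕ → Set
  IsTarget σ x = arr σ targetA x ≢ 0

  residual-write : ∀ {σ e m u v} → e ≡ offset u + offset u + v → u < N → v < N →
    residual (setArr σ residualA e m) u v ≡ m ×
    (∀ x y → x < N → y < N → (x ≢ u ⊎ y ≢ v) → residual σ x y ≡ residual (setArr σ residualA e m) x y)
  residual-write {σ} {e} {m} {u} {v} eq u<N v<N = set-hit eq ,
    λ x y x<N y<N ne → sym (set-miss λ e′ →
      case cell-injective u<N v<N x<N y<N (trans (sym eq) e′) of λ { (p , q) → [ (λ a → a (sym p)) , (λ b → b (sym q)) ]′ ne })

  private
    cancel-if : ∀ b {A B m m′} → A + (if b then m else 0) ≡ B + (if b then m′ else 0) → m ≡ suc m′ → A + bit b ≡ B
    cancel-if false eq _ = trans (+-identityʳ _) (trans (sym (+-identityʳ _)) (trans eq (+-identityʳ _)))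
    cancel-if true {A} {B} {m′ = m′} eq refl = +-cancelʳ-≡ m′ _ _ (trans (+-assoc A 1 m′) eq)

  crossing-decrease : ∀ W {r r′ u v} → u < N → v < N → r u v ≢ 0 → r′ u v ≡ r u v ∸ 1 →
    (∀ x y → x < N → y < N → (x ≢ u ⊎ y ≢ v) → r x y ≡ r′ x y) →
    crossing W r′ + bit (crosses W u v) ≡ crossing W r
  crossing-decrease W {r} {r′} {u} {v} u<N v<N pos new old =
    cancel-if (crosses W u v) (crossing-change W u v u<N v<N old) (sym (trans (cong suc new) (suc-pred′ pos)))
    where
    suc-pred′ : ∀ {m} → m ≢ 0 → suc (m ∸ 1) ≡ m
    suc-pred′ {zero}  ne = contradiction refl ne
    suc-pred′ {suc m} _  = refl

  crossing-increase : ∀ W {r r′ u v} → u < N → v < N → r′ u v ≡ suc (r u v) →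
    (∀ x y → x < N → y < N → (x ≢ u ⊎ y ≢ v) → r x y ≡ r′ x y) →
    crossing W r + bit (crosses W u v) ≡ crossing W r′
  crossing-increase W {u = u} {v} u<N v<N new old =
    cancel-if (crosses W u v) (sym (crossing-change W u v u<N v<N old)) new

  -- For a fixed cut, the residual crossing plus `bit (W y)` is constant as y moves from the target
  -- to a root: changing the arc between y and its parent u by one unit in each direction shifts the
  -- crossing by exactly `bit (W y)` - `bit (W u)`. The bit is 0 at the target and 1 at the root.
  augment-correct : ∀ {σ τ c x} → Env σ → SearchResult (residual σ) (IsRoot σ) (arr σ markA) (arr σ parentA) →
    reg σ targetR ≡ suc x → x < N → IsTarget σ x → arr σ markA x ≢ 0 →
    ⟪ augment ⟫ ⊢ σ ⇓[ c ] τ →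
    ∀ W → Valid (IsRoot σ) (IsTarget σ) W → crossing W (residual τ) + 1 ≡ crossing W (residual σ)
  augment-correct {σ} {τ} {x = x} E res tgt≡ x<N Tx mx (⇓seq ⇓reg d) W W-valid = finish last
    where
    open SearchResult res
    mark parent : ℕ → ℕ
    mark = arr σ markA
    parent = arr σ parentA

    -- `stopped` contains the termination measure, as every move lowers the mark. `ahead` says that
    -- the tree arcs still to be traversed have kept positive residual capacity.
    record Walking (i : ℕ) (υ : Store) : Set where
      field
        y       : ℕ
        y≡      : reg υ currentR ≡ y
        y<N     : y < N
        marked  : mark y ≢ 0
        stopped : IsRoot σ y ⊎ mark y + i ≤ N
        ahead   : ∀ w → w < N → mark w ≢ 0 → mark w ≤ mark y → IsRoot σ w ⊎ residual υ (parent w) w ≢ 0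
        balance : crossing W (residual υ) + bit (W y) ≡ crossing W (residual σ)

    E₀ : Env (setReg σ currentR (reg σ targetR ∸ 1))
    E₀ = env-keep (assign currentR (targetR ′ ⊖ lit 1)) refl (frame-of ⇓reg) E

    start : Walking 0 (setReg (setReg σ currentR (reg σ targetR ∸ 1)) xR 0)
    start = record
      { y = x ; y≡ = cong (_∸ 1) tgt≡ ; y<N = x<N ; marked = mx
      ; stopped = inj₂ (subst (_≤ N) (sym (+-identityʳ _)) (mark≤N x x<N mx))
      ; ahead = λ w w<N mw _ → case why w w<N mw of λ { (inj₁ z) → inj₁ z ; (inj₂ (_ , _ , _ , e)) → inj₂ e }
      ; balance = trans (cong (λ b → crossing W (residual σ) + bit b) (avoids W-valid x x<N Tx)) (+-identityʳ _)
      }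

    walk : ∀ {i υ ω c} → Env υ → arr υ rootA ≡ arr σ rootA → arr υ parentA ≡ parent →
      ⟪ augmentStep ⟫ ⊢ υ ⇓[ c ] ω → Walking i υ → Walking (suc i) (setReg ω xR (suc i))
    walk {i} {υ} Eυ root≡ parent≡ (⇓then ne ⇓skip) w = record
      { y = y ; y≡ = y≡ ; y<N = y<N ; marked = marked
      ; stopped = inj₁ (subst₂ (λ f m → f m ≢ 0) root≡ y≡ ne)
      ; ahead = ahead ; balance = balance }
      where open Walking w
    walk {i} {υ} Eυ root≡ parent≡ (⇓else ez (⇓seq ⇓reg (⇓seq ⇓arr (⇓seq ⇓arr ⇓reg)))) w = record
      { y = u ; y≡ = u≡ ; y<N = u<N ; marked = mu
      ; stopped = inj₂ (case stopped of λ
          { (inj₁ z) → contradiction z not-root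
          ; (inj₂ le) → ≤-trans (≤-reflexive (+-suc (mark u) i)) (≤-trans (+-monoˡ-≤ i mu<my) le) })
      ; ahead = ahead′
      ; balance = balance′
      }
      where
      open Walking w
      not-root : ¬ IsRoot σ y
      not-root z = z (trans (sym (cong₂ (λ f m → f m) root≡ y≡)) ez)

      u : ℕ
      u = parent y
      u≡ : arr υ parentA (reg υ currentR) ≡ u
      u≡ = cong₂ (λ f m → f m) parent≡ y≡

      edge : parent y < N × mark (parent y) ≢ 0 × mark (parent y) < mark y
      edge = case why y y<N marked of λ { (inj₁ z) → contradiction z not-root ; (inj₂ (a , b , c , _)) → a , b , c }
      u<N = proj₁ edge
      mu = proj₁ (proj₂ edge)
      mu<my = proj₂ (proj₂ edge)

      ruy : residual υ u y ≢ 0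
      ruy = case ahead y y<N marked ≤-refl of λ { (inj₁ z) → contradiction z not-root ; (inj₂ e) → e }

      υ₀ υ₁ υ₂ : Store
      υ₀ = setReg υ uR (arr υ parentA (reg υ currentR))
      υ₁ = setArr υ₀ residualA (eval υ₀ (cell uR currentR)) (eval υ₀ (residualA ⟦ cell uR currentR ⟧ ⊖ lit 1))
      υ₂ = setArr υ₁ residualA (eval υ₁ (cell currentR uR)) (eval υ₁ (residualA ⟦ cell currentR uR ⟧ ⊕ lit 1))

      Eυ₀ : Env υ₀
      Eυ₀ = env-keep (assign uR (parentA ⟦ currentR ′ ⟧)) refl (frame-of ⇓reg) Eυ
      Eυ₁ : Env υ₁
      Eυ₁ = env-keep (write residualA (cell uR currentR) (residualA ⟦ cell uR currentR ⟧ ⊖ lit 1)) refl (frame-of ⇓arr) Eυ₀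

      addr₀ : eval υ₀ (cell uR currentR) ≡ offset u + offset u + y
      addr₀ = cell≡ {u = uR} {currentR} Eυ₀ u≡ y≡ u<N
      addr₁ : eval υ₁ (cell currentR uR) ≡ offset y + offset y + u
      addr₁ = cell≡ {u = currentR} {uR} Eυ₁ y≡ u≡ y<N

      w₁ = residual-write {υ₀} {m = eval υ₀ (residualA ⟦ cell uR currentR ⟧ ⊖ lit 1)} addr₀ u<N y<N
      w₂ = residual-write {υ₁} {m = eval υ₁ (residualA ⟦ cell currentR uR ⟧ ⊕ lit 1)} addr₁ y<N u<N

      new₁ : residual υ₁ u y ≡ residual υ u y ∸ 1
      new₁ = trans (proj₁ w₁) (cong (λ a → arr υ residualA a ∸ 1) addr₀)
      new₂ : residual υ₂ y u ≡ suc (residual υ₁ y u)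
      new₂ = trans (proj₁ w₂) (trans (+-comm _ 1) (cong (λ a → suc (arr υ₁ residualA a)) addr₁))

      -- The decreased arc enters y, whose mark exceeds that of u, so it is not among the arcs still
      -- ahead. The arc from y to u might be, but it was increased.
      ahead′ : ∀ w → w < N → mark w ≢ 0 → mark w ≤ mark u → IsRoot σ w ⊎ residual υ₂ (parent w) w ≢ 0
      ahead′ w w<N mw mw≤mu with why w w<N mw
      ... | inj₁ z = inj₁ z
      ... | inj₂ (p<N , _) with ahead w w<N mw (≤-trans mw≤mu (<⇒≤ mu<my)) | parent w ≟ y | w ≟ u
      ...   | inj₁ z | _ | _ = inj₁ z
      ...   | inj₂ e | yes pw≡y | yes w≡u = inj₂ λ z → case trans (sym new₂) (trans (sym (cong₂ (residual υ₂) pw≡y w≡u)) z) of λ ()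
      ...   | inj₂ e | no pw≢y | _ = inj₂ λ z → e (trans (proj₂ w₁ _ w p<N w<N (inj₂ w≢y)) (trans (proj₂ w₂ _ w p<N w<N (inj₁ pw≢y)) z))
        where
        w≢y : w ≢ y
        w≢y refl = <⇒≱ mu<my mw≤mu
      ...   | inj₂ e | yes _ | no w≢u = inj₂ λ z → e (trans (proj₂ w₁ _ w p<N w<N (inj₂ w≢y)) (trans (proj₂ w₂ _ w p<N w<N (inj₂ w≢u)) z))
        where
        w≢y : w ≢ y
        w≢y refl = <⇒≱ mu<my mw≤mu

      exchange : ∀ a b c → c + bit (b ∧ not a) + bit a ≡ c + bit (a ∧ not b) + bit b
      exchange true  true  c = refl
      exchange false false c = refl
      exchange true  false c = trans (cong (_+ 1) (+-identityʳ c)) (sym (+-identityʳ (c + 1)))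
      exchange false true  c = trans (+-identityʳ (c + 1)) (cong (_+ 1) (sym (+-identityʳ c)))

      balance′ : crossing W (residual υ₂) + bit (W u) ≡ crossing W (residual σ)
      balance′ = begin
        crossing W (residual υ₂) + bit (W u)
          ≡⟨ cong (_+ bit (W u)) (sym (crossing-increase W y<N u<N new₂ (proj₂ w₂))) ⟩
        crossing W (residual υ₁) + bit (crosses W y u) + bit (W u)
          ≡⟨ exchange (W u) (W y) (crossing W (residual υ₁)) ⟩
        crossing W (residual υ₁) + bit (crosses W u y) + bit (W y)
          ≡⟨ cong (_+ bit (W y)) (crossing-decrease W u<N y<N ruy new₁ (proj₂ w₁)) ⟩
        crossing W (residual υ) + bit (W y)
          ≡⟨ balance ⟩
        crossing W (residual σ) ∎
        where open ≡-Reasoning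

    last : Walking N τ
    last = subst (λ m → Walking m τ) (N≡ E) (for-invariant Walking augmentStep d refl refl refl start
      λ _ _ F → walk (env-keep (forloop xR NR augmentStep) refl F E₀) (arrs F rootA refl) (arrs F parentA refl))

    finish : Walking N τ → crossing W (residual τ) + 1 ≡ crossing W (residual σ)
    finish w = subst (λ b → crossing W (residual τ) + bit b ≡ crossing W (residual σ)) (contains W-valid y y<N root) balance
      where
      open Walking w
      root : IsRoot σ y
      root = case stopped of λ
        { (inj₁ z) → z
        ; (inj₂ le) → contradiction (n≤0⇒n≡0 (+-cancelʳ-≤ N (mark y) 0 le)) marked }

  Flowed : (X : ℕ → Bool) (Z T : ℕ → Set) → Store → Set
  Flowed X Z T τ =
    (reg τ targetR ≢ 0 × (∀ W → Valid Z T W → K < capacity X W)) ⊎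
    (reg τ targetR ≡ 0 × ClosestCut X Z T (on ∘ arr τ markA))

  maxflow-correct : ∀ {σ τ c} X → Env σ → Capacities X (residual σ) → ⟪ maxflow ⟫ ⊢ σ ⇓[ c ] τ →
    Flowed X (IsRoot σ) (IsTarget σ) τ
  maxflow-correct {σ} {τ} X E cap (⇓seq ⇓reg d) = case last of λ
    -- After K + 1 successful rounds the flow has value K + 1, a lower bound for every valid cut.
    { (inj₁ (ne , flow)) → inj₁ (ne , λ W v → subst (K <_) (flow W v) (m≤n+m (suc K) _))
    ; (inj₂ stuck) → inj₂ stuck }
    where
    Z T′ : ℕ → Set
    Z = IsRoot σ
    T′ = IsTarget σ

    Inv : ℕ → Store → Set
    Inv i υ = (reg υ targetR ≢ 0 × Residual X Z T′ (residual υ) i) ⊎ (reg υ targetR ≡ 0 × ClosestCut X Z T′ (on ∘ arr υ markA))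

    E₀ : Env (setReg σ targetR 1)
    E₀ = env-keep (assign targetR (lit 1)) refl (frame-of ⇓reg) E

    each : ∀ {i υ ω c} → i ≤ K → Env υ → arr υ rootA ≡ arr σ rootA → arr υ targetA ≡ arr σ targetA →
      ⟪ flowRound ⟫ ⊢ υ ⇓[ c ] ω → Inv i υ → Inv (suc i) (setReg ω roundR (suc i))
    each i≤K Eυ root≡ target≡ (⇓else ez ⇓skip) (inj₁ (ne , _)) = contradiction ez ne
    each i≤K Eυ root≡ target≡ (⇓else ez ⇓skip) (inj₂ stuck)    = inj₂ stuck
    each i≤K Eυ root≡ target≡ (⇓then ne _) (inj₂ (ez , _))     = contradiction ez ne
    each {i} {υ} i≤K Eυ root≡ target≡ (⇓then ne (⇓seq {τ = υ₁} d₁ (⇓seq {τ = υ₂} d₂ d₃))) (inj₁ (_ , flow)) = go d₃ sought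
      where
      E₁ : Env υ₁
      E₁ = env-keep search refl (frame-of d₁) Eυ
      E₂ : Env υ₂
      E₂ = env-keep seek refl (frame-of d₂) E₁
      sought : Sought υ₂
      sought = seek-correct E₁ d₂
      root₂ : arr υ₂ rootA ≡ arr σ rootA
      root₂ = trans (arr-frame d₂ rootA refl) (trans (arr-frame d₁ rootA refl) root≡)
      target₂ : arr υ₂ targetA ≡ arr σ targetA
      target₂ = trans (arr-frame d₂ targetA refl) (trans (arr-frame d₁ targetA refl) target≡)
      residual₂ : arr υ₂ residualA ≡ arr υ residualA
      residual₂ = trans (arr-frame d₂ residualA refl) (arr-frame d₁ residualA refl)

      result : SearchResult (residual υ) (IsRoot υ) (arr υ₂ markA) (arr υ₂ parentA)
      result = subst₂ (SearchResult (residual υ) (IsRoot υ)) (sym (arr-frame d₂ markA refl)) (sym (arr-frame d₂ parentA refl))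
        (search-result (search-correct Eυ d₁))

      result₂ : SearchResult (residual υ₂) (IsRoot υ₂) (arr υ₂ markA) (arr υ₂ parentA)
      result₂ = subst₂ (λ f g → SearchResult (λ x y → f (offset x + offset x + y)) (λ x → g x ≢ 0) (arr υ₂ markA) (arr υ₂ parentA))
        (sym residual₂) (trans root≡ (sym root₂)) result

      go : ∀ {ω c} → ⟪ branch (targetR ′) augment nop ⟫ ⊢ υ₂ ⇓[ c ] ω → Sought υ₂ → Inv (suc i) (setReg ω roundR (suc i))
      go (⇓then ne′ _) (inj₁ (z , _)) = contradiction z ne′
      go (⇓else ez ⇓skip) (inj₁ (z , none)) = inj₂ (z , reached-closest flow i≤K
        (subst (λ f → Reached (λ x → f x ≢ 0) (residual υ) (on ∘ arr υ₂ markA)) root≡ (SearchResult.reached result))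
        λ x x<N Tx → on-false (none x x<N (subst (λ f → f x ≢ 0) (sym target₂) Tx)))
      go (⇓else ez ⇓skip) (inj₂ (_ , eq , _)) = case trans (sym ez) eq of λ ()
      go {ω} (⇓then ne′ d) (inj₂ (x , eq , x<N , Tx , mx)) = inj₁ (subst (_≢ 0) (sym (reg-frame d targetR refl)) ne′ , λ W v →
        trans (+-suc (crossing W (residual ω)) i) (trans (cong (_+ i) (trans (+-comm 1 _) (trans
          (augment-correct E₂ result₂ eq x<N Tx mx d W (valid
            (λ x x<N z → contains v x x<N (subst (λ f → f x ≢ 0) root₂ z))
            (λ x x<N z → avoids v x x<N (subst (λ f → f x ≢ 0) target₂ z))))
          (cong (λ f → crossing W (λ x y → f (offset x + offset x + y))) residual₂)))) (flow W v)))

    last : Inv (suc K) τ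
    last = subst (λ m → Inv m τ) (rounds≡ E₀) (for-invariant Inv flowRound d refl refl refl
      (inj₁ ((λ ()) , λ W v → trans (+-identityʳ _) (crossing-capacities W cap)))
      λ {i} i<b _ F → each (s≤s⁻¹ (subst (i <_) (rounds≡ E₀) i<b)) (env-keep (forloop roundR roundsR flowRound) refl F E₀)
        (arrs F rootA refl) (arrs F targetA refl))

  -- Stages of the program as steps of the abstract search

  Picked : Store → ℕ → (ℕ → Bool) → Set
  Picked τ i bd =
    (reg τ pickR ≡ 0 × (∀ v → v < i → bd v ≡ false)) ⊎
    Σ[ v ∈ ℕ ] (reg τ pickR ≡ suc v × v < i × bd v ≡ true × (∀ w → w < i → v < w → bd w ≡ false))

  pick-correct : ∀ {σ τ c} → Env σ → ⟪ pick ⟫ ⊢ σ ⇓[ c ] τ →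
    Picked τ n (boundary (on ∘ arr σ deletedA) (on ∘ arr σ markA))
  pick-correct {σ} {τ} E (⇓seq ⇓reg d) = subst (λ m → Picked τ m bd) (n≡ E)
    (for-invariant (λ i υ → Picked υ i bd) pickStep d refl refl refl (inj₁ (refl , λ _ ()))
      λ {i} i<b x≡i F → each x≡i (trans (regs F nR refl) (n≡ E)) (arrs F markA refl) (arrs F deletedA refl))
    where
    bd : ℕ → Bool
    bd = boundary (on ∘ arr σ deletedA) (on ∘ arr σ markA)

    extend : ∀ {i υ} → bd i ≡ false → Picked υ i bd → Picked υ (suc i) bd
    extend no-i (inj₁ (z , none)) = inj₁ (z , λ v v<1+i → [ none v , (λ { refl → no-i }) ]′ (<-suc-cases v<1+i))
    extend no-i (inj₂ (v , eq , v<i , yes-v , above)) =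
      inj₂ (v , eq , m<n⇒m<1+n v<i , yes-v , λ w w<1+i v<w → [ (λ w<i → above w w<i v<w) , (λ { refl → no-i }) ]′ (<-suc-cases w<1+i))

    each : ∀ {i υ ω c} → reg υ xR ≡ i → reg υ nR ≡ n → arr υ markA ≡ arr σ markA → arr υ deletedA ≡ arr σ deletedA →
      ⟪ pickStep ⟫ ⊢ υ ⇓[ c ] ω → Picked υ i bd → Picked (setReg ω xR (suc i)) (suc i) bd
    each {i} {υ} refl n≡′ mark≡ del≡ (⇓then ne (⇓else ez ⇓reg)) _ =
      inj₂ (i , +-comm _ 1 , ≤-refl , yes-i , λ w w<1+i i<w → contradiction i<w (≤⇒≯ (s≤s⁻¹ w<1+i)))
      where
      yes-i : bd i ≡ true
      yes-i = ∧-join (on-true (subst (λ f → f i ≢ 0) mark≡ ne)) (∧-join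
        (not-false (on-false (subst₂ (λ f m → f (m + i) ≡ 0) mark≡ n≡′ (m+n≡0⇒m≡0 (arr υ markA (reg υ nR + i)) ez))))
        (not-false (on-false (subst (λ f → f i ≡ 0) del≡ (m+n≡0⇒n≡0 (arr υ markA (reg υ nR + i)) ez)))))
    each {i} {υ} refl n≡′ mark≡ del≡ (⇓then ne (⇓then ne′ ⇓skip)) = extend {υ = υ} (≢true⇒false λ e →
      let _ , e₁ = ∧-split (on (arr σ markA i)) e
          a , b = ∧-split (not (on (arr σ markA (n + i)))) e₁ in
      ne′ (cong₂ _+_ (subst₂ (λ f m → f (m + i) ≡ 0) (sym mark≡) (sym n≡′) (on-≡0 (not-true a)))
                     (subst (λ f → f i ≡ 0) (sym del≡) (on-≡0 (not-true b)))))
    each {i} {υ} refl n≡′ mark≡ del≡ (⇓else ez ⇓skip) = extend {υ = υ} (≢true⇒false λ e →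
      on-≢0 (proj₁ (∧-split (on (arr σ markA i)) e)) (subst (λ f → f i ≡ 0) mark≡ ez))

  abs-cong : ∀ σ τ → arr τ deletedA ≡ arr σ deletedA → arr τ adoptedA ≡ arr σ adoptedA →
    reg τ rankR ≡ reg σ rankR → reg τ countR ≡ reg σ countR → abstraction τ ≡ abstraction σ
  abs-cong σ τ d a r c = trans
    (cong₂ (λ f g → state (characteristic n (on ∘ f)) (characteristic N (on ∘ g)) (reg τ rankR) (reg τ countR)) d a)
    (cong₂ (state _ _) r c)

  decide-correct : ∀ {σ τ c i} → Env σ → reg σ stageR ≡ i → i < 3 * ℓ → rank (abstraction σ) < ℓ →
    Flowed (X? (abstraction σ)) (Root (reg σ rankR)) (Target (abstraction σ)) σ →
    ⟪ decide ⟫ ⊢ σ ⇓[ c ] τ → Step (β i) (abstraction σ) (abstraction τ)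
  decide-correct E _ _ r (inj₁ (ne , bad)) (⇓then _ ⇓skip) = failed , (r , bad) , refl
  decide-correct E _ _ r (inj₁ (ne , bad)) (⇓else ez _) = contradiction ez ne
  decide-correct E _ _ r (inj₂ (ez , _)) (⇓then ne _) = contradiction ez ne
  decide-correct {σ} {τ} {i = i} E refl i<3ℓ r (inj₂ (_ , cc)) (⇓else _ (⇓seq {τ = υ} d e)) =
    case pick-correct E d of λ
      { (inj₁ (z , none)) → none-picked z none e
      ; (inj₂ (v , eq , v<n , yes-v , above)) → picked v eq v<n yes-v above e }
    where
    s₀ : State
    s₀ = abstraction σ
    Q : ℕ → Bool
    Q = on ∘ arr σ markA
    abs≡ : abstraction υ ≡ s₀
    abs≡ = abs-cong σ υ (arr-frame d deletedA refl) (arr-frame d adoptedA refl) (reg-frame d rankR refl) (reg-frame d countR refl)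
    Eυ : Env υ
    Eυ = env-keep pick refl (frame-of d) E

    boundary≡ : ∀ v → v < n → boundary (X? s₀) Q v ≡ boundary (on ∘ arr σ deletedA) Q v
    boundary≡ v v<n = cong (λ b → Q v ∧ (not (Q (n + v)) ∧ not b)) (deleted-abs σ v v<n)

    none-picked : ∀ {τ c} → reg υ pickR ≡ 0 → (∀ v → v < n → boundary (on ∘ arr σ deletedA) Q v ≡ false) →
      _ ⊢ υ ⇓[ c ] τ → Step (β i) s₀ (abstraction τ)
    none-picked z none (⇓then ne _) = contradiction z ne
    none-picked z none (⇓else _ (⇓seq {τ = ω} d′ ⇓reg)) =
      advance , (r , Q , cc , λ v v<n → trans (boundary≡ v v<n) (none v v<n)) ,
      trans (cong₂ (λ a b → state a b (reg ω rankR + 1) (reg ω countR))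
              (cong (λ f → characteristic n (on ∘ f)) (arr-frame d′ deletedA refl))
              (characteristic-cong N λ x x<N → on-false (clear-correct d′ refl x (subst (x <_) (sym (N≡ Eυ)) x<N))))
        (trans (cong₂ (state (deleted (abstraction υ)) (characteristic N (λ _ → false)))
                  (trans (+-comm _ 1) (cong suc (reg-frame d′ rankR refl))) (reg-frame d′ countR refl))
          (cong (next (β i) advance) abs≡))

    guess≡ : arr υ guessA (reg υ ℓR + reg υ ℓR + reg υ stageR) ≡ arr υ guessA (ℓ + ℓ + i)
    guess≡ = cong₂ (λ l m → arr υ guessA (l + l + m)) (ℓ≡ Eυ) (reg-frame d stageR refl)

    picked : ∀ {τ c} v → reg υ pickR ≡ suc v → v < n → boundary (on ∘ arr σ deletedA) Q v ≡ true →
      (∀ w → w < n → v < w → boundary (on ∘ arr σ deletedA) Q w ≡ false) →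
      _ ⊢ υ ⇓[ c ] τ → Step (β i) s₀ (abstraction τ)
    picked {τ} v eq v<n yes-v above e = select v ,
      (r , Q , cc , v<n , trans (boundary≡ v v<n) yes-v , λ w w<n v<w → trans (boundary≡ w w<n) (above w w<n v<w)) ,
      trans (go e) (cong (next (β i) (select v)) abs≡)
      where
      v≡ : reg υ pickR ∸ 1 ≡ v
      v≡ = cong (_∸ 1) eq

      inserted : ∀ (f : ℕ → ℕ) w → on (if reg υ pickR ∸ 1 ≡ᵇ w then 1 else f w) ≡ insert v (on ∘ f) w
      inserted f w rewrite v≡ with v ≡ᵇ w
      ... | true  = refl
      ... | false = refl

      go : ∀ {τ c} → _ ⊢ υ ⇓[ c ] τ → abstraction τ ≡ next (β i) (select v) (abstraction υ)
      go (⇓else z _) = case trans (sym eq) z of λ ()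
      go (⇓then _ (⇓else g ⇓arr)) rewrite bit-no Eυ i i<3ℓ (trans (sym guess≡) g) =
        cong (λ a → state (deleted (abstraction υ)) a (reg υ rankR) (reg υ countR))
          (characteristic-cong N λ x x<N → trans (inserted (arr υ adoptedA) x) (cong ((v ≡ᵇ x) ∨_) (sym (adopted-abs υ x x<N))))
      go (⇓then _ (⇓then g (⇓else f ⇓skip))) rewrite bit-yes Eυ i i<3ℓ (λ z → g (trans guess≡ z))
        | ≢true⇒false (λ t → <⇒≱ (<ᵇ-sound {reg υ countR} {K} t) (subst (_≤ reg υ countR) (K≡ Eυ) (m∸n≡0⇒m≤n f))) = refl
      go (⇓then _ (⇓then g (⇓then f (⇓seq ⇓arr ⇓reg)))) rewrite bit-yes Eυ i i<3ℓ (λ z → g (trans guess≡ z))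
        | <ᵇ-complete {reg υ countR} {K} (≰⇒> λ le → f (m≤n⇒m∸n≡0 (subst (_≤ reg υ countR) (sym (K≡ Eυ)) le))) =
        cong₂ (λ a m → state a (adopted (abstraction υ)) (reg υ rankR) m)
          (characteristic-cong n λ w w<n → trans (inserted (arr υ deletedA) w) (cong ((v ≡ᵇ w) ∨_) (sym (deleted-abs υ w w<n))))
          (+-comm _ 1)

  closest-transport : ∀ {X Z Z′ T T′ Q} →
    (∀ x → x < N → Z x → Z′ x) → (∀ x → x < N → Z′ x → Z x) →
    (∀ x → x < N → T x → T′ x) → (∀ x → x < N → T′ x → T x) →
    ClosestCut X Z T Q → ClosestCut X Z′ T′ Q
  closest-transport {Z = Z} {Z′} {T} {T′} Z⇒ Z⇐ T⇒ T⇐ cc = record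
    { isCut   = valid (λ x x<N → contains isCut x x<N ∘ Z⇐ x x<N) (λ x x<N → avoids isCut x x<N ∘ T⇐ x x<N)
    ; small   = small
    ; least   = λ W v → least W (back W v)
    ; closest = λ W v → closest W (back W v)
    ; uncross = λ W v → uncross W (back W v)
    }
    where
    open ClosestCut cc
    back : ∀ W → Valid Z′ T′ W → Valid Z T W
    back W v = valid (λ x x<N → contains v x x<N ∘ Z⇒ x x<N) (λ x x<N → avoids v x x<N ∘ T⇒ x x<N)

  stage-correct : ∀ {σ τ c i} → Env σ → reg σ stageR ≡ i → i < 3 * ℓ →
    ⟪ stage ⟫ ⊢ σ ⇓[ c ] τ → Step (β i) (abstraction σ) (abstraction τ)
  stage-correct {σ} E st i<3ℓ (⇓else ez ⇓skip) = halted , subst (_≤ reg σ rankR) (ℓ≡ E) (m∸n≡0⇒m≤n ez) , refl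
  stage-correct {σ} {τ} {i = i} E st i<3ℓ (⇓then ne (⇓seq {τ = σ₁} d₁ (⇓seq {τ = σ₂} d₂ (⇓seq {τ = σ₃} d₃ d₄)))) =
    subst (λ s′ → Step (β i) s′ (abstraction τ)) abs₃ (decide-correct E₃
      (trans (reg-frame d₃ stageR refl) (trans (reg-frame d₂ stageR refl) (trans (reg-frame d₁ stageR refl) st))) i<3ℓ
      (subst (_< ℓ) (sym rank₃) (subst (reg σ rankR <_) (ℓ≡ E) (≰⇒> (ne ∘ m≤n⇒m∸n≡0))))
      (subst₂ (λ s′ m → Flowed (X? s′) (Root m) (Target s′) σ₃) (sym abs₃) (sym rank₃) flowed) d₄)
    where
    E₁ = env-keep prepare refl (frame-of d₁) E
    E₂ = env-keep build refl (frame-of d₂) E₁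
    E₃ = env-keep maxflow refl (frame-of d₃) E₂

    rank₃ : reg σ₃ rankR ≡ reg σ rankR
    rank₃ = trans (reg-frame d₃ rankR refl) (trans (reg-frame d₂ rankR refl) (reg-frame d₁ rankR refl))

    abs₁ : abstraction σ₁ ≡ abstraction σ
    abs₁ = abs-cong σ σ₁ (arr-frame d₁ deletedA refl) (arr-frame d₁ adoptedA refl) (reg-frame d₁ rankR refl) (reg-frame d₁ countR refl)

    abs₃ : abstraction σ₃ ≡ abstraction σ
    abs₃ = trans (abs-cong σ₂ σ₃ (arr-frame d₃ deletedA refl) (arr-frame d₃ adoptedA refl) (reg-frame d₃ rankR refl) (reg-frame d₃ countR refl))
      (trans (abs-cong σ₁ σ₂ (arr-frame d₂ deletedA refl) (arr-frame d₂ adoptedA refl) (reg-frame d₂ rankR refl) (reg-frame d₂ countR refl)) abs₁)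

    terminals : Terminals σ σ₂
    terminals = record
      { root-sound   = λ x x<N → root-sound x x<N ∘ subst (λ f → f x ≢ 0) root≡
      ; root-all     = λ x x<N → subst (λ f → f x ≢ 0) (sym root≡) ∘ root-all x x<N
      ; target-sound = λ x x<N → target-sound x x<N ∘ subst (λ f → f x ≢ 0) target≡
      ; target-all   = λ x x<N → subst (λ f → f x ≢ 0) (sym target≡) ∘ target-all x x<N
      }
      where
      open Terminals (prepare-correct E d₁)
      root≡ : arr σ₂ rootA ≡ arr σ₁ rootA
      root≡ = arr-frame d₂ rootA refl
      target≡ : arr σ₂ targetA ≡ arr σ₁ targetA
      target≡ = arr-frame d₂ targetA refl

    flowed : Flowed (X? (abstraction σ)) (Root (reg σ rankR)) (Target (abstraction σ)) σ₃
    flowed = case maxflow-correct _ E₂ (subst (λ s′ → Capacities (X? s′) (residual σ₂)) abs₁ (build-correct E₁ d₂)) d₃ of λ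
      { (inj₁ (ne , bad)) → inj₁ (ne , λ W v → bad W (valid (λ x x<N → contains v x x<N ∘ root-sound x x<N)
          (λ x x<N → avoids v x x<N ∘ target-sound x x<N)))
      ; (inj₂ (ez , cc)) → inj₂ (ez , closest-transport root-sound root-all target-sound target-all cc) }
      where open Terminals terminals

  run-correct : ∀ {σ τ c} → Env σ → ⟪ run ⟫ ⊢ σ ⇓[ c ] τ → Steps β 0 (3 * ℓ) initial (abstraction τ)
  run-correct {σ} {τ} E (⇓seq {τ = σ₁} d₁ (⇓seq {τ = σ₂} d₂ (⇓seq ⇓reg (⇓seq ⇓reg d)))) =
    subst (λ m → Steps β 0 m initial (abstraction τ)) (+-identityʳ _) (last 0 (abstraction τ) done)
    where
    -- `Steps` grows at its front whereas a loop appends at the end, so the invariant quantifies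
    -- over all continuations.
    Inv : ℕ → Store → Set
    Inv i υ = ∀ f s′ → Steps β i f (abstraction υ) s′ → Steps β 0 (i + f) initial s′

    E₁ = env-keep (clear deletedA nR) refl (frame-of d₁) E
    E₂ = env-keep (clear adoptedA NR) refl (frame-of d₂) E₁

    σ₃ : Store
    σ₃ = setReg (setReg σ₂ countR 0) rankR 0
    E₃ : Env σ₃
    E₃ = env-keep (assign countR (lit 0) ⨟ assign rankR (lit 0)) refl (frame-of (⇓seq ⇓reg ⇓reg)) E₂

    start : abstraction σ₃ ≡ initial
    start = cong₂ (λ a b → state a b 0 0)
      (characteristic-cong n λ v v<n → on-false (trans (cong (λ f → f v) (arr-frame d₂ deletedA refl))
          (clear-correct d₁ refl v (subst (v <_) (sym (n≡ E)) v<n))))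
      (characteristic-cong N λ x x<N → on-false (clear-correct d₂ refl x (subst (x <_) (sym (N≡ E₁)) x<N)))

    last : Inv (3 * ℓ) τ
    last = subst (λ m → Inv m τ) (stages≡ E₃) (for-invariant Inv stage d refl refl refl
      (λ f s′ → subst (λ s → Steps β 0 f s s′) start)
      λ {i} i<b st F e inv f s′ ss → subst (λ m → Steps β 0 m initial s′) (+-suc i f)
        (inv (suc f) s′ (stage-correct (env-keep (forloop stageR stagesR stage) refl F E₃) st (subst (i <_) (stages≡ E₃) i<b) e ◅ ss)))

-- Enumeration of the advice

module Enumeration
  (n K ℓ : ℕ) (adj : ℕ → ℕ → Bool) (s t offset : ℕ → ℕ)
  (cell-injective : ∀ {x y x′ y′} → x < n + n → y < n + n → x′ < n + n → y′ < n + n →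
    offset x + offset x + y ≡ offset x′ + offset x′ + y′ → x ≡ x′ × y ≡ y′)
  (s< : ∀ i → i < ℓ → s i < n) (t< : ∀ i → i < ℓ → t i < n)
  where

  base : ℕ → ℕ
  base i = if i <ᵇ ℓ then ℓ else 2

  digitCount : ℕ
  digitCount = 5 * ℓ

  Ready : Store → Set
  Ready = Static n K ℓ adj s t offset

  base-value : ∀ i → (i < ℓ × base i ≡ ℓ) ⊎ (ℓ ≤ i × base i ≡ 2)
  base-value i with i <ᵇ ℓ in eq
  ... | true  = inj₁ (<ᵇ-sound eq , refl)
  ... | false = inj₂ (≮⇒≥ (λ lt → subst T eq (<⇒<ᵇ lt)) , refl)

  -- The odometer invariant: the lowest i digits have been incremented, with the carry standing for
  -- the overflow into place i.
  record Carrying (g : ℕ → ℕ) (i : ℕ) (υ : Store) : Set where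
    field
      carry   : reg υ carryR ≡ 0 ⊎ reg υ carryR ≡ 1
      balance : value base i (arr υ guessA) + reg υ carryR * place base i ≡ suc (value base i g)
      same    : ∀ j → i ≤ j → arr υ guessA j ≡ g j
      digits  : Digits base i (arr υ guessA)

  carry-step : ∀ {g i υ ω c} → reg υ ℓR ≡ ℓ → reg υ xR ≡ i → g i < base i →
    ⟪ carryStep ⟫ ⊢ υ ⇓[ c ] ω → Carrying g i υ → Carrying g (suc i) (setReg ω xR (suc i))
  carry-step {g} {i} {υ} ℓ≡ refl g<b (⇓else ez ⇓skip) C = record
    { carry   = carry
    ; balance = trans (cong (value base i (arr υ guessA) + arr υ guessA i * place base i +_) (cong (_* (base i * place base i)) ez))
        (trans (+-identityʳ _) (trans (cong₂ (λ a b → a + b * place base i) no-carry (same i ≤-refl)) refl))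
    ; same    = λ j i<j → same j (<⇒≤ i<j)
    ; digits  = λ j j<1+i → [ digits j , (λ { refl → subst (_< base i) (sym (same i ≤-refl)) g<b }) ]′ (<-suc-cases j<1+i)
    }
    where
    open Carrying C
    no-carry : value base i (arr υ guessA) ≡ suc (value base i g)
    no-carry = trans (sym (+-identityʳ _)) (trans (cong (λ m → value base i (arr υ guessA) + m * place base i) (sym ez)) balance)
  carry-step {g} {i} {υ} {ω} ℓ≡ refl g<b (⇓then ne (⇓seq ⇓reg (⇓seq {τ = υ′} d₁ d₂))) C = go d₂
    where
    open Carrying C
    open ≡-Reasoning
    G : ℕ → ℕ
    G = arr υ guessA
    one : reg υ carryR ≡ 1
    one = [ (λ z → contradiction z ne) , id ]′ carry
    carried : value base i G + place base i ≡ suc (value base i g)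
    carried = trans (cong (value base i G +_) (trans (sym (+-identityʳ _)) (cong (_* place base i) (sym one)))) balance

    based : ∀ {ω c} → ⟪ branch (ℓR ′ ⊖ xR ′) (assign baseR (ℓR ′)) nop ⟫ ⊢ setReg υ baseR 2 ⇓[ c ] ω → reg ω baseR ≡ base i
    based (⇓then lt ⇓reg) = [ (λ (_ , b) → trans ℓ≡ (sym b)) , (λ (le , _) → contradiction
        (m≤n⇒m∸n≡0 (subst (_≤ i) (sym ℓ≡) le)) lt) ]′ (base-value i)
    based (⇓else ez ⇓skip) = [ (λ (i<ℓ , _) → contradiction (subst (_≤ i) ℓ≡ (m∸n≡0⇒m≤n ez)) (<⇒≱ i<ℓ)) , (λ (_ , b) → sym b) ]′ (base-value i)

    guess≡ : arr υ′ guessA ≡ G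
    guess≡ = arr-frame d₁ guessA refl
    x≡ : reg υ′ xR ≡ i
    x≡ = reg-frame d₁ xR refl
    digit : arr υ′ guessA (reg υ′ xR) ≡ g i
    digit = trans (cong₂ (λ f m → f m) guess≡ x≡) (same i ≤-refl)

    lower-value : ∀ m → value base i (update (arr υ′ guessA) (reg υ′ xR) m) ≡ value base i G
    lower-value m = value-cong base i λ j j<i → trans (update-other (arr υ′ guessA) λ e → <-irrefl (trans (sym e) x≡) j<i) (cong (λ f → f j) guess≡)

    top : ∀ m → update (arr υ′ guessA) (reg υ′ xR) m i ≡ m
    top m = trans (cong (λ j → update (arr υ′ guessA) j m i) x≡) (update-same (arr υ′ guessA) i)

    keep : ∀ m j → i ≢ j → update (arr υ′ guessA) (reg υ′ xR) m j ≡ G j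
    keep m j i≢j = trans (update-other (arr υ′ guessA) λ e → i≢j (trans (sym x≡) e)) (cong (λ f → f j) guess≡)

    new-digits : ∀ m → m < base i → Digits base (suc i) (update (arr υ′ guessA) (reg υ′ xR) m)
    new-digits m m<b j j<1+i = [ (λ j<i → subst (_< base j) (sym (keep m j (<⇒≢ j<i ∘ sym))) (digits j j<i))
                               , (λ { refl → subst (_< base i) (sym (top m)) m<b }) ]′ (<-suc-cases j<1+i)

    go : ∀ {ω c} → ⟪ branch (baseR ′ ⊖ (guessA ⟦ xR ′ ⟧ ⊕ lit 1))
       (write guessA (xR ′) (guessA ⟦ xR ′ ⟧ ⊕ lit 1) ⨟ assign carryR (lit 0))
       (write guessA (xR ′) (lit 0)) ⟫ ⊢ υ′ ⇓[ c ] ω → Carrying g (suc i) (setReg ω xR (suc i))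
    go (⇓then lt (⇓seq ⇓arr ⇓reg)) = record
      { carry   = inj₁ refl
      ; balance = begin
          value base i (update (arr υ′ guessA) (reg υ′ xR) d′) + update (arr υ′ guessA) (reg υ′ xR) d′ i * place base i + 0
            ≡⟨ +-identityʳ _ ⟩
          value base i (update (arr υ′ guessA) (reg υ′ xR) d′) + update (arr υ′ guessA) (reg υ′ xR) d′ i * place base i
            ≡⟨ cong₂ (λ a b → a + b * place base i) (lower-value d′) (trans (top d′) d′≡) ⟩
          value base i G + (place base i + g i * place base i)
            ≡⟨ sym (+-assoc (value base i G) _ _) ⟩
          value base i G + place base i + g i * place base i
            ≡⟨ cong (_+ g i * place base i) carried ⟩
          suc (value base i g + g i * place base i) ∎
      ; same    = λ j i<j → trans (keep d′ j (<⇒≢ i<j)) (same j (<⇒≤ i<j))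
      ; digits  = new-digits d′ (subst (_< base i) (sym d′≡) (≰⇒> λ le → lt (m≤n⇒m∸n≡0 (subst₂ _≤_ (sym (based d₁)) (sym d′≡) le))))
      }
      where
      d′ : ℕ
      d′ = arr υ′ guessA (reg υ′ xR) + 1
      d′≡ : d′ ≡ suc (g i)
      d′≡ = trans (+-comm _ 1) (cong suc digit)
    go (⇓else ge ⇓arr) = record
      { carry   = inj₂ (trans (reg-frame d₁ carryR refl) one)
      ; balance = begin
          value base i (update (arr υ′ guessA) (reg υ′ xR) 0) + update (arr υ′ guessA) (reg υ′ xR) 0 i *
              place base i + reg υ′ carryR * (base i * place base i)
            ≡⟨ cong₂ (λ a b → a + b * place base i + reg υ′ carryR * (base i * place base i)) (lower-value 0) (top 0) ⟩
          value base i G + 0 + reg υ′ carryR * (base i * place base i)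
            ≡⟨ cong₂ (λ a b → a + b) (+-identityʳ _)
                (trans (cong (_* (base i * place base i)) (trans (reg-frame d₁ carryR refl) one))
                (+-identityʳ _)) ⟩
          value base i G + base i * place base i
            ≡⟨ cong (λ b → value base i G + b * place base i) base≡ ⟩
          value base i G + (place base i + g i * place base i)
            ≡⟨ sym (+-assoc (value base i G) _ _) ⟩
          value base i G + place base i + g i * place base i
            ≡⟨ cong (_+ g i * place base i) carried ⟩
          suc (value base i g + g i * place base i) ∎
      ; same    = λ j i<j → trans (keep 0 j (<⇒≢ i<j)) (same j (<⇒≤ i<j))
      ; digits  = new-digits 0 (≤-<-trans z≤n g<b)
      }
      where
      base≡ : base i ≡ suc (g i)
      base≡ = ≤-antisym (subst₂ _≤_ (based d₁) (trans (+-comm _ 1) (cong suc digit)) (m∸n≡0⇒m≤n ge)) g<b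

  increment-correct : ∀ {σ τ c} → Ready σ → Digits base digitCount (arr σ guessA) → ⟪ increment ⟫ ⊢ σ ⇓[ c ] τ →
    Digits base digitCount (arr τ guessA) ×
    ((reg τ goR ≡ reg σ goR × value base digitCount (arr τ guessA) ≡ suc (value base digitCount (arr σ guessA))) ⊎
     (reg τ goR ≡ 0 × place base digitCount ≤ suc (value base digitCount (arr σ guessA))))
  increment-correct {σ} {τ} S digs (⇓seq ⇓reg (⇓seq {τ = υ} d e)) = go e
    where
    open Static S
    carried : Carrying (arr σ guessA) digitCount υ
    carried = subst (λ m → Carrying (arr σ guessA) m υ) digits≡
      (for-invariant (Carrying (arr σ guessA)) carryStep d refl refl refl
        (record { carry = inj₂ refl ; balance = refl ; same = λ _ _ → refl ; digits = λ _ () })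
        λ {i} i<b x≡i F → carry-step (trans (regs F ℓR refl) ℓ≡) x≡i (digs i (subst (i <_) digits≡ i<b)))
    open Carrying carried
    go : ∀ {τ c} → ⟪ branch (carryR ′) (assign goR (lit 0)) nop ⟫ ⊢ υ ⇓[ c ] τ →
      Digits base digitCount (arr τ guessA) ×
      ((reg τ goR ≡ reg σ goR × value base digitCount (arr τ guessA) ≡ suc (value base digitCount (arr σ guessA))) ⊎
       (reg τ goR ≡ 0 × place base digitCount ≤ suc (value base digitCount (arr σ guessA))))
    go (⇓else ez ⇓skip) = digits , inj₁ (reg-frame d goR refl ,
      trans (sym (+-identityʳ _)) (trans (cong (λ m → value base digitCount (arr υ guessA) + m * place base digitCount) (sym ez)) balance))
    go (⇓then ne ⇓reg) = digits , inj₂ (refl , (begin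
      place base digitCount                                                ≡⟨ sym (+-identityʳ _) ⟩
      1 * place base digitCount
        ≡⟨ cong (_* place base digitCount) (sym ([ (λ z → contradiction z ne) , id ]′ carry)) ⟩
      reg υ carryR * place base digitCount                                 ≤⟨ m≤n+m _ _ ⟩
      value base digitCount (arr υ guessA) + reg υ carryR * place base digitCount   ≡⟨ balance ⟩
      suc (value base digitCount (arr σ guessA))                           ∎))
      where open ≤-Reasoning

  open Network n K adj using (Closed; isClosed; no-boundary; no-leak; closed-mono; size; boundary; leak) public

  Severed : (ℕ → Bool) → ℕ → ℕ → Set
  Severed X a b = Σ[ W ∈ (ℕ → Bool) ] (Closed X W × W a ≡ true × W (n + b) ≡ false)

  Solved : (ℕ → Bool) → Set
  Solved X = size X ≤ K × (∀ i → i < ℓ → Severed X (s i) (t i) ⊎ Severed X (t i) (s i))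

  -- Quantified over every reading that the advice is compatible with, so that the completeness
  -- argument can use its own ranks, directions and bits.
  Fails : (ℕ → ℕ) → Set
  Fails g = ∀ rk source sink β → (∀ i → i < ℓ → source i < n) → (∀ i → i < ℓ → sink i < n) →
    Guided ℓ s t g rk source sink β →
    Σ[ s′ ∈ State ] (Search.Steps n K ℓ adj rk source sink β 0 (3 * ℓ) (Search.initial n K ℓ adj rk source sink) s′ × rank s′ < ℓ)

  run-steps : ∀ {σ τ c rk source sink β} → Ready σ → (∀ i → i < ℓ → source i < n) → (∀ i → i < ℓ → sink i < n) →
    Guided ℓ s t (arr σ guessA) rk source sink β → ⟪ run ⟫ ⊢ σ ⇓[ c ] τ →
    Search.Steps n K ℓ adj rk source sink β 0 (3 * ℓ) (Search.initial n K ℓ adj rk source sink)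
      (state (characteristic n (on ∘ arr τ deletedA)) (characteristic (n + n) (on ∘ arr τ adoptedA)) (reg τ rankR) (reg τ countR))
  run-steps {rk = rk} {source} {sink} {β} S source< sink< guided d =
    Machine.run-correct n K ℓ adj s t offset cell-injective rk source sink source< sink< β
      (record { static = S ; guided = guided }) d

  run-fails : ∀ {σ τ c} → Ready σ → ⟪ run ⟫ ⊢ σ ⇓[ c ] τ → reg τ rankR < ℓ →
    ∀ g → (∀ i → i < digitCount → g i ≡ arr σ guessA i) → Fails g
  run-fails {σ} {τ} S d r g g≡ rk source sink β source< sink< guided = _ , run-steps S source< sink< (record
    { rk≡     = λ i i<ℓ → trans (sym (g≡ i (early i<ℓ))) (rk≡ i i<ℓ)
    ; forward  = λ i i<ℓ ne → forward i i<ℓ (subst (_≢ 0) (sym (g≡ (ℓ + i) (middle i<ℓ))) ne)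
    ; backward = λ i i<ℓ ez → backward i i<ℓ (trans (g≡ (ℓ + i) (middle i<ℓ)) ez)
    ; bit-yes  = λ i i<3ℓ ne → bit-yes i i<3ℓ (subst (_≢ 0) (sym (g≡ (ℓ + ℓ + i) (late i<3ℓ))) ne)
    ; bit-no   = λ i i<3ℓ ez → bit-no i i<3ℓ (trans (g≡ (ℓ + ℓ + i) (late i<3ℓ)) ez)
    }) d , r
    where
    open Guided guided
    early : ∀ {i} → i < ℓ → i < digitCount
    early i<ℓ = <-≤-trans i<ℓ (m≤m+n ℓ _)
    middle : ∀ {i} → i < ℓ → ℓ + i < digitCount
    middle i<ℓ = +-monoʳ-< ℓ (<-≤-trans i<ℓ (m≤m+n ℓ _))
    late : ∀ {i} → i < 3 * ℓ → ℓ + ℓ + i < digitCount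
    late {i} i<3ℓ = subst (_< digitCount) (sym (+-assoc ℓ ℓ i)) (+-monoʳ-< ℓ (+-monoʳ-< ℓ i<3ℓ))

  -- The advice is read at face value: its digits serve as ranks, directions and bits, wherever they
  -- come from. The final rank then certifies the answer.
  run-succeeds : ∀ {σ τ c} → Ready σ → Digits base digitCount (arr σ guessA) → ⟪ run ⟫ ⊢ σ ⇓[ c ] τ → ℓ ≤ reg τ rankR →
    Solved (on ∘ arr τ deletedA)
  run-succeeds {σ} {τ} S digs d r = ≤-trans (≤-reflexive (∑-cong n λ v v<n → cong bit (sym (deleted≡ v v<n)))) (≤-trans size≤ count≤K) ,
    λ i i<ℓ → request i i<ℓ (true-or-false (on (g (ℓ + i))))
    where
    g : ℕ → ℕ
    g = arr σ guessA
    source sink : ℕ → ℕ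
    source i = if on (g (ℓ + i)) then s i else t i
    sink i = if on (g (ℓ + i)) then t i else s i
    β : ℕ → Bool
    β i = on (g (ℓ + ℓ + i))
    source< : ∀ i → i < ℓ → source i < n
    source< i i<ℓ with on (g (ℓ + i))
    ... | true  = s< i i<ℓ
    ... | false = t< i i<ℓ
    sink< : ∀ i → i < ℓ → sink i < n
    sink< i i<ℓ with on (g (ℓ + i))
    ... | true  = t< i i<ℓ
    ... | false = s< i i<ℓ

    guided : Guided ℓ s t g g source sink β
    guided = record
      { rk≡ = λ _ _ → refl
      ; forward = λ i _ ne → cong (λ b → if b then s i else t i) (on-true ne) , cong (λ b → if b then t i else s i) (on-true ne)
      ; backward = λ i _ ez → cong (λ b → if b then s i else t i) (on-false ez) , cong (λ b → if b then t i else s i) (on-false ez)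
      ; bit-yes = λ i _ → on-true
      ; bit-no = λ i _ → on-false
      }

    open Search n K ℓ adj g source sink using (Sound; sound-steps; initial; X?; Separated)

    final : State
    final = state (characteristic n (on ∘ arr τ deletedA)) (characteristic (n + n) (on ∘ arr τ adoptedA)) (reg τ rankR) (reg τ countR)

    deleted≡ : ∀ v → v < n → X? final v ≡ on (arr τ deletedA v)
    deleted≡ = member-characteristic n (on ∘ arr τ deletedA)

    sound : Sound final
    sound = sound-steps sink< (run-steps S source< sink< guided d) record
      { count≤K = z≤n
      ; size≤ = ≤-reflexive (∑-zero n λ v _ → cong bit (nothing-member n v))
      ; cuts = λ _ ()
      ; rank≤ℓ = z≤n
      }
    open Sound sound

    severed : ∀ i → i < ℓ → Severed (on ∘ arr τ deletedA) (source i) (sink i)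
    -- Rank digits are in base ℓ, so the rank of each request has been completed.
    severed i i<ℓ with cuts (g i) (<-≤-trans rank-digit r)
      where
      rank-digit : g i < ℓ
      rank-digit = [ (λ (_ , b) → subst (g i <_) b (digs i (<-≤-trans i<ℓ (m≤m+n ℓ _)))) , (λ (le , _) → contradiction i<ℓ (≤⇒≯ le)) ]′ (base-value i)
    ... | W , c , inc , exc = W , closed-mono (λ v v<n e → trans (sym (deleted≡ v v<n)) e) c ,
      inc (source i) (<-≤-trans (source< i i<ℓ) (m≤m+n n n)) (i , i<ℓ , ≤-refl , refl) , exc i i<ℓ refl

    request : ∀ i → i < ℓ → on (g (ℓ + i)) ≡ true ⊎ on (g (ℓ + i)) ≡ false →
      Severed (on ∘ arr τ deletedA) (s i) (t i) ⊎ Severed (on ∘ arr τ deletedA) (t i) (s i)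
    request i i<ℓ (inj₁ e) = inj₁ (subst (λ b → Severed _ (if b then s i else t i) (if b then t i else s i)) e (severed i i<ℓ))
    request i i<ℓ (inj₂ e) = inj₂ (subst (λ b → Severed _ (if b then s i else t i) (if b then t i else s i)) e (severed i i<ℓ))

  record Looping (σ : Store) : Set where
    field
      static  : Ready σ
      digits  : Digits base digitCount (arr σ guessA)
      going   : reg σ goR ≡ 1
      unfound : reg σ foundR ≡ 0
      failing : ∀ g → Digits base digitCount g → value base digitCount g < value base digitCount (arr σ guessA) → Fails g

  Result : Store → Set
  Result τ = (reg τ foundR ≢ 0 × Solved (on ∘ arr τ deletedA)) ⊎ (reg τ foundR ≡ 0 × (∀ g → Digits base digitCount g → Fails g))

  attempt-correct : ∀ {σ τ c} → Looping σ → ⟪ attempt ⟫ ⊢ σ ⇓[ c ] τ →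
    (reg τ goR ≡ 0 × Result τ) ⊎ (Looping τ × value base digitCount (arr τ guessA) ≡ suc (value base digitCount (arr σ guessA)))
  attempt-correct {σ} {τ} L (⇓seq {τ = υ} d e) = go e
    where
    open Looping L
    guess≡ : arr υ guessA ≡ arr σ guessA
    guess≡ = arr-frame d guessA refl
    static-υ : Ready υ
    static-υ = static-keep ⟪ run ⟫ refl (frame-of d) static
    digits-υ : Digits base digitCount (arr υ guessA)
    digits-υ = subst (Digits base digitCount) (sym guess≡) digits

    fails-now : reg υ rankR < ℓ → ∀ g → Digits base digitCount g → value base digitCount g < suc (value base digitCount (arr σ guessA)) → Fails g
    fails-now r g dg lt = [ failing g dg , (λ eq → run-fails static d r g (value-injective base digitCount dg digits eq)) ]′ (<-suc-cases lt)

    go : ∀ {τ c} → ⟪ branch (ℓR ′ ⊖ rankR ′) increment (assign foundR (lit 1) ⨟ assign goR (lit 0)) ⟫ ⊢ υ ⇓[ c ] τ →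
      (reg τ goR ≡ 0 × Result τ) ⊎ (Looping τ × value base digitCount (arr τ guessA) ≡ suc (value base digitCount (arr σ guessA)))
    go (⇓else ez (⇓seq ⇓reg ⇓reg)) = inj₁ (refl , inj₁ ((λ ()) , run-succeeds static digits d
      (subst (_≤ reg υ rankR) (Static.ℓ≡ static-υ) (m∸n≡0⇒m≤n ez))))
    go {τ} (⇓then ne d′) = case increment-correct static-υ digits-υ d′ of λ
      { (_ , inj₂ (z , full)) → inj₁ (z , inj₂ (unfound-τ ,
          λ g dg → fails-now rank< g dg (<-≤-trans (value<place base digitCount dg)
              (subst (λ f → place base digitCount ≤ suc (value base digitCount f)) guess≡ full))))
      ; (digits-τ , inj₁ (go≡ , next≡)) → inj₂ (record
          { static = static-keep ⟪ increment ⟫ refl (frame-of d′) static-υ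
          ; digits = digits-τ
          ; going = trans go≡ (trans (reg-frame d goR refl) going)
          ; unfound = unfound-τ
          ; failing = λ g dg lt → fails-now rank< g dg (subst (value base digitCount g <_)
              (trans next≡ (cong (λ f → suc (value base digitCount f)) guess≡)) lt)
          } , trans next≡ (cong (λ f → suc (value base digitCount f)) guess≡)) }
      where
      rank< : reg υ rankR < ℓ
      rank< = subst (reg υ rankR <_) (Static.ℓ≡ static-υ) (≰⇒> (ne ∘ m≤n⇒m∸n≡0))
      unfound-τ : reg τ foundR ≡ 0
      unfound-τ = trans (reg-frame d′ foundR refl) (trans (reg-frame d foundR refl) unfound)

  open Reachability n adj

  -- As the conclusion is ⊥, the reachability matrix and the winning bits may be assumed although
  -- both are available only under double negation. They are encoded as advice whose run must end
  -- both below rank ℓ and at rank ℓ or beyond.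
  all-fail⇒unsolvable : (∀ g → Digits base digitCount g → Fails g) → K ≤ ℓ → ∀ X → size X ≤ K →
    (∀ i → i < ℓ → ¬ (_⇝_ X (s i) (t i)) ⊎ ¬ (_⇝_ X (t i) (s i))) → ⊥
  all-fail⇒unsolvable fails K≤ℓ X small solution =
    reaches X λ (R , reach) → with-reach R reach
    where
    with-reach : ∀ R → Reaches X R → ⊥
    with-reach R reach = good-bits (3 * ℓ) 0 initial (good-initial small K≤ℓ) λ (β , wins) →
      let s′ , steps , r = fails (guess β) (guess-digits β) rk source sink β source< sink< (guided β) in
      <⇒≱ r (wins s′ steps)
      where
      open Ranking X R reach ℓ s t s< t< solution
      open Start X R reach K ℓ rk source sink source< sink< skew
      open Bits n K ℓ adj rk source sink using (good-bits; initial)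

      guess : (ℕ → Bool) → ℕ → ℕ
      guess β i = if i <ᵇ ℓ then rk i else (if i <ᵇ ℓ + ℓ then bit (forward (i ∸ ℓ)) else bit (β (i ∸ (ℓ + ℓ))))

      guess-digits : ∀ β → Digits base digitCount (guess β)
      guess-digits β i _ with i <ᵇ ℓ in eq
      ... | true = rk<ℓ i (<ᵇ-sound eq)
      ... | false with i <ᵇ ℓ + ℓ
      ...   | true  = s≤s (bit≤1 _)
      ...   | false = s≤s (bit≤1 _)

      first : ∀ β i → i < ℓ → guess β i ≡ rk i
      first β i i<ℓ rewrite <ᵇ-complete i<ℓ = refl

      direction : ∀ β i → i < ℓ → guess β (ℓ + i) ≡ bit (forward i)
      direction β i i<ℓ rewrite ≥⇒<ᵇ-false (m≤m+n ℓ i) | <ᵇ-complete (+-monoʳ-< ℓ i<ℓ) | m+n∸m≡n ℓ i = refl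

      decision : ∀ β i → guess β (ℓ + ℓ + i) ≡ bit (β i)
      decision β i rewrite ≥⇒<ᵇ-false {ℓ + ℓ + i} {ℓ} (≤-trans (m≤m+n ℓ ℓ) (m≤m+n (ℓ + ℓ) i)) | ≥⇒<ᵇ-false
          (m≤m+n (ℓ + ℓ) i) | m+n∸m≡n (ℓ + ℓ) i = refl

      bit-true : ∀ {b} → bit b ≢ 0 → b ≡ true
      bit-true {true}  _  = refl
      bit-true {false} ne = contradiction refl ne

      guided : ∀ β → Guided ℓ s t (guess β) rk source sink β
      guided β = record
        { rk≡     = λ i i<ℓ → first β i i<ℓ
        ; forward  = λ i i<ℓ ne → let e = bit-true (λ z → ne (trans (direction β i i<ℓ) z)) in
            cong (λ b → if b then s i else t i) e , cong (λ b → if b then t i else s i) e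
        ; backward = λ i i<ℓ ez → let e = bit≡0 (trans (sym (direction β i i<ℓ)) ez) in
            cong (λ b → if b then s i else t i) e , cong (λ b → if b then t i else s i) e
        ; bit-yes  = λ i _ ne → bit-true (λ z → ne (trans (decision β i) z))
        ; bit-no   = λ i _ ez → bit≡0 (trans (sym (decision β i)) ez)
        }

  -- Running time of the enumeration

  module Halting (K≤ℓ : K ≤ ℓ) where

    M L : ℕ
    M = n ⊔ 1
    L = suc ℓ

    open Timing M L (m≤n⊔m n 1) (s≤s z≤n) public

    register-bounds : ∀ {σ} → reg σ nR ≡ n → reg σ ℓR ≡ ℓ → reg σ KR ≡ K → reg σ NR ≡ n + n →
      reg σ roundsR ≡ suc K → reg σ stagesR ≡ 3 * ℓ → reg σ digitsR ≡ digitCount → Bounds σ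
    register-bounds {σ} n≡ ℓ≡ K≡ N≡ rounds≡ stages≡ digits≡ = bounds
      where
      ℓ≤L : ℓ ≤ L
      ℓ≤L = n≤1+n ℓ
      by : ∀ {a m} c X → a ≡ m → m ≤ c * X → c ≤ 5 → a ≤ 5 * X
      by c X refl m≤ c≤5 = ≤-trans m≤ (*-monoˡ-≤ X c≤5)
      one : ∀ {m X} → m ≤ X → m ≤ 1 * X
      one {X = X} m≤X = ≤-trans m≤X (≤-reflexive (sym (*-identityˡ X)))
      bounds : Bounds σ
      bounds 0 _ = by 1 M n≡ (one (m≤m⊔n n 1)) (≤ᵇ⇒≤ 1 5 tt)
      bounds 1 _ = by 1 L ℓ≡ (one ℓ≤L) (≤ᵇ⇒≤ 1 5 tt)
      bounds 2 _ = by 1 L K≡ (one (≤-trans K≤ℓ ℓ≤L)) (≤ᵇ⇒≤ 1 5 tt)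
      bounds 3 _ = by 2 M N≡ (+-mono-≤ (m≤m⊔n n 1) (one (m≤m⊔n n 1))) (≤ᵇ⇒≤ 2 5 tt)
      bounds 4 _ = by 1 L rounds≡ (one (s≤s K≤ℓ)) (≤ᵇ⇒≤ 1 5 tt)
      bounds 5 _ = by 3 L stages≡ (*-monoʳ-≤ 3 ℓ≤L) (≤ᵇ⇒≤ 3 5 tt)
      bounds 6 _ = by 5 L digits≡ (*-monoʳ-≤ 5 ℓ≤L) ≤-refl
      bounds (suc (suc (suc (suc (suc (suc (suc _))))))) (s≤s (s≤s (s≤s (s≤s (s≤s (s≤s (s≤s ())))))))

    static-bounds : ∀ {σ} → Ready σ → Bounds σ
    static-bounds {σ} S = register-bounds {σ} n≡ ℓ≡ K≡ N≡ rounds≡ stages≡ digits≡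
      where open Static S

    attemptTime : ℕ
    -- Two nested loops over the nodes, inside the loops over flow rounds and stages.
    attemptTime = attemptCost * (M ^ 2 * L ^ 2)

    -- Induction on the number j of advice strings not yet refuted, the current one included.
    loop-result : ∀ j σ → Looping σ → value base digitCount (arr σ guessA) + j ≡ place base digitCount →
      Σ[ u ∈ ℕ ] Σ[ τ ∈ Store ] (while (goR ′) ⟪ attempt ⟫ ⊢ σ ⇓[ u ] τ) × Result τ × u ≤ 2 + j * (2 + attemptTime)
    loop-result zero σ looping eq =
      contradiction (trans (sym (+-identityʳ _)) eq) (<⇒≢ (value<place base digitCount (Looping.digits looping)))
    loop-result (suc j) σ looping eq =
      case halts-within attempt attempt-cost refl refl refl σ (static-bounds (Looping.static looping)) of λ
        (u , υ , d , u≤) → continue u υ d u≤ (attempt-correct looping d)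
      where
      open ≤-Reasoning
      going≢0 : reg σ goR ≢ 0
      going≢0 z = case trans (sym (Looping.going looping)) z of λ ()
      swap : ∀ a b → 2 + a + (2 + b) ≡ 2 + (2 + a + b)
      swap = solve-∀

      continue : ∀ u υ → ⟪ attempt ⟫ ⊢ σ ⇓[ u ] υ → u ≤ attemptTime →
        (reg υ goR ≡ 0 × Result υ) ⊎ (Looping υ × value base digitCount (arr υ guessA) ≡ suc (value base digitCount (arr σ guessA))) →
        Σ[ u ∈ ℕ ] Σ[ τ ∈ Store ] (while (goR ′) ⟪ attempt ⟫ ⊢ σ ⇓[ u ] τ) × Result τ × u ≤ 2 + suc j * (2 + attemptTime)
      continue u υ d u≤ (inj₁ (stopped , result)) = _ , υ , ⇓loop going≢0 d (⇓exit stopped) , result , (begin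
        2 + u + 2                            ≡⟨ +-comm (2 + u) 2 ⟩
        2 + (2 + u)                          ≤⟨ +-monoʳ-≤ 2 (+-monoʳ-≤ 2 u≤) ⟩
        2 + (2 + attemptTime)                ≤⟨ +-monoʳ-≤ 2 (m≤m+n (2 + attemptTime) _) ⟩
        2 + suc j * (2 + attemptTime)        ∎)
      continue u υ d u≤ (inj₂ (looping′ , next≡)) =
        case loop-result j υ looping′ (trans (cong (_+ j) next≡) (trans (sym (+-suc _ j)) eq)) of λ
          (v , τ , e , result , v≤) → _ , τ , ⇓loop going≢0 d e , result , (begin
            2 + u + v                                            ≤⟨ +-mono-≤ (+-monoʳ-≤ 2 u≤) v≤ ⟩
            2 + attemptTime + (2 + j * (2 + attemptTime))        ≡⟨ swap attemptTime (j * (2 + attemptTime)) ⟩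
            2 + suc j * (2 + attemptTime)                        ∎)

    place≡ : place base digitCount ≡ 2 ^ (4 * ℓ) * ℓ ^ ℓ
    place≡ = trans (cong (place base) (+-comm ℓ (4 * ℓ))) (trans (place-+ base ℓ (4 * ℓ))
      (cong₂ _*_ (place-const _ 2 (4 * ℓ) λ i _ → [ (λ (lt , _) → contradiction lt (m+n≮n i ℓ)) , proj₂ ]′ (base-value (i + ℓ)))
                 (place-const base ℓ ℓ λ i i<ℓ → [ proj₂ , (λ (le , _) → contradiction i<ℓ (≤⇒≯ le)) ]′ (base-value i))))

-- Digraphs and lists

extend : ∀ {A : Set} n → (Fin n → A) → A → ℕ → A
extend n f a i with i <? n
... | yes i<n = f (fromℕ< i<n)
... | no _    = a

extend-toℕ : ∀ {A : Set} {n} (f : Fin n → A) {a} i → extend n f a (toℕ i) ≡ f i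
extend-toℕ {n = n} f i with toℕ i <? n
... | yes i<n = cong f (fromℕ<-toℕ i i<n)
... | no i≮n  = contradiction (toℕ<n i) i≮n

arcs : ∀ {n} → Digraph n → ℕ → ℕ → Bool
arcs {n} D u v = extend n (λ u → extend n (D u) false v) false u

arcs-toℕ : ∀ {n} (D : Digraph n) u v → arcs D (toℕ u) (toℕ v) ≡ D u v
arcs-toℕ {n} D u v = trans (extend-toℕ (λ u → extend n (D u) false (toℕ v)) u) (extend-toℕ (D u) v)

nth-map-tabulate : ∀ {A : Set} {n} (f : A → ℕ) (h : Fin n → A) v → nth (map f (tabulateₗ h)) (toℕ v) ≡ f (h v)
nth-map-tabulate f h zero    = refl
nth-map-tabulate f h (suc v) = nth-map-tabulate f (h ∘ suc) v

nth-++ˡ : ∀ xs ys {i} → i < length xs → nth (xs ++ ys) i ≡ nth xs i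
nth-++ˡ (x ∷ xs) ys {zero}  _         = refl
nth-++ˡ (x ∷ xs) ys {suc i} (s<s i<l) = nth-++ˡ xs ys i<l

nth-++ʳ : ∀ xs ys i → nth (xs ++ ys) (length xs + i) ≡ nth ys i
nth-++ʳ []       ys i = refl
nth-++ʳ (x ∷ xs) ys i = nth-++ʳ xs ys i

nth-product : ∀ {m n} {A B : Set} (f : A → B → ℕ) (g : Fin m → A) (h : Fin n → B) u v →
  nth (cartesianProductWith f (tabulateₗ g) (tabulateₗ h)) (toℕ u * n + toℕ v) ≡ f (g u) (h v)
nth-product {n = n} f g h zero v = trans (nth-++ˡ (map (f (g zero)) (tabulateₗ h)) _ v<)
    (nth-map-tabulate (f (g zero)) h v)
  where
  v< : toℕ v < length (map (f (g zero)) (tabulateₗ h))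
  v< = subst (toℕ v <_) (sym (trans (length-map _ (tabulateₗ h)) (length-tabulate h))) (toℕ<n v)
nth-product {n = n} f g h (suc u) v = begin
  nth (row ++ rest) (n + toℕ u * n + toℕ v)               ≡⟨ cong (nth (row ++ rest)) (+-assoc n _ _) ⟩
  nth (row ++ rest) (n + (toℕ u * n + toℕ v))             ≡⟨ cong (λ l → nth (row ++ rest) (l + (toℕ u * n + toℕ v)))
                                                                        (sym (trans (length-map _ (tabulateₗ h)) (length-tabulate h))) ⟩
  nth (row ++ rest) (length row + (toℕ u * n + toℕ v))    ≡⟨ nth-++ʳ row rest _ ⟩
  nth rest (toℕ u * n + toℕ v)                                      ≡⟨ nth-product f (g ∘ suc) h u v ⟩
  f (g (suc u)) (h v)                                               ∎
  where
  open ≡-Reasoning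
  row rest : List ℕ
  row = map (f (g zero)) (tabulateₗ h)
  rest = cartesianProductWith f (tabulateₗ (g ∘ suc)) (tabulateₗ h)

nth-all : ∀ {A : Set} (f g : A → ℕ) (Q : ℕ → ℕ → Set) (xs : List A) →
  (∀ i → i < length xs → Q (nth (map f xs) i) (nth (map g xs) i)) → All (λ x → Q (f x) (g x)) xs
nth-all f g Q []       q = []
nth-all f g Q (x ∷ xs) q = q 0 z<s ∷ nth-all f g Q xs λ i i<l → q (suc i) (s<s i<l)

all-nth : ∀ {A : Set} (f g : A → ℕ) (Q : ℕ → ℕ → Set) {xs : List A} → All (λ x → Q (f x) (g x)) xs →
  ∀ i → i < length xs → Q (nth (map f xs) i) (nth (map g xs) i)
all-nth f g Q (q ∷ qs) zero    _         = q
all-nth f g Q (q ∷ qs) (suc i) (s<s i<l) = all-nth f g Q qs i i<l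

∈-tabulate : ∀ {n} (f : Fin n → Bool) {v} → f v ≡ true → v ∈ tabulate f
∈-tabulate f {v} eq = Vec.lookup⇒[]= v (tabulate f) (trans (Vec.lookup∘tabulate f v) eq)

size-tabulate : ∀ n (f : ℕ → Bool) → ∣ tabulate {n = n} (f ∘ toℕ) ∣ ≡ ∑ n (bit ∘ f)
size-tabulate zero    f = refl
size-tabulate (suc n) f with f 0
... | true  = cong suc (size-tabulate n (f ∘ suc))
... | false = size-tabulate n (f ∘ suc)

false⇒∉ : ∀ {n} (Y : Subset n) {v} → Vec.lookup Y v ≡ false → v ∉ Y
false⇒∉ Y e v∈Y = true≢false (Vec.[]=⇒lookup v∈Y) e

module _ {n} {D : Digraph n} {P : Fin n → Set} where

  path-suffix : ∀ {u v w vs} → Path D v w vs → All P vs → u ∈ₗ vs → Σ[ ws ∈ List (Fin n) ] (Path D u w ws × All P ws)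
  path-suffix p a (Any.here refl) with p
  ... | here , _     = _ , p , a
  ... | step _ _ , _ = _ , p , a
  path-suffix (step _ w , _ ∷ uniq) (_ ∷ a) (Any.there i) = path-suffix (w , uniq) a i

  -- `CutsAll` speaks of simple paths, but reachability yields walks. When the first vertex occurs
  -- again, the detour is dropped, which introduces no new vertices.
  walk⇒path : ∀ {u w vs} → Walk D u w vs → All P vs → Σ[ ws ∈ List (Fin n) ] (Path D u w ws × All P ws)
  walk⇒path here a = _ , (here , ([] ∷ [])) , a
  walk⇒path {u} (step e w) (p ∷ a) with walk⇒path w a
  ... | ws , (w′ , uniq) , a′ with Any.any? (u Fin.≟_) ws
  ...   | yes u∈ws = path-suffix (w′ , uniq) a′ u∈ws
  ...   | no u∉ws  = u ∷ ws , (step e w′ , All.¬Any⇒All¬ ws u∉ws ∷ uniq) , p ∷ a′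

reach⇒walk : ∀ {n} (D : Digraph n) (Y : Subset n) {a b} →
  Reachability._⇝_ n (arcs D) (extend n (Vec.lookup Y) false) a b →
  ∀ u v → toℕ u ≡ a → toℕ v ≡ b → Σ[ vs ∈ List (Fin n) ] (Walk D u v vs × All (_∉ Y) vs)
reach⇒walk {n} D Y (Reachability.stop _ Xu) u v refl eq with toℕ-injective {i = v} {u} eq
... | refl = _ , here , (false⇒∉ Y (trans (sym (extend-toℕ (Vec.lookup Y) u)) Xu) ∷ [])
reach⇒walk {n} D Y (Reachability.move {w = w} u<n Xu e p) u v refl eq
  with reach⇒walk D Y p (fromℕ< w<n) v (toℕ-fromℕ< w<n) eq
  where
  w<n : w < n
  w<n = Reachability.⇝-bounded n (arcs D) _ (Reachability.⇝-source n (arcs D) _ p)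
... | vs , walk , avoid = u ∷ vs , step (Equivalence.from T-≡
    (trans (sym (trans (cong (arcs D (toℕ u)) (sym (toℕ-fromℕ< _))) (arcs-toℕ D u _))) e)) walk ,
  false⇒∉ Y (trans (sym (extend-toℕ (Vec.lookup Y) u)) Xu) ∷ avoid

cuts⇒unreachable : ∀ {n} (D : Digraph n) (Y : Subset n) u v → CutsAll D Y u v →
  ¬ Reachability._⇝_ n (arcs D) (extend n (Vec.lookup Y) false) (toℕ u) (toℕ v)
cuts⇒unreachable D Y u v cuts p with reach⇒walk D Y p u v refl refl
... | vs , walk , avoid with walk⇒path walk avoid
...   | ws , path , avoid′ = All.All¬⇒¬Any avoid′ (cuts path)

-- Membership in W passes from in-node to out-node of each vertex not deleted, as there is no
-- boundary, and along each arc, as there is no leak.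
closed-walk : ∀ {n K} (D : Digraph n) (X W : ℕ → Bool) → Network.Closed n K (arcs D) X W →
  ∀ {u v vs} → Walk D u v vs → ¬ Any (_∈ tabulate (X ∘ toℕ)) vs → W (toℕ u) ≡ true → W (n + toℕ v) ≡ true
closed-walk {n} {K} D X W c = go
  where
  open Network n K (arcs D)
  leave : ∀ {u : Fin n} → ¬ (u ∈ tabulate (X ∘ toℕ)) → W (toℕ u) ≡ true → W (n + toℕ u) ≡ true
  leave {u} u∉X Wu with W (n + toℕ u) in eq
  ... | true  = refl
  ... | false = contradiction (no-boundary c (toℕ u) (toℕ<n u)) (true≢false (∧-join Wu
    (∧-join (not-false eq) (not-false (≢true⇒false λ e → u∉X (∈-tabulate (X ∘ toℕ) e))))))
  go : ∀ {u v vs} → Walk D u v vs → ¬ Any (_∈ tabulate (X ∘ toℕ)) vs → W (toℕ u) ≡ true → W (n + toℕ v) ≡ true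
  go here avoid Wu = leave (avoid ∘ Any.here) Wu
  go {u} (step {v = v} e w) avoid Wu = go w (avoid ∘ Any.there) enter
    where
    enter : W (toℕ v) ≡ true
    enter with W (toℕ v) in eq
    ... | true  = refl
    ... | false = contradiction (no-leak c (toℕ u) (toℕ v) (toℕ<n u) (toℕ<n v))
      (true≢false (∧-join (∧-join (leave (avoid ∘ Any.here) Wu) (not-false eq)) (trans (arcs-toℕ D u v) (Equivalence.to T-≡ e))))

severed⇒cuts : ∀ {n K} (D : Digraph n) (X W : ℕ → Bool) → Network.Closed n K (arcs D) X W → ∀ u v →
  W (toℕ u) ≡ true → W (n + toℕ v) ≡ false → CutsAll D (tabulate (X ∘ toℕ)) u v
severed⇒cuts {n} {K} D X W c u v Wu Wv {vs} (walk , _) with Any.any? (λ w → w Subset.∈? tabulate (X ∘ toℕ)) vs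
... | yes hit  = hit
... | no avoid = contradiction Wv (true≢false (closed-walk {K = K} D X W c walk avoid Wu))

-- Since ℓ + 1 ≤ 2^ℓ, the left side is at most (64 ℓ)^ℓ, and for ℓ ≥ 16 already 64 ℓ ≤ 4 ℓ^2 ≤ (2 ℓ
-- + 1)^2. For ℓ ≤ 16 it is at most 1024^16, the value of `slack`.
exponential-slack : ∀ ℓ → 2 ^ (4 * ℓ) * ℓ ^ ℓ * suc ℓ ^ 2 ≤ slack * (2 * ℓ + 1) ^ (2 * ℓ)
exponential-slack ℓ = begin
  2 ^ (4 * ℓ) * ℓ ^ ℓ * suc ℓ ^ 2            ≤⟨ *-monoʳ-≤ (2 ^ (4 * ℓ) * ℓ ^ ℓ) (^-monoˡ-≤ 2 (1+m≤2^m ℓ)) ⟩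
  2 ^ (4 * ℓ) * ℓ ^ ℓ * (2 ^ ℓ) ^ 2
    ≡⟨ cong₂ (λ a b → a * ℓ ^ ℓ * b) (sym (^-*-assoc 2 4 ℓ)) (trans (^-*-assoc 2 ℓ 2) (trans (cong (2 ^_) (*-comm ℓ 2)) (sym (^-*-assoc 2 2 ℓ)))) ⟩
  16 ^ ℓ * ℓ ^ ℓ * 4 ^ ℓ                     ≡⟨ cong (_* 4 ^ ℓ) (sym (^-distribʳ-* ℓ 16 ℓ)) ⟩
  (16 * ℓ) ^ ℓ * 4 ^ ℓ                       ≡⟨ sym (^-distribʳ-* ℓ (16 * ℓ) 4) ⟩
  (16 * ℓ * 4) ^ ℓ                           ≤⟨ small-or-large (≤-total ℓ 16) ⟩
  slack * ((2 * ℓ + 1) ^ 2) ^ ℓ    ≡⟨ cong (slack *_) (^-*-assoc (2 * ℓ + 1) 2 ℓ) ⟩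
  slack * (2 * ℓ + 1) ^ (2 * ℓ)    ∎
  where
  open ≤-Reasoning
  1+m≤2^m : ∀ m → suc m ≤ 2 ^ m
  1+m≤2^m zero    = ≤-refl
  1+m≤2^m (suc m) = +-mono-≤ (≤-trans (s≤s z≤n) (1+m≤2^m m)) (≤-trans (1+m≤2^m m) (m≤m+n _ 0))

  ^-distribʳ-* : ∀ m a b → (a * b) ^ m ≡ a ^ m * b ^ m
  ^-distribʳ-* zero    a b = refl
  ^-distribʳ-* (suc m) a b = trans (cong (a * b *_) (^-distribʳ-* m a b)) (interchange a b (a ^ m) (b ^ m))
    where
    interchange : ∀ a b c d → a * b * (c * d) ≡ a * c * (b * d)
    interchange = solve-∀

  square-pos : 1 ≤ (2 * ℓ + 1) ^ 2
  square-pos = subst (1 ≤_) (sym (expand ℓ)) (m≤n+m 1 _)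
    where
    expand : ∀ ℓ → (2 * ℓ + 1) * ((2 * ℓ + 1) * 1) ≡ 4 * ℓ * ℓ + 4 * ℓ + 1
    expand = solve-∀

  small-or-large : ℓ ≤ 16 ⊎ 16 ≤ ℓ → (16 * ℓ * 4) ^ ℓ ≤ slack * ((2 * ℓ + 1) ^ 2) ^ ℓ
  small-or-large (inj₁ ℓ≤16) = begin
    (16 * ℓ * 4) ^ ℓ                           ≤⟨ ^-monoˡ-≤ ℓ (*-monoˡ-≤ 4 (*-monoʳ-≤ 16 ℓ≤16)) ⟩
    1024 ^ ℓ                                   ≤⟨ ^-monoʳ-≤ 1024 ℓ≤16 ⟩
    1024 ^ 16                                  ≤⟨ slack-large ⟩
    slack                                      ≡⟨ sym (*-identityʳ slack) ⟩
    slack * 1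
      ≤⟨ *-monoʳ-≤ slack (subst (_≤ ((2 * ℓ + 1) ^ 2) ^ ℓ) (^-zeroˡ ℓ) (^-monoˡ-≤ ℓ square-pos)) ⟩
    slack * ((2 * ℓ + 1) ^ 2) ^ ℓ              ∎
  small-or-large (inj₂ 16≤ℓ) = begin
    (16 * ℓ * 4) ^ ℓ                           ≤⟨ ^-monoˡ-≤ ℓ square ⟩
    ((2 * ℓ + 1) ^ 2) ^ ℓ                      ≡⟨ sym (*-identityˡ (((2 * ℓ + 1) ^ 2) ^ ℓ)) ⟩
    1 * ((2 * ℓ + 1) ^ 2) ^ ℓ                  ≤⟨ *-monoˡ-≤ (((2 * ℓ + 1) ^ 2) ^ ℓ) slack-pos ⟩
    slack * ((2 * ℓ + 1) ^ 2) ^ ℓ              ∎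
    where
    square : 16 * ℓ * 4 ≤ (2 * ℓ + 1) ^ 2
    square = begin
      16 * ℓ * 4                    ≤⟨ *-monoˡ-≤ 4 (*-monoˡ-≤ ℓ 16≤ℓ) ⟩
      ℓ * ℓ * 4                     ≤⟨ m≤m+n (ℓ * ℓ * 4) (4 * ℓ + 1) ⟩
      ℓ * ℓ * 4 + (4 * ℓ + 1)       ≡⟨ expand ℓ ⟩
      (2 * ℓ + 1) ^ 2               ∎
      where
      expand : ∀ ℓ → ℓ * ℓ * 4 + (4 * ℓ + 1) ≡ (2 * ℓ + 1) * ((2 * ℓ + 1) * 1)
      expand = solve-∀

truncate-≤ : ∀ k ℓ → k ∸ (k ∸ ℓ) ≤ ℓ
truncate-≤ k ℓ with ≤-total ℓ k
... | inj₁ ℓ≤k = ≤-reflexive (m∸[m∸n]≡n ℓ≤k)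
... | inj₂ k≤ℓ = ≤-trans (m∸n≤m k (k ∸ ℓ)) k≤ℓ

truncate-greatest : ∀ {k ℓ m} → m ≤ k → m ≤ ℓ → m ≤ k ∸ (k ∸ ℓ)
truncate-greatest {k} {ℓ} {m} m≤k m≤ℓ with ≤-total ℓ k
... | inj₁ ℓ≤k = subst (m ≤_) (sym (m∸[m∸n]≡n ℓ≤k)) m≤ℓ
... | inj₂ k≤ℓ = subst (m ≤_) (sym (cong (k ∸_) (m≤n⇒m∸n≡0 k≤ℓ))) m≤k

collect : ℕ → (ℕ → ℕ) → ℕ → Bool
collect m s v = anyBelow m λ i → s i ≡ᵇ v

collect-size : ∀ n m (s : ℕ → ℕ) → (∀ i → i < m → s i < n) → ∑ n (bit ∘ collect m s) ≤ m
collect-size n zero    s s< = ≤-reflexive (∑-zero n λ _ _ → refl)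
collect-size n (suc m) s s< = ≤-trans (size-insert n (s 0) (collect m (s ∘ suc)) (s< 0 z<s))
  (s≤s (collect-size n m (s ∘ suc) λ i i<m → s< (suc i) (s<s i<m)))

-- The program on a given instance

module Solve (I : Instance) where

  open Instance I

  K : ℕ
  K = k ∸ (k ∸ ℓ)

  K≤ℓ : K ≤ ℓ
  K≤ℓ = truncate-≤ k ℓ

  s t offset : ℕ → ℕ
  s = nth (map (λ r → toℕ (proj₁ r)) C)
  t = nth (map (λ r → toℕ (proj₂ r)) C)
  offset u = u * n

  cell-injective : ∀ {x y x′ y′} → x < n + n → y < n + n → x′ < n + n → y′ < n + n →
    offset x + offset x + y ≡ offset x′ + offset x′ + y′ → x ≡ x′ × y ≡ y′
  cell-injective {x} {y} {x′} {y′} _ y< _ y′< eq =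
    case quotient-unique x x′ y< y′< (trans (sym (commute x n y)) (trans eq (commute x′ n y′))) of λ (p , q) → q , p
    where
    commute : ∀ x n y → x * n + x * n + y ≡ y + x * (n + n)
    commute = solve-∀

  s< : ∀ i → i < ℓ → s i < n
  s< = all-nth (λ r → toℕ (proj₁ r)) (λ r → toℕ (proj₁ r)) (λ a _ → a < n) (All.universal (λ r → toℕ<n (proj₁ r)) C)

  t< : ∀ i → i < ℓ → t i < n
  t< = all-nth (λ r → toℕ (proj₂ r)) (λ r → toℕ (proj₂ r)) (λ a _ → a < n) (All.universal (λ r → toℕ<n (proj₂ r)) C)

  open Enumeration n K ℓ (arcs D) s t offset cell-injective s< t<
  open Halting K≤ℓ

  configured : Store
  configured =
    let σ₁ = setReg (input I) KR (k ∸ (k ∸ ℓ))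
        σ₂ = setReg σ₁ NR (n + n)
        σ₃ = setReg σ₂ roundsR (K + 1)
        σ₄ = setReg σ₃ stagesR (ℓ + ℓ + ℓ)
        σ₅ = setReg σ₄ digitsR (ℓ + ℓ + ℓ + ℓ + ℓ)
    in setReg σ₅ goR 1

  configure : registers ⊢ input I ⇓[ 28 ] configured
  configure = ⇓seq ⇓reg (⇓seq ⇓reg (⇓seq ⇓reg (⇓seq ⇓reg (⇓seq ⇓reg ⇓reg))))

  triple : ∀ m → m + m + m ≡ 3 * m
  triple = solve-∀

  quintuple : ∀ m → m + m + m + m + m ≡ 5 * m
  quintuple = solve-∀

  offsets-correct : ∀ {τ c} → ⟪ offsets ⟫ ⊢ configured ⇓[ c ] τ → ∀ u → u < n + n → arr τ offsetA u ≡ u * n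
  offsets-correct {τ} d u u<N = last u (<⇒≤ u<N)
    where
    Inv : ℕ → Store → Set
    Inv i υ = ∀ u → u ≤ i → arr υ offsetA u ≡ u * n
    last : Inv (n + n) τ
    last = for-invariant Inv (write offsetA (xR ′ ⊕ lit 1) (offsetA ⟦ xR ′ ⟧ ⊕ nR ′)) d refl refl refl (λ { zero z≤n → refl })
      λ { {i} {υ} _ x≡i F ⇓arr inv u u≤1+i →
          let x+1≡ = trans (+-comm (reg υ xR) 1) (cong suc x≡i) in
          [ (λ u<1+i → trans (set-miss λ e → <-irrefl (trans (sym e) x+1≡) u<1+i) (inv u (s≤s⁻¹ u<1+i)))
          , (λ { refl → trans (set-hit x+1≡)
              (trans (cong₂ _+_ (trans (cong (arr υ offsetA) x≡i) (inv i ≤-refl)) (regs F nR refl))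
              (+-comm (i * n) n)) }) ]′
          (m≤n⇒m<n∨m≡n u≤1+i) }

  ready : ∀ {τ c} → ⟪ offsets ⟫ ⊢ configured ⇓[ c ] τ → Looping τ
  ready {τ} d = record
    { static = record
      { n≡ = reg-frame d nR refl ; ℓ≡ = reg-frame d ℓR refl ; K≡ = reg-frame d KR refl ; N≡ = reg-frame d NR refl
      ; rounds≡ = trans (reg-frame d roundsR refl) (+-comm K 1)
      ; stages≡ = trans (reg-frame d stagesR refl) (triple ℓ)
      ; digits≡ = trans (reg-frame d digitsR refl) (quintuple ℓ)
      ; arcs≡ = λ u v u<n v<n → trans (cong (λ f → f (u * n + v)) (arr-frame d adjA refl)) (matrix u v u<n v<n)
      ; s≡ = λ i _ → cong (λ f → f i) (arr-frame d sA refl)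
      ; t≡ = λ i _ → cong (λ f → f i) (arr-frame d tA refl)
      ; offset≡ = offsets-correct d
      }
    ; digits = λ i i<D → subst (_< base i) (sym (blank i)) (base-pos i i<D)
    ; going = reg-frame d goR refl
    ; unfound = reg-frame d foundR refl
    ; failing = λ g _ lt → ⊥-elim (n≮0 (subst (value base digitCount g <_) (value-zero base digitCount (λ i _ → blank i)) lt))
    }
    where
    blank : ∀ i → arr τ guessA i ≡ 0
    blank i = cong (λ f → f i) (arr-frame d guessA refl)
    base-pos : ∀ i → i < digitCount → 0 < base i
    base-pos i i<D = [ (λ (i<ℓ , b) → subst (0 <_) (sym b) (≤-<-trans z≤n i<ℓ)) , (λ (_ , b) → subst (0 <_) (sym b) z<s) ]′ (base-value i)
    matrix : ∀ u v → u < n → v < n → arr (input I) adjA (u * n + v) ≡ bit (arcs D u v)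
    matrix u v u<n v<n = begin
      arr (input I) adjA (u * n + v)
        ≡⟨ cong₂ (λ a b → arr (input I) adjA (a * n + b)) (sym (toℕ-fromℕ< u<n)) (sym (toℕ-fromℕ< v<n)) ⟩
      arr (input I) adjA (toℕ (fromℕ< u<n) * n + toℕ (fromℕ< v<n))
        ≡⟨ nth-product (λ u v → bit (D u v)) id id (fromℕ< u<n) (fromℕ< v<n) ⟩
      bit (D (fromℕ< u<n) (fromℕ< v<n))
        ≡⟨ cong bit (sym (arcs-toℕ D (fromℕ< u<n) (fromℕ< v<n))) ⟩
      bit (arcs D (toℕ (fromℕ< u<n)) (toℕ (fromℕ< v<n)))
        ≡⟨ cong₂ (λ a b → bit (arcs D a b)) (toℕ-fromℕ< u<n) (toℕ-fromℕ< v<n) ⟩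
      bit (arcs D u v)                                     ∎
      where open ≡-Reasoning

  solved⇒solution : ∀ X → Solved X → IsSolution I (tabulate (X ∘ toℕ))
  solved⇒solution X (small , severed) =
    ≤-trans (≤-reflexive (size-tabulate n X)) (≤-trans small (m∸n≤m k (k ∸ ℓ))) ,
    All.map (λ { {u , v} (inj₁ (W , c , Wu , Wv)) → inj₁ λ {vs} → severed⇒cuts {K = K} D X W c u v Wu Wv {vs}
               ; {u , v} (inj₂ (W , c , Wv , Wu)) → inj₂ λ {vs} → severed⇒cuts {K = K} D X W c v u Wv Wu {vs} })
      (nth-all (λ r → toℕ (proj₁ r)) (λ r → toℕ (proj₂ r)) (λ a b → Severed X a b ⊎ Severed X b a) C severed)

  Unreachable : (ℕ → Bool) → ℕ → ℕ → Set
  Unreachable X a b = ¬ (Reachability._⇝_ n (arcs D) X a b)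

  -- A solution with at least ℓ vertices forces k ≥ ℓ, hence K = ℓ, and can be exchanged for the set
  -- of first endpoints of the requests. Smaller solutions fit into K as they are.
  unsolvable : (∀ g → Digits base digitCount g → Fails g) → ∀ Y → ¬ IsSolution I Y
  unsolvable fails Y (small , cuts) with ≤-total ∣ Y ∣ ℓ
  ... | inj₁ Y≤ℓ = all-fail⇒unsolvable fails K≤ℓ X (truncate-greatest (subst (_≤ k) size≡ small) (subst (_≤ ℓ) size≡ Y≤ℓ))
    (all-nth (λ r → toℕ (proj₁ r)) (λ r → toℕ (proj₂ r)) (λ a b → Unreachable X a b ⊎ Unreachable X b a)
      (All.map (λ { {u , v} (inj₁ c) → inj₁ (cuts⇒unreachable D Y u v λ {vs} → c {vs}) ; {u , v} (inj₂ c) →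
          inj₂ (cuts⇒unreachable D Y v u λ {vs} → c {vs}) }) cuts))
    where
    X : ℕ → Bool
    X = extend n (Vec.lookup Y) false
    size≡ : ∣ Y ∣ ≡ ∑ n (bit ∘ X)
    size≡ = trans (cong ∣_∣ (sym (trans (Vec.tabulate-cong (λ v → extend-toℕ (Vec.lookup Y) v)) (Vec.tabulate∘lookup Y)))) (size-tabulate n X)
  ... | inj₂ ℓ≤Y = all-fail⇒unsolvable fails K≤ℓ (collect ℓ s)
    (≤-trans (collect-size n ℓ s s<) (truncate-greatest (≤-trans ℓ≤Y small) ≤-refl))
    λ i i<ℓ → inj₁ λ p → avoided (Reachability.⇝-source n (arcs D) _ p) (anyBelow-true ℓ _ i i<ℓ (≡ᵇ-refl (s i)))
    where
    avoided : ∀ {X a} → Reachability._⇝_ n (arcs D) X a a → X a ≢ true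
    avoided (Reachability.stop _ e)     = λ e′ → true≢false e′ e
    avoided (Reachability.move _ e _ _) = λ e′ → true≢false e′ e

  correct : ∀ {τ} → Result τ → CorrectAnswer I (output n (setReg τ nR (reg τ foundR)))
  correct {τ} (inj₁ (found , solved)) with reg τ foundR
  ... | zero  = contradiction refl found
  ... | suc _ = solved⇒solution (on ∘ arr τ deletedA) solved
  correct {τ} (inj₂ (unfound , fails)) rewrite unfound = unsolvable fails

  constant : ℕ
  -- The 34 consists of 28 for the registers, 2 for the last test of the outer loop, 2 for the
  -- output and 2 for the test before each attempt.
  constant = 34 + offsetsCost + attemptCost

  time-bound : ∀ {o u} → o ≤ offsetsCost * (M ^ 1 * L ^ 0) → u ≤ 2 + place base digitCount * (2 + attemptTime) →
    28 + (o + (u + 2)) ≤ (constant * slack) * bound I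
  time-bound {o} {u} o≤ u≤ = begin
    28 + (o + (u + 2))
      ≤⟨ +-monoʳ-≤ 28 (+-mono-≤ o≤ (+-monoˡ-≤ 2 u≤)) ⟩
    28 + (offsetsCost * (M ^ 1 * L ^ 0) + (2 + P * (2 + attemptCost * V) + 2))
      ≤⟨ +-monoʳ-≤ 28 (+-monoˡ-≤ _ (*-monoʳ-≤ (offsetsCost) offsets≤)) ⟩
    28 + (offsetsCost * (P * V) + (2 + P * (2 + attemptCost * V) + 2))
      ≡⟨ expand (offsetsCost) (attemptCost) P V ⟩
    32 + 2 * P + offsetsCost * (P * V) + attemptCost * (P * V)
      ≤⟨ +-monoˡ-≤ (attemptCost * (P * V)) (+-monoˡ-≤ (offsetsCost * (P * V)) (+-mono-≤
           (≤-trans (≤-reflexive (sym (*-identityʳ 32))) (*-monoʳ-≤ 32 (*-mono-≤ P≥1 V≥1)))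
           (*-monoʳ-≤ 2 (≤-trans (≤-reflexive (sym (*-identityʳ P))) (*-monoʳ-≤ P V≥1))))) ⟩
    32 * (P * V) + 2 * (P * V) + offsetsCost * (P * V) + attemptCost * (P * V)
      ≡⟨ collect-terms (offsetsCost) (attemptCost) (P * V) ⟩
    constant * (P * V)
      ≤⟨ *-monoʳ-≤ constant PV≤ ⟩
    constant * (slack * bound I)
      ≡⟨ sym (*-assoc constant slack (bound I)) ⟩
    constant * slack * bound I ∎
    where
    open ≤-Reasoning
    P V : ℕ
    P = place base digitCount
    V = M ^ 2 * L ^ 2
    V≥1 : 1 ≤ V
    V≥1 = *-mono-≤ (pow-pos 2 (m≤n⊔m n 1)) (pow-pos {L} 2 (s≤s z≤n))
    P≥1 : 1 ≤ P
    P≥1 = ≤-<-trans z≤n (value<place base digitCount (λ i i<D → [ (λ (i<ℓ , b) → subst (0 <_) (sym b)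
        (≤-<-trans z≤n i<ℓ)) , (λ (_ , b) → subst (0 <_) (sym b) z<s) ]′ (base-value i)))
    offsets≤ : M ^ 1 * L ^ 0 ≤ P * V
    offsets≤ = ≤-trans (*-mono-≤ (^-monoʳ-≤ M ⦃ >-nonZero (m≤n⊔m n 1) ⦄ {1} {2} (s≤s z≤n)) (^-monoʳ-≤ L {0} {2} z≤n))
      (≤-trans (≤-reflexive (sym (*-identityˡ V))) (*-monoˡ-≤ V P≥1))
    expand : ∀ a b P V → 28 + (a * (P * V) + (2 + P * (2 + b * V) + 2)) ≡ 32 + 2 * P + a * (P * V) + b * (P * V)
    expand = solve-∀
    collect-terms : ∀ a b X → 32 * X + 2 * X + a * X + b * X ≡ (34 + a + b) * X
    collect-terms = solve-∀
    PV≤ : P * V ≤ slack * bound I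
    PV≤ = begin
      P * (M ^ 2 * L ^ 2)                                       ≡⟨ cong (_* (M ^ 2 * L ^ 2)) place≡ ⟩
      2 ^ (4 * ℓ) * ℓ ^ ℓ * (M ^ 2 * L ^ 2)
        ≡⟨ shuffle (2 ^ (4 * ℓ) * ℓ ^ ℓ) (M ^ 2) (L ^ 2) ⟩
      2 ^ (4 * ℓ) * ℓ ^ ℓ * L ^ 2 * M ^ 2                        ≤⟨ *-monoˡ-≤ (M ^ 2) (exponential-slack ℓ) ⟩
      slack * (2 * ℓ + 1) ^ (2 * ℓ) * M ^ 2            ≡⟨ *-assoc slack _ _ ⟩
      slack * ((2 * ℓ + 1) ^ (2 * ℓ) * M ^ 2)          ≤⟨ *-monoʳ-≤ slack (*-monoˡ-≤ (M ^ 2)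
                                                                      (≤-trans (grow ((2 * ℓ + 1) ^ (2 * ℓ)) (m^n>0 4 k))
                                                                               (grow ((2 * ℓ + 1) ^ (2 * ℓ) * 4 ^ k) (^-monoˡ-≤ 3 (m≤n⊔m k 1))))) ⟩
      slack * bound I                                 ∎
      where
      shuffle : ∀ a b c → a * (b * c) ≡ a * c * b
      shuffle = solve-∀
      grow : ∀ a {b} → 1 ≤ b → a ≤ a * b
      grow a b≥1 = ≤-trans (≤-reflexive (sym (*-identityʳ a))) (*-monoʳ-≤ a b≥1)

  solves : SolvesInTime multicut (λ J → (constant * slack) * bound J) I
  solves = case halts-within offsets offsets-cost refl refl refl configured
      (register-bounds {configured} refl refl refl refl (+-comm K 1) (triple ℓ) (quintuple ℓ)) of λ
    (o , σ , d , o≤) → case loop-result (place base digitCount) σ (ready d)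
        (cong (_+ place base digitCount) (value-zero base digitCount λ i _ → cong (λ f → f i) (arr-frame d guessA refl))) of λ
      (u , τ , e , result , u≤) →
        _ , _ , ⇓seq configure (⇓seq d (⇓seq e ⇓reg)) , correct {τ} result , time-bound o≤ u≤

theorem7 : Σ[ p ∈ Program ] Σ[ c ∈ ℕ ] ((I : Instance) → SolvesInTime p (λ J → c * bound J) I)
theorem7 = multicut , (34 + offsetsCost + attemptCost) * slack , Solve.solves
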